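{- Let $d\ge 2$. For every integer $m\ge 2d$ there exists a probability measure $\mu$ on $\mathbb{R}^d$, absolutely continuous with respect to Lebesgue measure, that cannot be partitioned into $2m$ equal parts by an $m$-fan; that is, for every set of $m$ hyperplanes in $\mathbb{R}^d$ all containing a common $(d-2)$-flat, it is not the case that the complement of their union consists of $2m$ parts each of $\mu$-measure $\frac{1}{2m}$.
   Context: A $(d-2)$-flat is a $(d-2)$-dimensional affine subspace of $\mathbb{R}^d$. An $m$-fan is a set of $m$ hyperplanes in $\mathbb{R}^d$ passing through a common $(d-2)$-flat. -}

module Defs where

open import Axiom.ExcludedMiddle using (ExcludedMiddle)
open import Data.Empty using (⊥)
open import Data.Fin.Base using (Fin; toℕ)
open import Data.Integer.Base using (+_)
open import Data.Nat.Base as ℕ using (ℕ; zero; suc)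
import Data.Nat.Properties as ℕ
open import Data.Product.Base using (Σ; ∃; _×_; _,_)
open import Data.Rational.Base as ℚ using (ℚ; 0ℚ; 1ℚ; ½; _/_)
import Data.Rational.Properties as ℚ
open import Data.Rational.Solver using (module +-*-Solver)
open import Data.Vec.Functional using (Vector; foldr)
open import Level using (0ℓ; Setω)
open import Relation.Binary.PropositionalEquality
  using (_≡_; _≢_; refl; sym; cong; subst)
open import Relation.Nullary.Negation using (¬_)
open import Relation.Unary using (Pred; _∈_; _⊆_; _≐_; _∪_; _∩_; ∁; ⋃; U; ∅; Satisfiable)

-- The theory formalised here is classical: the order on ℝ is decidable,
-- infima exist, and measures are real-valued. Excluded middle is therefore an
-- explicit hypothesis. Since `∃` is a strong sum, it also yields choice.

Classical : Setω
Classical = ∀ {ℓ} → ExcludedMiddle ℓ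

Eventually : (ℕ → Set) → Set
Eventually P = ∃ λ N → ∀ n → N ℕ.≤ n → P n

IsCauchy : (ℕ → ℚ) → Set
IsCauchy x = ∀ ε → 0ℚ ℚ.< ε →
  ∃ λ N → ∀ m n → N ℕ.≤ m → N ℕ.≤ n → ℚ.∣ x m ℚ.- x n ∣ ℚ.< ε

record ℝ : Set where
  constructor mkℝ
  field
    approx   : ℕ → ℚ
    isCauchy : IsCauchy approx

open ℝ public

infix  4 _≈_ _≤ᴿ_ _<ᴿ_
infixl 6 _+ᴿ_ _-ᴿ_
infixl 7 _*ᴿ_

-- The relations are records rather than functions, so that x and y can be
-- inferred from x ≈ y.
record _≈_ (x y : ℝ) : Set where
  constructor mk≈
  field
    close : ∀ ε → 0ℚ ℚ.< ε → Eventually λ n → ℚ.∣ approx x n ℚ.- approx y n ∣ ℚ.< ε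

record _≤ᴿ_ (x y : ℝ) : Set where
  constructor mk≤
  field
    below : ∀ ε → 0ℚ ℚ.< ε → Eventually λ n → approx x n ℚ.≤ approx y n ℚ.+ ε

record _<ᴿ_ (x y : ℝ) : Set where
  constructor mk<
  field
    gap   : ℚ
    gap>0 : 0ℚ ℚ.< gap
    apart : Eventually λ n → approx x n ℚ.+ gap ℚ.≤ approx y n

private
  open +-*-Solver using (solve; _:=_; _:+_; _:*_; _:-_; :-_; con)

  Bounded : (ℕ → ℚ) → Set
  Bounded z = ∃ λ B → 0ℚ ℚ.< B × Eventually λ n → ℚ.∣ z n ∣ ℚ.≤ B

  Close : (ℕ → ℚ) → ℚ → Set
  Close z δ = ∃ λ N → ∀ m n → N ℕ.≤ m → N ℕ.≤ n → ℚ.∣ z m ℚ.- z n ∣ ℚ.< δ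

  abstract
    0<½ε : ∀ ε → 0ℚ ℚ.< ε → 0ℚ ℚ.< ε ℚ.* ½
    0<½ε ε 0<ε = subst (ℚ._< ε ℚ.* ½) (ℚ.*-zeroˡ ½) (ℚ.*-monoˡ-<-pos ½ 0<ε)

    half+half : ∀ ε → ε ℚ.* ½ ℚ.+ ε ℚ.* ½ ≡ ε
    half+half ε = solve 1 (λ e → e :* con ½ :+ e :* con ½ := e) refl ε

    const-cauchy : ∀ q → IsCauchy (λ _ → q)
    const-cauchy q ε 0<ε =
      0 , λ _ _ _ _ → subst (λ r → ℚ.∣ r ∣ ℚ.< ε) (sym (ℚ.+-inverseʳ q)) 0<ε

    +-cauchy : ∀ x y → IsCauchy x → IsCauchy y → IsCauchy (λ n → x n ℚ.+ y n)
    +-cauchy x y cx cy ε 0<ε with cx _ (0<½ε ε 0<ε) | cy _ (0<½ε ε 0<ε)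
    ... | M , p | N , q = M ℕ.⊔ N , λ m n m≥ n≥ → begin-strict
        ℚ.∣ (x m ℚ.+ y m) ℚ.- (x n ℚ.+ y n) ∣
          ≡⟨ cong ℚ.∣_∣ (solve 4 (λ a b c d → (a :+ b) :- (c :+ d) := (a :- c) :+ (b :- d))
                          refl (x m) (y m) (x n) (y n)) ⟩
        ℚ.∣ (x m ℚ.- x n) ℚ.+ (y m ℚ.- y n) ∣
          ≤⟨ ℚ.∣p+q∣≤∣p∣+∣q∣ (x m ℚ.- x n) (y m ℚ.- y n) ⟩
        ℚ.∣ x m ℚ.- x n ∣ ℚ.+ ℚ.∣ y m ℚ.- y n ∣
          <⟨ ℚ.+-mono-< (p m n (ℕ.m⊔n≤o⇒m≤o M N m≥) (ℕ.m⊔n≤o⇒m≤o M N n≥))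
                        (q m n (ℕ.m⊔n≤o⇒n≤o M N m≥) (ℕ.m⊔n≤o⇒n≤o M N n≥)) ⟩
        ε ℚ.* ½ ℚ.+ ε ℚ.* ½
          ≡⟨ half+half ε ⟩
        ε ∎
      where open ℚ.≤-Reasoning

    neg-cauchy : ∀ x → IsCauchy x → IsCauchy (λ n → ℚ.- x n)
    neg-cauchy x cx ε 0<ε with cx ε 0<ε
    ... | N , p = N , λ m n m≥ n≥ → begin-strict
        ℚ.∣ (ℚ.- x m) ℚ.- (ℚ.- x n) ∣
          ≡⟨ cong ℚ.∣_∣ (solve 2 (λ a b → (:- a) :- (:- b) := :- (a :- b)) refl (x m) (x n)) ⟩
        ℚ.∣ ℚ.- (x m ℚ.- x n) ∣
          ≡⟨ ℚ.∣-p∣≡∣p∣ (x m ℚ.- x n) ⟩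
        ℚ.∣ x m ℚ.- x n ∣
          <⟨ p m n m≥ n≥ ⟩
        ε ∎
      where open ℚ.≤-Reasoning

    cauchy-bounded : ∀ x → IsCauchy x → Bounded x
    cauchy-bounded x cx with cx 1ℚ (ℚ.positive⁻¹ 1ℚ)
    ... | N , p = ℚ.∣ x N ∣ ℚ.+ 1ℚ , 0<B , N , bound
      where
      open ℚ.≤-Reasoning

      0<B : 0ℚ ℚ.< ℚ.∣ x N ∣ ℚ.+ 1ℚ
      0<B = ℚ.+-mono-≤-< (ℚ.0≤∣p∣ (x N)) (ℚ.positive⁻¹ 1ℚ)

      bound : ∀ n → N ℕ.≤ n → ℚ.∣ x n ∣ ℚ.≤ ℚ.∣ x N ∣ ℚ.+ 1ℚ
      bound n n≥ = begin
        ℚ.∣ x n ∣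
          ≡⟨ cong ℚ.∣_∣ (solve 2 (λ a b → a := b :+ (a :- b)) refl (x n) (x N)) ⟩
        ℚ.∣ x N ℚ.+ (x n ℚ.- x N) ∣
          ≤⟨ ℚ.∣p+q∣≤∣p∣+∣q∣ (x N) (x n ℚ.- x N) ⟩
        ℚ.∣ x N ∣ ℚ.+ ℚ.∣ x n ℚ.- x N ∣
          ≤⟨ ℚ.+-monoʳ-≤ ℚ.∣ x N ∣ (ℚ.<⇒≤ (p n N n≥ ℕ.≤-refl)) ⟩
        ℚ.∣ x N ∣ ℚ.+ 1ℚ ∎

    *-term : ∀ C δ p q → 0ℚ ℚ.< C → ℚ.∣ p ∣ ℚ.≤ C → ℚ.∣ q ∣ ℚ.< δ →
             ℚ.∣ p ℚ.* q ∣ ℚ.< C ℚ.* δ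
    *-term C δ p q 0<C p≤C q<δ = begin-strict
      ℚ.∣ p ℚ.* q ∣         ≡⟨ ℚ.∣p*q∣≡∣p∣*∣q∣ p q ⟩
      ℚ.∣ p ∣ ℚ.* ℚ.∣ q ∣   ≤⟨ ℚ.*-monoʳ-≤-nonNeg ℚ.∣ q ∣ {{ℚ.∣-∣-nonNeg q}} p≤C ⟩
      C ℚ.* ℚ.∣ q ∣         <⟨ ℚ.*-monoʳ-<-pos C {{ℚ.positive 0<C}} q<δ ⟩
      C ℚ.* δ               ∎
      where open ℚ.≤-Reasoning

    *-estimate : ∀ A B δ a b c d → 0ℚ ℚ.< A → 0ℚ ℚ.< B →
      ℚ.∣ a ∣ ℚ.≤ A → ℚ.∣ d ∣ ℚ.≤ B → ℚ.∣ a ℚ.- c ∣ ℚ.< δ → ℚ.∣ b ℚ.- d ∣ ℚ.< δ →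
      ℚ.∣ a ℚ.* b ℚ.- c ℚ.* d ∣ ℚ.< (A ℚ.+ B) ℚ.* δ
    *-estimate A B δ a b c d 0<A 0<B a≤A d≤B ac bd = begin-strict
      ℚ.∣ a ℚ.* b ℚ.- c ℚ.* d ∣
        ≡⟨ cong ℚ.∣_∣ (solve 4 (λ a b c d → a :* b :- c :* d := a :* (b :- d) :+ d :* (a :- c))
                        refl a b c d) ⟩
      ℚ.∣ a ℚ.* (b ℚ.- d) ℚ.+ d ℚ.* (a ℚ.- c) ∣
        ≤⟨ ℚ.∣p+q∣≤∣p∣+∣q∣ (a ℚ.* (b ℚ.- d)) (d ℚ.* (a ℚ.- c)) ⟩
      ℚ.∣ a ℚ.* (b ℚ.- d) ∣ ℚ.+ ℚ.∣ d ℚ.* (a ℚ.- c) ∣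
        <⟨ ℚ.+-mono-< (*-term A δ a (b ℚ.- d) 0<A a≤A bd) (*-term B δ d (a ℚ.- c) 0<B d≤B ac) ⟩
      A ℚ.* δ ℚ.+ B ℚ.* δ
        ≡⟨ ℚ.*-distribʳ-+ δ A B ⟨
      (A ℚ.+ B) ℚ.* δ ∎
      where open ℚ.≤-Reasoning

    divide : ∀ K ε → 0ℚ ℚ.< K → 0ℚ ℚ.< ε → ∃ λ δ → 0ℚ ℚ.< δ × K ℚ.* δ ≡ ε
    divide K ε 0<K 0<ε = ε ℚ.* K⁻¹ , 0<δ , eq
      where
      K⁻¹ : ℚ
      K⁻¹ = ℚ.1/_ K {{ℚ.pos⇒nonZero K {{ℚ.positive 0<K}}}}

      0<δ : 0ℚ ℚ.< ε ℚ.* K⁻¹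
      0<δ = ℚ.positive⁻¹ (ε ℚ.* K⁻¹)
        {{ℚ.pos*pos⇒pos ε {{ℚ.positive 0<ε}} K⁻¹ {{ℚ.1/pos⇒pos K {{ℚ.positive 0<K}}}}}}

      open ℚ.≤-Reasoning
      eq : K ℚ.* (ε ℚ.* K⁻¹) ≡ ε
      eq = begin-equality
        K ℚ.* (ε ℚ.* K⁻¹)   ≡⟨ ℚ.*-comm K (ε ℚ.* K⁻¹) ⟩
        ε ℚ.* K⁻¹ ℚ.* K     ≡⟨ ℚ.*-assoc ε K⁻¹ K ⟩
        ε ℚ.* (K⁻¹ ℚ.* K)   ≡⟨ cong (ε ℚ.*_) (ℚ.*-inverseˡ K {{ℚ.pos⇒nonZero K {{ℚ.positive 0<K}}}}) ⟩
        ε ℚ.* 1ℚ            ≡⟨ ℚ.*-identityʳ ε ⟩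
        ε                   ∎

    *-cauchy : ∀ x y → IsCauchy x → IsCauchy y → IsCauchy (λ n → x n ℚ.* y n)
    *-cauchy x y cx cy ε 0<ε = bounded (cauchy-bounded x cx) (cauchy-bounded y cy)
      where
      module _ {A B δ} (0<A : 0ℚ ℚ.< A) (0<B : 0ℚ ℚ.< B) (eq : (A ℚ.+ B) ℚ.* δ ≡ ε) where

        close : (Eventually λ n → ℚ.∣ x n ∣ ℚ.≤ A) → (Eventually λ n → ℚ.∣ y n ∣ ℚ.≤ B) →
                Close x δ → Close y δ → Close (λ n → x n ℚ.* y n) ε
        close (Na , boundA) (Nb , boundB) (Nx , px) (Ny , py) =
          (Nx ℕ.⊔ Ny) ℕ.⊔ (Na ℕ.⊔ Nb) , λ m n m≥ n≥ →
          let mxy = ℕ.m⊔n≤o⇒m≤o (Nx ℕ.⊔ Ny) (Na ℕ.⊔ Nb) m≥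
              mab = ℕ.m⊔n≤o⇒n≤o (Nx ℕ.⊔ Ny) (Na ℕ.⊔ Nb) m≥
              nxy = ℕ.m⊔n≤o⇒m≤o (Nx ℕ.⊔ Ny) (Na ℕ.⊔ Nb) n≥
              nab = ℕ.m⊔n≤o⇒n≤o (Nx ℕ.⊔ Ny) (Na ℕ.⊔ Nb) n≥
          in subst (ℚ.∣ x m ℚ.* y m ℚ.- x n ℚ.* y n ∣ ℚ.<_) eq
               (*-estimate A B δ (x m) (y m) (x n) (y n) 0<A 0<B
                 (boundA m (ℕ.m⊔n≤o⇒m≤o Na Nb mab)) (boundB n (ℕ.m⊔n≤o⇒n≤o Na Nb nab))
                 (px m n (ℕ.m⊔n≤o⇒m≤o Nx Ny mxy) (ℕ.m⊔n≤o⇒m≤o Nx Ny nxy))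
                 (py m n (ℕ.m⊔n≤o⇒n≤o Nx Ny mxy) (ℕ.m⊔n≤o⇒n≤o Nx Ny nxy)))

      bounded : Bounded x → Bounded y → Close (λ n → x n ℚ.* y n) ε
      bounded (A , 0<A , a) (B , 0<B , b) =
        let δ , 0<δ , eq = divide (A ℚ.+ B) ε (ℚ.+-mono-< 0<A 0<B) 0<ε
        in close 0<A 0<B eq a b (cx δ 0<δ) (cy δ 0<δ)

fromℚ : ℚ → ℝ
fromℚ q = mkℝ (λ _ → q) (const-cauchy q)

0ᴿ 1ᴿ : ℝ
0ᴿ = fromℚ 0ℚ
1ᴿ = fromℚ 1ℚ

_+ᴿ_ _-ᴿ_ _*ᴿ_ : ℝ → ℝ → ℝ
mkℝ x cx +ᴿ mkℝ y cy = mkℝ (λ n → x n ℚ.+ y n) (+-cauchy x y cx cy)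
mkℝ x cx *ᴿ mkℝ y cy = mkℝ (λ n → x n ℚ.* y n) (*-cauchy x y cx cy)
mkℝ x cx -ᴿ mkℝ y cy =
  mkℝ (λ n → x n ℚ.- y n) (+-cauchy x (λ n → ℚ.- y n) cx (neg-cauchy y cy))

-- The value at 0 is junk.
1/ᴿ_ : ℕ → ℝ
1/ᴿ zero  = 0ᴿ
1/ᴿ suc n = fromℚ (+ 1 / suc n)

sum product : ∀ {n} → Vector ℝ n → ℝ
sum     = foldr _+ᴿ_ 0ᴿ
product = foldr _*ᴿ_ 1ᴿ

Within : ℝ → ℝ → ℝ → Set
Within ε x y = (x -ᴿ ε <ᴿ y) × (y <ᴿ x +ᴿ ε)

ConvergesTo : (ℕ → ℝ) → ℝ → Set
ConvergesTo a l = ∀ ε → 0ᴿ <ᴿ ε → Eventually λ n → Within ε l (a n)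

HasSum : (ℕ → ℝ) → ℝ → Set
HasSum a = ConvergesTo (λ n → sum {n} (λ i → a (toℕ i)))

IsInfimum : Pred ℝ 0ℓ → ℝ → Set
IsInfimum S v = (∀ s → S s → v ≤ᴿ s) × (∀ w → (∀ s → S s → w ≤ᴿ s) → w ≤ᴿ v)

Space : ℕ → Set
Space d = Vector ℝ d

_·_ : ∀ {d} → Space d → Space d → ℝ
u · v = sum (λ i → u i *ᴿ v i)

combination : ∀ {d k} → Vector ℝ k → Vector (Space d) k → Space d
combination t v j = sum (λ i → t i *ᴿ v i j)

LinearlyIndependent : ∀ {d k} → Vector (Space d) k → Set
LinearlyIndependent v =
  ∀ t → (∀ j → combination t v j ≈ 0ᴿ) → ∀ i → t i ≈ 0ᴿ

record Flat (d k : ℕ) : Set where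
  field
    base                : Space d
    directions          : Vector (Space d) k
    linearlyIndependent : LinearlyIndependent directions

  points : Pred (Space d) 0ℓ
  points x = ∃ λ t → ∀ j → x j ≈ base j +ᴿ combination t directions j

record Hyperplane (d : ℕ) : Set where
  field
    normal    : Space d
    offset    : ℝ
    normal≉0  : ∃ λ i → ¬ normal i ≈ 0ᴿ

  points : Pred (Space d) 0ℓ
  points x = normal · x ≈ offset

-- Only used for d ≥ 2, where truncated subtraction is the ordinary one.
record Fan (d m : ℕ) : Set where
  field
    hyperplane : Fin m → Hyperplane d
    distinct   : ∀ i j → i ≢ j →
                 ¬ Hyperplane.points (hyperplane i) ≐ Hyperplane.points (hyperplane j)
    axis       : Flat d (d ℕ.∸ 2)
    axis⊆      : ∀ i → Flat.points axis ⊆ Hyperplane.points (hyperplane i)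

  complement : Pred (Space d) 0ℓ
  complement = ∁ (⋃ (Fin m) (λ i → Hyperplane.points (hyperplane i)))

-- Balls of the sup norm generate the Euclidean topology. Open sets are
-- automatically invariant under coordinatewise ≈.
IsOpen : ∀ {d} → Pred (Space d) 0ℓ → Set
IsOpen {d} A =
  ∀ x → x ∈ A → ∃ λ ε → 0ᴿ <ᴿ ε × (∀ y → (∀ i → Within ε (x i) (y i)) → y ∈ A)

IsConnected : ∀ {d} → Pred (Space d) 0ℓ → Set₁
IsConnected {d} C = ∀ (V W : Pred (Space d) 0ℓ) → IsOpen V → IsOpen W →
  C ⊆ V ∪ W → Satisfiable (C ∩ V) → Satisfiable (C ∩ W) → Satisfiable (C ∩ (V ∩ W))

record IsComponent {d} (A C : Pred (Space d) 0ℓ) : Set₁ where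
  field
    nonempty  : Satisfiable C
    subset    : C ⊆ A
    connected : IsConnected C
    maximal   : ∀ D → IsConnected D → D ⊆ A → Satisfiable (C ∩ D) → D ⊆ C

data IsBorel {d} : Pred (Space d) 0ℓ → Set₁ where
  open′      : ∀ {A} → IsOpen A → IsBorel A
  complement : ∀ {A} → IsBorel A → IsBorel (∁ A)
  union      : ∀ {A : ℕ → Pred (Space d) 0ℓ} →
               (∀ n → IsBorel (A n)) → IsBorel (⋃ ℕ A)
  resp       : ∀ {A B} → A ≐ B → IsBorel A → IsBorel B

record BorelSet (d : ℕ) : Set₁ where
  constructor mkBorel
  field
    set     : Pred (Space d) 0ℓ
    isBorel : IsBorel set

open BorelSet public

⋃ᴮ : ∀ {d} → (ℕ → BorelSet d) → BorelSet d
⋃ᴮ A = mkBorel (⋃ ℕ (λ n → set (A n))) (union (λ n → isBorel (A n)))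

record ProbabilityMeasure (d : ℕ) : Set₁ where
  field
    measure     : BorelSet d → ℝ
    resp-≐      : ∀ A B → set A ≐ set B → measure A ≈ measure B
    nonnegative : ∀ A → 0ᴿ ≤ᴿ measure A
    empty       : ∀ A → set A ≐ ∅ → measure A ≈ 0ᴿ
    σ-additive  : ∀ (A : ℕ → BorelSet d) →
                  (∀ i j → i ≢ j → ∀ x → x ∈ set (A i) → x ∈ set (A j) → ⊥) →
                  HasSum (λ n → measure (A n)) (measure (⋃ᴮ A))
    total       : ∀ A → set A ≐ U → measure A ≈ 1ᴿ

open ProbabilityMeasure public using (measure)

record Box (d : ℕ) : Set where
  field
    lower upper : Space d
    lower≤upper : ∀ i → lower i ≤ᴿ upper i

  points : Pred (Space d) 0ℓ
  points x = ∀ i → (lower i ≤ᴿ x i) × (x i ≤ᴿ upper i)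

  volume : ℝ
  volume = product (λ i → upper i -ᴿ lower i)

CoveringVolume : ∀ {d} → Pred (Space d) 0ℓ → Pred ℝ 0ℓ
CoveringVolume {d} A s = Σ (ℕ → Box d) λ B →
  (A ⊆ ⋃ ℕ (λ n → Box.points (B n))) × HasSum (λ n → Box.volume (B n)) s

-- A has finite Lebesgue (outer) measure v. Sets of infinite measure have no
-- covering volume, hence no real infimum.
HasLebesgueMeasure : ∀ {d} → BorelSet d → ℝ → Set
HasLebesgueMeasure A v = IsInfimum (CoveringVolume (set A)) v

AbsolutelyContinuous : ∀ {d} → ProbabilityMeasure d → Set₁
AbsolutelyContinuous μ = ∀ A → HasLebesgueMeasure A 0ᴿ → measure μ A ≈ 0ᴿ

-- The parts cut out by a fan are the connected components of the complement of
-- the union of its hyperplanes.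
record Equipartitions {d m} (F : Fan d m) (μ : ProbabilityMeasure d) : Set₁ where
  field
    part        : Fin (2 ℕ.* m) → BorelSet d
    isComponent : ∀ i → IsComponent (Fan.complement F) (set (part i))
    distinct    : ∀ i j → i ≢ j → ¬ set (part i) ≐ set (part j)
    exhaustive  : ∀ C → IsComponent (Fan.complement F) C → ∃ λ i → C ≐ set (part i)
    equal       : ∀ i → measure μ (part i) ≈ 1/ᴿ (2 ℕ.* m)

{-# OPTIONS --safe #-}
-- Place 2m - 1 unit boxes with integer corners in ℝ^d and let μ be uniform with
-- mass 1/(2m - 1) on each. A box that meets no hyperplane of a fan lies in a
-- single part, which is then heavier than 1/2m; so it suffices to place the
-- boxes such that no m-fan meets all of them. An m-fan has only
-- 2(d - 1) + m < 2m - 1 parameters: its hyperplanes belong to a pencil spanned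
-- by two functionals, which normalised at a maximal minor have 2(d - 1) free
-- coefficients in [-1, 1], and inside the pencil each hyperplane costs one more
-- such number. For corners in an n × ... × n grid, round these parameters to
-- multiples of 1/n. If a hyperplane meets a box, the rounded hyperplane and all
-- but one of the coordinates of the box leave only boundedly many choices for
-- the last coordinate. Hence there are fewer ways for a fan to meet all boxes
-- than there are placements once n is large, and the pigeonhole principle
-- yields a placement that no fan meets entirely.
--
-- The measure is the image of a coin-tossing measure under the map that reads
-- off a box and binary digits. A Lebesgue null set is μ-null because a
-- uniform k-digit fraction hits an interval with probability at most its length
-- plus 2/2^k, independently for each coordinate.

module Submission where

open import Algebra.Bundles using (CommutativeRing)
open import Algebra.Structures using (IsCommutativeRing)
import Algebra.Solver.Ring as RingSolver
open import Algebra.Solver.Ring.AlmostCommutativeRing using (fromCommutativeRing; _-Raw-AlmostCommutative⟶_)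
open import Data.Maybe.Base using (Maybe; just; nothing)
import Algebra.Properties.Semiring.Sum as SemiringSum
open import Data.Bool.Base using (Bool; true; false; if_then_else_)
open import Data.Empty using (⊥; ⊥-elim)
open import Data.Fin.Base as Fin using (Fin; toℕ; fromℕ<; punchIn; combine; finToFun; funToFin)
import Data.Fin.Properties as Fin
open import Data.Integer.Base as ℤ using (+_)
import Data.Integer.Properties as ℤ
open import Data.Nat.Base as ℕ using (ℕ; zero; suc)
import Data.Nat.DivMod as ℕ
import Data.Nat.Properties as ℕ
import Data.Nat.Solver as ℕ
open import Data.Product.Base using (Σ; ∃; _×_; _,_; proj₁; proj₂)
open import Data.Rational.Base as ℚ using (ℚ; 0ℚ; 1ℚ; ½; _/_)
import Data.Rational.Properties as ℚ
import Data.Rational.Unnormalised.Base as ℚᵘ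
import Data.Rational.Unnormalised.Properties as ℚᵘ
open import Data.Rational.Solver using (module +-*-Solver)
open import Data.Sum.Base using (_⊎_; inj₁; inj₂; [_,_]′)
open import Data.Unit.Base using (⊤; tt)
open import Data.Vec.Base as Vec using (Vec; []; _∷_; _∷ʳ_)
import Data.Vec.Properties as Vec
import Data.Vec.Functional as Vector
import Data.Vec.Functional.Properties as Vector
open import Data.Vec.Functional using (Vector)
open import Function.Base using (_∘_; id)
open import Level using (0ℓ)
open import Relation.Binary.PropositionalEquality
  using (_≡_; _≢_; refl; sym; trans; cong; cong₂; subst; subst₂; module ≡-Reasoning)
open import Relation.Binary.Definitions using (tri<; tri≈; tri>)
open import Relation.Binary.Structures using (IsPreorder)
import Relation.Binary.Reasoning.Base.Double as PreorderReasoning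
import Relation.Binary.Reasoning.Setoid as SetoidReasoning
open import Relation.Nullary using (¬_; Dec; yes; no)
open import Relation.Unary using (Pred; _∈_; _⊆_; _≐_; _∪_; _∩_; ∁; ⋃; Satisfiable)

-- Ordered fields and linear algebra

-- The threshold m ≥ 2d is where two demands on the number N of boxes meet. A box must outweigh a
-- part, so N is at most 2m - 1; and each box leaves a factor n by which placements outnumber
-- fingerprints, so N must exceed the 2(d - 1) + m rounded parameters. Rounding helps only if its
-- effect is uniform over all fans. Hence points are written homogeneously as (n, x), with every
-- entry at most n, the pencil is normalised at its largest minor, and each hyperplane by its larger
-- pencil coordinate: an error 1/n in a coefficient then costs a bounded amount at every box. That
-- the last coordinate of a box has boundedly many values is exploited through its residue: two
-- placements with one fingerprint agree there up to less than the modulus, so no list of candidates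
-- is formed. The measure is an outer measure defined by open covers with rational bounds. Upper
-- bounds come from explicit covers, lower bounds from compactness of the space of words, and
-- additivity from Lebesgue's criterion, which preimages of open sets satisfy and which passes to
-- complements and countable unions.

-- The linear algebra is done over an abstract field because definitional
-- unfolding of the operations of ℝ makes its terms very large.
record OrderedField : Set₁ where
  infix  4 _≈_ _≤_ _≈?_
  infixl 6 _+_
  infixl 7 _*_
  infix  8 -_
  field
    Carrier           : Set
    _≈_ _≤_           : Carrier → Carrier → Set
    _+_ _*_           : Carrier → Carrier → Carrier
    -_ ∣_∣            : Carrier → Carrier
    embed             : ℚ → Carrier
    isCommutativeRing : IsCommutativeRing _≈_ _+_ _*_ -_ (embed 0ℚ) (embed 1ℚ)
    embed-+           : ∀ p q → embed (p ℚ.+ q) ≈ embed p + embed q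
    embed-*           : ∀ p q → embed (p ℚ.* q) ≈ embed p * embed q
    embed--           : ∀ p → embed (ℚ.- p) ≈ - embed p
    _≈?_              : ∀ x y → Dec (x ≈ y)
    ≤-isPreorder      : IsPreorder _≈_ _≤_
    ≤-antisym         : ∀ {x y} → x ≤ y → y ≤ x → x ≈ y
    ≤-total           : ∀ x y → x ≤ y ⊎ y ≤ x
    +-mono-≤          : ∀ {x y u v} → x ≤ y → u ≤ v → x + u ≤ y + v
    0≤*               : ∀ {x y} → embed 0ℚ ≤ x → embed 0ℚ ≤ y → embed 0ℚ ≤ x * y
    1≉0               : ¬ embed 1ℚ ≈ embed 0ℚ
    reciprocal        : ∀ {x} → ¬ x ≈ embed 0ℚ → ∃ λ y → x * y ≈ embed 1ℚ
    x≤∣x∣             : ∀ x → x ≤ ∣ x ∣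
    -x≤∣x∣            : ∀ x → - x ≤ ∣ x ∣
    ∣x∣≤y             : ∀ {x y} → x ≤ y → - x ≤ y → ∣ x ∣ ≤ y
    ∣x*y∣≈∣x∣*∣y∣     : ∀ x y → ∣ x * y ∣ ≈ ∣ x ∣ * ∣ y ∣

module OrderedFieldProperties (F : OrderedField) where
  open OrderedField F

  commutativeRing : CommutativeRing 0ℓ 0ℓ
  commutativeRing = record { isCommutativeRing = isCommutativeRing }

  open CommutativeRing commutativeRing public
    using (0#; 1#; _-_; setoid; semiring; +-cong; +-comm; *-cong; *-comm; *-assoc; distribˡ; distribʳ; zeroˡ; zeroʳ;
           +-identityˡ; +-identityʳ; *-identityˡ; *-identityʳ; -‿inverseˡ; -‿inverseʳ; -‿cong)
    renaming (refl to ≈-refl; sym to ≈-sym; trans to ≈-trans; reflexive to ≈-reflexive)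

  -- Taking the solver's coefficients from ℚ lets numerals normalise by computation, whatever the
  -- field.
  embed-morphism : CommutativeRing.rawRing ℚ.+-*-commutativeRing -Raw-AlmostCommutative⟶ fromCommutativeRing commutativeRing
  embed-morphism = record
    { ⟦_⟧ = embed ; +-homo = embed-+ ; *-homo = embed-* ; -‿homo = embed--
    ; 0-homo = ≈-refl ; 1-homo = ≈-refl }

  coefficient≟ : ∀ p q → Maybe (embed p ≈ embed q)
  coefficient≟ p q with p ℚ.≟ q
  ... | yes p≡q = just (≈-reflexive (cong embed p≡q))
  ... | no  _   = nothing

  open RingSolver (CommutativeRing.rawRing ℚ.+-*-commutativeRing) (fromCommutativeRing commutativeRing)
    embed-morphism coefficient≟ using (solve; _:=_; _:+_; _:*_; _:-_; :-_; con) public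

  open IsPreorder ≤-isPreorder public using () renaming (reflexive to ≈⇒≤; trans to ≤-trans)

  ≤-refl : ∀ {x} → x ≤ x
  ≤-refl = ≈⇒≤ ≈-refl

  module ≈-Reasoning = SetoidReasoning setoid
  module ≤-Reasoning = PreorderReasoning ≤-isPreorder
  module ∑ = SemiringSum semiring
  open ∑ public using (sum)

  -- Inequalities are proved by naming the nonnegative difference `r`, which leaves a ring identity
  -- for the solver.
  slack : ∀ {x y} r → 0# ≤ r → x + r ≈ y → x ≤ y
  slack {x} {y} r 0≤r eq = begin
    x        ≈⟨ +-identityʳ x ⟨
    x + 0#   ≲⟨ +-mono-≤ ≤-refl 0≤r ⟩
    x + r    ≈⟨ eq ⟩
    y        ∎
    where open ≤-Reasoning

  x≤y⇒0≤y-x : ∀ {x y} → x ≤ y → 0# ≤ y - x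
  x≤y⇒0≤y-x {x} {y} x≤y = begin
    0#      ≈⟨ -‿inverseʳ x ⟨
    x - x   ≲⟨ +-mono-≤ x≤y ≤-refl ⟩
    y - x   ∎
    where open ≤-Reasoning

  0≤+ : ∀ {x y} → 0# ≤ x → 0# ≤ y → 0# ≤ x + y
  0≤+ {x} {y} p q = ≤-trans (≈⇒≤ (≈-sym (+-identityˡ 0#))) (+-mono-≤ p q)

  *-monoʳ-≤ : ∀ {x y} z → 0# ≤ z → x ≤ y → x * z ≤ y * z
  *-monoʳ-≤ {x} {y} z 0≤z x≤y = slack ((y - x) * z) (0≤* (x≤y⇒0≤y-x x≤y) 0≤z)
    (solve 3 (λ x y z → x :* z :+ (y :- x) :* z := y :* z) ≈-refl x y z)

  *-monoˡ-≤ : ∀ {x y} z → 0# ≤ z → x ≤ y → z * x ≤ z * y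
  *-monoˡ-≤ {x} {y} z 0≤z x≤y = slack (z * (y - x)) (0≤* 0≤z (x≤y⇒0≤y-x x≤y))
    (solve 3 (λ x y z → z :* x :+ z :* (y :- x) := z :* y) ≈-refl x y z)

  neg-mono-≤ : ∀ {x y} → x ≤ y → - y ≤ - x
  neg-mono-≤ {x} {y} x≤y = slack (y - x) (x≤y⇒0≤y-x x≤y)
    (solve 2 (λ x y → :- y :+ (y :- x) := :- x) ≈-refl x y)

  0≤x*x : ∀ x → 0# ≤ x * x
  0≤x*x x with ≤-total 0# x
  ... | inj₁ 0≤x = 0≤* 0≤x 0≤x
  ... | inj₂ x≤0 = ≤-trans (0≤* (x≤y⇒0≤y-x x≤0) (x≤y⇒0≤y-x x≤0))
        (≈⇒≤ (solve 1 (λ x → (con 0ℚ :- x) :* (con 0ℚ :- x) := x :* x) ≈-refl x))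

  0≤1 : 0# ≤ 1#
  0≤1 = ≤-trans (0≤x*x 1#) (≈⇒≤ (*-identityˡ 1#))

  1≰0 : ¬ 1# ≤ 0#
  1≰0 1≤0 = 1≉0 (≤-antisym 1≤0 0≤1)

  0≤∣x∣ : ∀ x → 0# ≤ ∣ x ∣
  0≤∣x∣ x with ≤-total 0# x
  ... | inj₁ 0≤x = ≤-trans 0≤x (x≤∣x∣ x)
  ... | inj₂ x≤0 = ≤-trans (x≤y⇒0≤y-x x≤0) (≤-trans (≈⇒≤ (+-identityˡ (- x))) (-x≤∣x∣ x))

  ∣∣-resp-≤ : ∀ {x y c} → x ≈ y → ∣ y ∣ ≤ c → ∣ x ∣ ≤ c
  ∣∣-resp-≤ {x} {y} x≈y h = ∣x∣≤y (≤-trans (≈⇒≤ x≈y) (≤-trans (x≤∣x∣ y) h))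
    (≤-trans (≈⇒≤ (-‿cong x≈y)) (≤-trans (-x≤∣x∣ y) h))

  ∣∣-cong : ∀ {x y} → x ≈ y → ∣ x ∣ ≈ ∣ y ∣
  ∣∣-cong x≈y = ≤-antisym (∣∣-resp-≤ x≈y ≤-refl) (∣∣-resp-≤ (≈-sym x≈y) ≤-refl)

  ∣x+y∣≤ : ∀ {x y a b} → ∣ x ∣ ≤ a → ∣ y ∣ ≤ b → ∣ x + y ∣ ≤ a + b
  ∣x+y∣≤ {x} {y} x≤a y≤b = ∣x∣≤y (+-mono-≤ (≤-trans (x≤∣x∣ x) x≤a) (≤-trans (x≤∣x∣ y) y≤b))
    (≤-trans (≈⇒≤ (solve 2 (λ x y → :- (x :+ y) := :- x :+ :- y) ≈-refl x y))
      (+-mono-≤ (≤-trans (-x≤∣x∣ x) x≤a) (≤-trans (-x≤∣x∣ y) y≤b)))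

  ∣-x∣≤ : ∀ {x a} → ∣ x ∣ ≤ a → ∣ - x ∣ ≤ a
  ∣-x∣≤ {x} h = ∣x∣≤y (≤-trans (-x≤∣x∣ x) h)
    (≤-trans (≈⇒≤ (solve 1 (λ x → :- (:- x) := x) ≈-refl x)) (≤-trans (x≤∣x∣ x) h))

  ∣x*y∣≤ : ∀ {x y a b} → ∣ x ∣ ≤ a → ∣ y ∣ ≤ b → ∣ x * y ∣ ≤ a * b
  ∣x*y∣≤ {x} {y} {a} {b} x≤a y≤b = begin
    ∣ x * y ∣       ≈⟨ ∣x*y∣≈∣x∣*∣y∣ x y ⟩
    ∣ x ∣ * ∣ y ∣   ≲⟨ *-monoʳ-≤ ∣ y ∣ (0≤∣x∣ y) x≤a ⟩
    a * ∣ y ∣       ≲⟨ *-monoˡ-≤ a (≤-trans (0≤∣x∣ x) x≤a) y≤b ⟩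
    a * b           ∎
    where open ≤-Reasoning

  ∣x∣≈x : ∀ {x} → 0# ≤ x → ∣ x ∣ ≈ x
  ∣x∣≈x {x} 0≤x = ≤-antisym (∣x∣≤y ≤-refl (≤-trans (slack x 0≤x (-‿inverseˡ x)) 0≤x)) (x≤∣x∣ x)

  ∣x∣≤0⇒x≈0 : ∀ {x} → ∣ x ∣ ≤ 0# → x ≈ 0#
  ∣x∣≤0⇒x≈0 {x} h = ≤-antisym (≤-trans (x≤∣x∣ x) h) (slack (- - x) (0≤- (≤-trans (-x≤∣x∣ x) h))
    (solve 1 (λ x → con 0ℚ :+ :- (:- x) := x) ≈-refl x))
    where
    0≤- : ∀ {y} → y ≤ 0# → 0# ≤ - y
    0≤- {y} y≤0 = ≤-trans (x≤y⇒0≤y-x y≤0) (≈⇒≤ (+-identityˡ (- y)))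

  *-zero-cancelˡ : ∀ {x y} → ¬ x ≈ 0# → x * y ≈ 0# → y ≈ 0#
  *-zero-cancelˡ {x} {y} x≉0 xy≈0 with reciprocal x≉0
  ... | r , xr≈1 = begin
    y             ≈⟨ *-identityˡ y ⟨
    1# * y        ≈⟨ *-cong xr≈1 ≈-refl ⟨
    x * r * y     ≈⟨ solve 3 (λ x r y → x :* r :* y := r :* (x :* y)) ≈-refl x r y ⟩
    r * (x * y)   ≈⟨ *-cong ≈-refl xy≈0 ⟩
    r * 0#        ≈⟨ zeroʳ r ⟩
    0#            ∎
    where open ≈-Reasoning

  x-y≈0⇒x≈y : ∀ {x y} → x - y ≈ 0# → x ≈ y
  x-y≈0⇒x≈y {x} {y} eq = begin
    x           ≈⟨ solve 2 (λ x y → x := x :- y :+ y) ≈-refl x y ⟩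
    x - y + y   ≈⟨ +-cong eq ≈-refl ⟩
    0# + y      ≈⟨ +-identityˡ y ⟩
    y           ∎
    where open ≈-Reasoning

  zeroˡ′ : ∀ {x} y → x ≈ 0# → x * y ≈ 0#
  zeroˡ′ y x≈0 = ≈-trans (*-cong x≈0 ≈-refl) (zeroˡ y)

  zeroʳ′ : ∀ x {y} → y ≈ 0# → x * y ≈ 0#
  zeroʳ′ x y≈0 = ≈-trans (*-cong ≈-refl y≈0) (zeroʳ x)

  +-zero : ∀ {x y} → x ≈ 0# → y ≈ 0# → x + y ≈ 0#
  +-zero x≈0 y≈0 = ≈-trans (+-cong x≈0 y≈0) (+-identityˡ 0#)

  x*x≈0⇒x≈0 : ∀ {x} → x * x ≈ 0# → x ≈ 0#
  x*x≈0⇒x≈0 {x} eq with x ≈? 0#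
  ... | yes x≈0 = x≈0
  ... | no  x≉0 = *-zero-cancelˡ x≉0 eq

  *-cancelʳ-≤ : ∀ {x y} z → 0# ≤ z → ¬ z ≈ 0# → x * z ≤ y * z → x ≤ y
  *-cancelʳ-≤ {x} {y} z 0≤z z≉0 h with ≤-total x y
  ... | inj₁ x≤y = x≤y
  ... | inj₂ y≤x = ≈⇒≤ (x-y≈0⇒x≈y (*-zero-cancelˡ z≉0 (begin
    z * (x - y)     ≈⟨ solve 3 (λ x y z → z :* (x :- y) := x :* z :- y :* z) ≈-refl x y z ⟩
    x * z - y * z   ≈⟨ +-cong (≤-antisym h (*-monoʳ-≤ z 0≤z y≤x)) ≈-refl ⟩
    y * z - y * z   ≈⟨ -‿inverseʳ (y * z) ⟩
    0#              ∎)))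
    where open ≈-Reasoning

  lerp : Carrier → Carrier → Carrier → Carrier
  lerp x y t = x + t * (y - x)

  lerp-≥ : ∀ {l x y t} → l ≤ x → l ≤ y → 0# ≤ t → t ≤ 1# → l ≤ lerp x y t
  lerp-≥ {l} {x} {y} {t} l≤x l≤y 0≤t t≤1 = slack ((1# - t) * (x - l) + t * (y - l))
    (0≤+ (0≤* (x≤y⇒0≤y-x t≤1) (x≤y⇒0≤y-x l≤x)) (0≤* 0≤t (x≤y⇒0≤y-x l≤y)))
    (solve 4 (λ l x y t → l :+ ((con 1ℚ :- t) :* (x :- l) :+ t :* (y :- l)) := x :+ t :* (y :- x)) ≈-refl l x y t)

  lerp-≤ : ∀ {u x y t} → x ≤ u → y ≤ u → 0# ≤ t → t ≤ 1# → lerp x y t ≤ u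
  lerp-≤ {u} {x} {y} {t} x≤u y≤u 0≤t t≤1 = slack ((1# - t) * (u - x) + t * (u - y))
    (0≤+ (0≤* (x≤y⇒0≤y-x t≤1) (x≤y⇒0≤y-x x≤u)) (0≤* 0≤t (x≤y⇒0≤y-x y≤u)))
    (solve 4 (λ u x y t → x :+ t :* (y :- x) :+ ((con 1ℚ :- t) :* (u :- x) :+ t :* (u :- y)) := u) ≈-refl u x y t)

  lerp-close : ∀ {x y s t δ B} → ∣ t - s ∣ ≤ δ → ∣ y - x ∣ ≤ B → ∣ lerp x y t - lerp x y s ∣ ≤ δ * B
  lerp-close {x} {y} {s} {t} t≈s y-x≤B = ∣∣-resp-≤
    (solve 4 (λ x y s t → x :+ t :* (y :- x) :- (x :+ s :* (y :- x)) := (t :- s) :* (y :- x)) ≈-refl x y s t)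
    (∣x*y∣≤ t≈s y-x≤B)

  lerp-0 : ∀ x y → lerp x y 0# ≈ x
  lerp-0 = solve 2 (λ x y → x :+ con 0ℚ :* (y :- x) := x) ≈-refl

  lerp-1 : ∀ x y → lerp x y 1# ≈ y
  lerp-1 = solve 2 (λ x y → x :+ con 1ℚ :* (y :- x) := y) ≈-refl

  nat : ℕ → Carrier
  nat zero    = 0#
  nat (suc n) = 1# + nat n

  0≤nat : ∀ n → 0# ≤ nat n
  0≤nat zero    = ≤-refl
  0≤nat (suc n) = 0≤+ 0≤1 (0≤nat n)

  nat-mono-≤ : ∀ {m n} → m ℕ.≤ n → nat m ≤ nat n
  nat-mono-≤ {n = n} ℕ.z≤n = 0≤nat n
  nat-mono-≤ (ℕ.s≤s m≤n) = +-mono-≤ ≤-refl (nat-mono-≤ m≤n)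

  nat-+ : ∀ m n → nat (m ℕ.+ n) ≈ nat m + nat n
  nat-+ zero    n = ≈-sym (+-identityˡ (nat n))
  nat-+ (suc m) n = ≈-trans (+-cong ≈-refl (nat-+ m n))
    (solve 3 (λ o m n → o :+ (m :+ n) := o :+ m :+ n) ≈-refl 1# (nat m) (nat n))

  nat-* : ∀ m n → nat (m ℕ.* n) ≈ nat m * nat n
  nat-* zero    n = ≈-sym (zeroˡ (nat n))
  nat-* (suc m) n = ≈-trans (nat-+ n (m ℕ.* n)) (≈-trans (+-cong ≈-refl (nat-* m n))
    (solve 2 (λ m n → n :+ m :* n := (con 1ℚ :+ m) :* n) ≈-refl (nat m) (nat n)))

  nat≤0 : ∀ n → nat n ≤ 0# → n ≡ 0
  nat≤0 zero    _ = refl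
  nat≤0 (suc n) h = ⊥-elim (1≰0 (≤-trans (slack (nat n) (0≤nat n) ≈-refl) h))

  nat-cancel-≤ : ∀ m n → nat m ≤ nat n → m ℕ.≤ n
  nat-cancel-≤ zero    n       h = ℕ.z≤n
  nat-cancel-≤ (suc m) zero    h with () ← nat≤0 (suc m) h
  nat-cancel-≤ (suc m) (suc n) h = ℕ.s≤s (nat-cancel-≤ m n (slack (1# + nat n - (1# + nat m)) (x≤y⇒0≤y-x h)
    (solve 3 (λ o m n → m :+ (o :+ n :- (o :+ m)) := n) ≈-refl 1# (nat m) (nat n))))

  nat≉0 : ∀ n → ¬ nat (suc n) ≈ 0#
  nat≉0 n eq with () ← nat≤0 (suc n) (≈⇒≤ eq)

module LinearAlgebra (F : OrderedField) where
  open OrderedField F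
  open OrderedFieldProperties F

  ∑-cong : ∀ {n} {f g : Vector Carrier n} → (∀ i → f i ≈ g i) → sum f ≈ sum g
  ∑-cong = ∑.sum-cong-≋

  ∑-zero : ∀ {n} (f : Vector Carrier n) → (∀ i → f i ≈ 0#) → sum f ≈ 0#
  ∑-zero {n} f eq = ≈-trans (∑-cong eq) (∑.sum-replicate-zero n)

  ∣∑∣≤ : ∀ {n} (f : Vector Carrier n) c → (∀ i → ∣ f i ∣ ≤ c) → ∣ sum f ∣ ≤ nat n * c
  ∣∑∣≤ {zero}  f c h = ≤-trans (≈⇒≤ (∣x∣≈x ≤-refl)) (≈⇒≤ (≈-sym (zeroˡ c)))
  ∣∑∣≤ {suc n} f c h = ≤-trans (∣x+y∣≤ (h Fin.zero) (∣∑∣≤ (f ∘ Fin.suc) c (h ∘ Fin.suc)))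
    (≈⇒≤ (solve 2 (λ m c → c :+ m :* c := (con 1ℚ :+ m) :* c) ≈-refl (nat n) c))

  _·_ : ∀ {n} → Vector Carrier n → Vector Carrier n → Carrier
  u · v = sum (λ i → u i * v i)

  combination : ∀ {d k} → Vector Carrier k → Vector (Vector Carrier d) k → Vector Carrier d
  combination t v j = sum (λ i → t i * v i j)

  ·-cong : ∀ {n} {u u′ v v′ : Vector Carrier n} → (∀ i → u i ≈ u′ i) → (∀ i → v i ≈ v′ i) → u · v ≈ u′ · v′
  ·-cong p q = ∑-cong (λ i → *-cong (p i) (q i))

  ·-congˡ : ∀ {n} {u u′ : Vector Carrier n} v → (∀ i → u i ≈ u′ i) → u · v ≈ u′ · v
  ·-congˡ v p = ·-cong p (λ _ → ≈-refl)

  ·-comm : ∀ {n} (u v : Vector Carrier n) → u · v ≈ v · u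
  ·-comm u v = ∑-cong (λ i → *-comm (u i) (v i))

  ·-zeroˡ : ∀ {n} (u w : Vector Carrier n) → (∀ i → u i ≈ 0#) → u · w ≈ 0#
  ·-zeroˡ u w eq = ∑-zero (λ i → u i * w i) (λ i → zeroˡ′ (w i) (eq i))

  ·-+ˡ : ∀ {n} (u v w : Vector Carrier n) → (λ i → u i + v i) · w ≈ u · w + v · w
  ·-+ˡ u v w = ≈-trans (∑-cong (λ i → distribʳ (w i) (u i) (v i)))
    (∑.∑-distrib-+ (λ i → u i * w i) (λ i → v i * w i))

  ·-+ʳ : ∀ {n} (w u v : Vector Carrier n) → w · (λ i → u i + v i) ≈ w · u + w · v
  ·-+ʳ w u v = ≈-trans (∑-cong (λ i → distribˡ (w i) (u i) (v i)))
    (∑.∑-distrib-+ (λ i → w i * u i) (λ i → w i * v i))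

  ·-*ˡ : ∀ {n} c (u w : Vector Carrier n) → (λ i → c * u i) · w ≈ c * (u · w)
  ·-*ˡ c u w = ≈-trans (∑-cong (λ i → *-assoc c (u i) (w i)))
    (≈-sym (∑.*-distribˡ-sum c (λ i → u i * w i)))

  ·-lerp : ∀ {n} (w x y : Vector Carrier n) t → w · (λ j → lerp (x j) (y j) t) ≈ lerp (w · x) (w · y) t
  ·-lerp w x y t = begin
    w · (λ j → lerp (x j) (y j) t)
      -- Subtraction becomes multiplication by `- 1#`, so that additivity and the extraction of
      -- scalars suffice to split the sum.
      ≈⟨ ∑-cong (λ j → solve 4 (λ w x y t → w :* (x :+ t :* (y :- x)) := w :* x :+ t :* (w :* y :+ (:- con 1ℚ) :* (w :* x))) ≈-refl (w j) (x j) (y j) t) ⟩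
    sum (λ j → w j * x j + t * (w j * y j + (- 1#) * (w j * x j)))
      ≈⟨ ≈-trans (∑.∑-distrib-+ (λ j → w j * x j) (λ j → t * (w j * y j + (- 1#) * (w j * x j))))
           (+-cong ≈-refl (≈-sym (∑.*-distribˡ-sum t (λ j → w j * y j + (- 1#) * (w j * x j))))) ⟩
    w · x + t * sum (λ j → w j * y j + (- 1#) * (w j * x j))
      ≈⟨ +-cong ≈-refl (*-cong ≈-refl (≈-trans (∑.∑-distrib-+ (λ j → w j * y j) (λ j → (- 1#) * (w j * x j)))
           (+-cong ≈-refl (≈-sym (∑.*-distribˡ-sum (- 1#) (λ j → w j * x j)))))) ⟩
    w · x + t * (w · y + (- 1#) * (w · x))
      ≈⟨ solve 3 (λ a b t → a :+ t :* (b :+ (:- con 1ℚ) :* a) := a :+ t :* (b :- a)) ≈-refl (w · x) (w · y) t ⟩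
    lerp (w · x) (w · y) t ∎
    where open ≈-Reasoning

  ·-close : ∀ {n} (w x y : Vector Carrier n) W e → (∀ j → ∣ w j ∣ ≤ W) → (∀ j → ∣ y j - x j ∣ ≤ e) →
            ∣ w · y - w · x ∣ ≤ nat n * (W * e)
  ·-close w x y W e w≤W y≈x = ∣∣-resp-≤ (≈-sym difference)
    (∣∑∣≤ (λ j → w j * (y j - x j)) (W * e) (λ j → ∣x*y∣≤ (w≤W j) (y≈x j)))
    where
    open ≈-Reasoning
    difference : sum (λ j → w j * (y j - x j)) ≈ w · y - w · x
    difference = begin
      sum (λ j → w j * (y j - x j))
        ≈⟨ ∑-cong (λ j → solve 3 (λ w x y → w :* (y :- x) := w :* y :+ (:- con 1ℚ) :* (w :* x)) ≈-refl (w j) (x j) (y j)) ⟩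
      sum (λ j → w j * y j + (- 1#) * (w j * x j))
        ≈⟨ ≈-trans (∑.∑-distrib-+ (λ j → w j * y j) (λ j → (- 1#) * (w j * x j)))
             (+-cong ≈-refl (≈-sym (∑.*-distribˡ-sum (- 1#) (λ j → w j * x j)))) ⟩
      w · y + (- 1#) * (w · x)
        ≈⟨ solve 2 (λ a b → b :+ (:- con 1ℚ) :* a := b :- a) ≈-refl (w · x) (w · y) ⟩
      w · y - w · x ∎

  ·-nonneg : ∀ {n} (x : Vector Carrier n) → 0# ≤ x · x
  ·-nonneg {zero}  x = ≤-refl
  ·-nonneg {suc n} x = 0≤+ (0≤x*x (x Fin.zero)) (·-nonneg (x ∘ Fin.suc))

  x+y≈0⇒x≈0 : ∀ {x y} → 0# ≤ x → 0# ≤ y → x + y ≈ 0# → x ≈ 0#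
  x+y≈0⇒x≈0 {x} {y} 0≤x 0≤y eq = ≤-antisym (≤-trans (slack y 0≤y ≈-refl) (≈⇒≤ eq)) 0≤x

  x·x≈0⇒x≈0 : ∀ {n} (x : Vector Carrier n) → x · x ≈ 0# → ∀ i → x i ≈ 0#
  x·x≈0⇒x≈0 {suc n} x eq Fin.zero =
    x*x≈0⇒x≈0 (x+y≈0⇒x≈0 (0≤x*x (x Fin.zero)) (·-nonneg (x ∘ Fin.suc)) eq)
  x·x≈0⇒x≈0 {suc n} x eq (Fin.suc i) = x·x≈0⇒x≈0 (x ∘ Fin.suc)
    (x+y≈0⇒x≈0 (·-nonneg (x ∘ Fin.suc)) (0≤x*x (x Fin.zero)) (≈-trans (+-comm _ _) eq)) i

  Independent : ∀ {k n} → Vector (Vector Carrier n) k → Set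
  Independent v = ∀ t → (∀ j → combination t v j ≈ 0#) → ∀ i → t i ≈ 0#

  -- Gaussian elimination. If coordinate 0 vanishes throughout, one vector is dropped with
  -- coefficient 0. Otherwise some `v p` is nonzero there and clears that coordinate from the
  -- others; cross-multiplying avoids division, at the price of scaling the coefficients found by
  -- `v p Fin.zero`, which keeps them nonzero.
  more-vectors-than-coordinates : ∀ n (v : Vector (Vector Carrier n) (suc n)) →
    Σ (Vector Carrier (suc n)) λ t → (∀ j → combination t v j ≈ 0#) × ∃ λ i → ¬ t i ≈ 0#
  more-vectors-than-coordinates zero v = (λ _ → 1#) , (λ ()) , Fin.zero , 1≉0
  more-vectors-than-coordinates (suc n) v with Fin.all? (λ i → v i Fin.zero ≈? 0#)
  ... | yes v₀≈0 with more-vectors-than-coordinates n (λ i j → v (Fin.suc i) (Fin.suc j))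
  ...   | t , eq , i , ti≉0 = 0# Vector.∷ t , vanish , Fin.suc i , ti≉0
    where
    vanish : ∀ j → combination (0# Vector.∷ t) v j ≈ 0#
    vanish Fin.zero    = ∑-zero _ (λ i → zeroʳ′ ((0# Vector.∷ t) i) (v₀≈0 i))
    vanish (Fin.suc j) = +-zero (zeroˡ (v Fin.zero (Fin.suc j))) (eq j)
  more-vectors-than-coordinates (suc n) v | no v₀≉0 with Fin.¬∀⟶∃¬ _ _ (λ i → v i Fin.zero ≈? 0#) v₀≉0
  ... | p , vp≉0 with more-vectors-than-coordinates n (λ i j →
           v p Fin.zero * v (punchIn p i) (Fin.suc j) - v (punchIn p i) Fin.zero * v p (Fin.suc j))
  ...   | s , eq , i , si≉0 = t , vanish , punchIn p i , λ ti≈0 →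
          si≉0 (*-zero-cancelˡ vp≉0 (≈-trans (≈-sym (≈-reflexive (Vector.insertAt-punchIn rest p tp i))) ti≈0))
    where
    column : Vector Carrier (suc n)
    column i = s i * v (punchIn p i) Fin.zero

    tp : Carrier
    tp = - sum column

    rest : Vector Carrier (suc n)
    rest i = v p Fin.zero * s i

    t : Vector Carrier (suc (suc n))
    t = Vector.insertAt rest p tp

    eliminated : ∀ j i → Carrier
    eliminated j i = v p Fin.zero * v (punchIn p i) j - v (punchIn p i) Fin.zero * v p j

    split : ∀ j → combination t v j ≈ sum (λ i → s i * eliminated j i)
    split j = begin
      combination t v j
        ≈⟨ ∑.sum-remove {i = p} (λ i → t i * v i j) ⟩
      t p * v p j + sum (λ i → t (punchIn p i) * v (punchIn p i) j)
        ≈⟨ +-cong (*-cong (≈-reflexive (Vector.insertAt-lookup rest p tp)) ≈-refl)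
            (∑-cong (λ i → *-cong (≈-reflexive (Vector.insertAt-punchIn rest p tp i)) (≈-refl {v (punchIn p i) j}))) ⟩
      - sum column * v p j + sum (λ i → rest i * v (punchIn p i) j)
        ≈⟨ +-cong (solve 2 (λ S v → :- S :* v := (:- v) :* S) ≈-refl (sum column) (v p j)) ≈-refl ⟩
      - v p j * sum column + sum (λ i → rest i * v (punchIn p i) j)
        ≈⟨ +-cong (∑.*-distribˡ-sum (- v p j) column) ≈-refl ⟩
      sum (λ i → - v p j * column i) + sum (λ i → rest i * v (punchIn p i) j)
        ≈⟨ ∑.∑-distrib-+ (λ i → - v p j * column i) (λ i → rest i * v (punchIn p i) j) ⟨
      sum (λ i → - v p j * column i + rest i * v (punchIn p i) j)
        ≈⟨ ∑-cong (λ i → solve 5 (λ vpj si vi0 vp0 vij →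
              :- vpj :* (si :* vi0) :+ vp0 :* si :* vij := si :* (vp0 :* vij :- vi0 :* vpj)) ≈-refl
             (v p j) (s i) (v (punchIn p i) Fin.zero) (v p Fin.zero) (v (punchIn p i) j)) ⟩
      sum (λ i → s i * eliminated j i) ∎
      where open ≈-Reasoning

    vanish : ∀ j → combination t v j ≈ 0#
    vanish Fin.zero = ≈-trans (split Fin.zero) (∑-zero _ λ i → zeroʳ′ (s i)
      (solve 2 (λ a b → a :* b :- b :* a := con 0ℚ) ≈-refl (v p Fin.zero) (v (punchIn p i) Fin.zero)))
    vanish (Fin.suc j) = ≈-trans (split (Fin.suc j)) (eq j)

  maximal : ∀ {n} (f : Fin (suc n) → Carrier) → ∃ λ i → ∀ j → f j ≤ f i
  maximal {zero}  f = Fin.zero , λ { Fin.zero → ≤-refl }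
  maximal {suc n} f with maximal (f ∘ Fin.suc)
  ... | i , max with ≤-total (f Fin.zero) (f (Fin.suc i))
  ...   | inj₁ le = Fin.suc i , λ { Fin.zero → le ; (Fin.suc j) → max j }
  ...   | inj₂ ge = Fin.zero  , λ { Fin.zero → ≤-refl ; (Fin.suc j) → ≤-trans (max j) ge }

-- Hyperplanes through a common flat as members of a pencil

module Arrangements (F : OrderedField) where
  open OrderedField F
  open OrderedFieldProperties F
  open LinearAlgebra F

  record Arrangement (d k m : ℕ) : Set where
    field
      normal      : Fin m → Vector Carrier d
      offset      : Fin m → Carrier
      normal≉0    : ∀ i → ∃ λ j → ¬ normal i j ≈ 0#
      distinct    : ∀ i j → i ≢ j → ¬ (∀ x → (normal i · x ≈ offset i → normal j · x ≈ offset j) ×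
                                             (normal j · x ≈ offset j → normal i · x ≈ offset i))
      base        : Vector Carrier d
      directions  : Vector (Vector Carrier d) k
      independent : Independent directions
      axis⊆       : ∀ i t → normal i · (λ j → base j + combination t directions j) ≈ offset i

    normal·base : ∀ i → normal i · base ≈ offset i
    normal·base i = ≈-trans (·-cong {u = normal i} (λ _ → ≈-refl)
      (λ j → ≈-sym (≈-trans (+-cong ≈-refl (∑-zero _ (λ l → zeroˡ (directions l j)))) (+-identityʳ (base j)))))
      (axis⊆ i (λ _ → 0#))

    -- Two points of the axis that differ by this combination satisfy the same equation; subtract.
    normal⊥axis : ∀ i t → normal i · combination t directions ≈ 0#
    normal⊥axis i t = begin
      normal i · c                                   ≈⟨ solve 2 (λ a b → b := a :+ b :- a) ≈-refl (normal i · base) _ ⟩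
      normal i · base + normal i · c - normal i · base ≈⟨ +-cong (≈-trans (≈-sym (·-+ʳ (normal i) base c)) (axis⊆ i t)) (-‿cong (normal·base i)) ⟩
      offset i - offset i                            ≈⟨ -‿inverseʳ (offset i) ⟩
      0#                                             ∎
      where
      open ≈-Reasoning
      c : Vector Carrier d
      c = combination t directions

  record Relation {n} (u v w : Vector Carrier n) : Set where
    field
      α β γ      : Carrier
      vanishes   : ∀ j → α * u j + β * v j + γ * w j ≈ 0#
      nontrivial : ¬ (α ≈ 0# × β ≈ 0# × γ ≈ 0#)

  -- The normals are orthogonal to the k axis directions, so a relation among
  -- three normals and the directions splits into two orthogonal halves.
  module _ {k m} (A : Arrangement (suc (suc k)) k m) where
    open Arrangement A

    normals-related : ∀ i₁ i₂ i₃ → Relation (offset i₁ Vector.∷ normal i₁) (offset i₂ Vector.∷ normal i₂) (offset i₃ Vector.∷ normal i₃)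
    normals-related i₁ i₂ i₃ with more-vectors-than-coordinates (suc (suc k))
      (normal i₁ Vector.∷ normal i₂ Vector.∷ normal i₃ Vector.∷ directions)
    ... | t , eq , i , ti≉0 = record
      { α = α ; β = β ; γ = γ
      ; vanishes = λ { Fin.zero → offsets ; (Fin.suc j) → n≈0 j }
      ; nontrivial = λ { (α≈0 , β≈0 , γ≈0) → ti≉0 (all-zero α≈0 β≈0 γ≈0 i) }
      }
      where
      open ≈-Reasoning
      α β γ : Carrier
      α = t Fin.zero
      β = t (Fin.suc Fin.zero)
      γ = t (Fin.suc (Fin.suc Fin.zero))

      s : Vector Carrier k
      s i = t (Fin.suc (Fin.suc (Fin.suc i)))

      n c : Vector Carrier (suc (suc k))
      n j = α * normal i₁ j + β * normal i₂ j + γ * normal i₃ j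
      c = combination s directions

      n+c≈0 : ∀ j → n j + c j ≈ 0#
      n+c≈0 j = ≈-trans (solve 4 (λ a b g r → a :+ b :+ g :+ r := a :+ (b :+ (g :+ r))) ≈-refl
        (α * normal i₁ j) (β * normal i₂ j) (γ * normal i₃ j) (c j)) (eq j)

      n· : ∀ x → n · x ≈ α * (normal i₁ · x) + β * (normal i₂ · x) + γ * (normal i₃ · x)
      n· x = begin
        n · x
          ≈⟨ ·-+ˡ (λ j → α * normal i₁ j + β * normal i₂ j) (λ j → γ * normal i₃ j) x ⟩
        (λ j → α * normal i₁ j + β * normal i₂ j) · x + (λ j → γ * normal i₃ j) · x
          ≈⟨ +-cong (·-+ˡ (λ j → α * normal i₁ j) (λ j → β * normal i₂ j) x) ≈-refl ⟩
        (λ j → α * normal i₁ j) · x + (λ j → β * normal i₂ j) · x + (λ j → γ * normal i₃ j) · x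
          ≈⟨ +-cong (+-cong (·-*ˡ α (normal i₁) x) (·-*ˡ β (normal i₂) x)) (·-*ˡ γ (normal i₃) x) ⟩
        α * (normal i₁ · x) + β * (normal i₂ · x) + γ * (normal i₃ · x) ∎

      n·c≈0 : n · c ≈ 0#
      n·c≈0 = ≈-trans (n· c) (+-zero (+-zero (zeroʳ′ α (normal⊥axis i₁ s)) (zeroʳ′ β (normal⊥axis i₂ s))) (zeroʳ′ γ (normal⊥axis i₃ s)))

      -- From n + c = 0 and n orthogonal to c follows n · n = 0, and a sum of squares vanishes only
      -- termwise.
      n≈0 : ∀ j → n j ≈ 0#
      n≈0 = x·x≈0⇒x≈0 n (begin
        n · n               ≈⟨ solve 2 (λ a b → a := b :+ a :- b) ≈-refl (n · n) (n · c) ⟩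
        n · c + n · n - n · c ≈⟨ +-cong (+-comm (n · c) (n · n)) (-‿cong n·c≈0) ⟩
        n · n + n · c - 0#  ≈⟨ +-cong (·-+ʳ n n c) ≈-refl ⟨
        n · (λ j → n j + c j) - 0# ≈⟨ +-cong (≈-trans (·-comm n (λ j → n j + c j)) (·-zeroˡ (λ j → n j + c j) n n+c≈0)) ≈-refl ⟩
        0# - 0#             ≈⟨ -‿inverseʳ 0# ⟩
        0#                  ∎)

      -- The base point lies on all three hyperplanes, so pairing n = 0 with it carries the relation
      -- over to the offsets.
      offsets : α * offset i₁ + β * offset i₂ + γ * offset i₃ ≈ 0#
      offsets = begin
        α * offset i₁ + β * offset i₂ + γ * offset i₃
          ≈⟨ +-cong (+-cong (*-cong ≈-refl (normal·base i₁)) (*-cong ≈-refl (normal·base i₂))) (*-cong ≈-refl (normal·base i₃)) ⟨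
        α * (normal i₁ · base) + β * (normal i₂ · base) + γ * (normal i₃ · base)
          ≈⟨ n· base ⟨
        n · base
          ≈⟨ ·-zeroˡ n base n≈0 ⟩
        0# ∎

      -- Since n = 0 also gives c = 0, independence of the directions yields s = 0; a relation with
      -- α, β, γ all zero would therefore be trivial altogether.
      s≈0 : α ≈ 0# → β ≈ 0# → γ ≈ 0# → ∀ i → s i ≈ 0#
      s≈0 α≈0 β≈0 γ≈0 = independent s λ j → begin
        c j        ≈⟨ +-identityˡ (c j) ⟨
        0# + c j   ≈⟨ +-cong (n≈0 j) ≈-refl ⟨
        n j + c j  ≈⟨ n+c≈0 j ⟩
        0#         ∎

      all-zero : α ≈ 0# → β ≈ 0# → γ ≈ 0# → ∀ i → t i ≈ 0#
      all-zero α≈0 β≈0 γ≈0 Fin.zero                               = α≈0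
      all-zero α≈0 β≈0 γ≈0 (Fin.suc Fin.zero)                     = β≈0
      all-zero α≈0 β≈0 γ≈0 (Fin.suc (Fin.suc Fin.zero))           = γ≈0
      all-zero α≈0 β≈0 γ≈0 (Fin.suc (Fin.suc (Fin.suc i)))        = s≈0 α≈0 β≈0 γ≈0 i

  minor : ∀ {n} (u v : Vector Carrier n) → Fin n → Fin n → Carrier
  minor u v p q = u p * v q - u q * v p

  -- The 3 × 3 minor of u, v, w at the columns p, q, j vanishes; expanding it gives the rule.
  -- Combining the relation at j, p and q with the 2 × 2 minors as weights eliminates α and β and
  -- leaves γ times the claim. If γ were 0, a nonzero minor of u and v would force α and β to be 0
  -- too.
  cramer : ∀ {n} {u v w : Vector Carrier n} → Relation u v w → ∀ p q → ¬ minor u v p q ≈ 0# →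
           ∀ j → minor u v p q * w j ≈ w p * minor u v j q + w q * minor u v p j
  cramer {u = u} {v} {w} R p q D≉0 j = x-y≈0⇒x≈y (*-zero-cancelˡ γ≉0 (begin
      γ * (D * w j - (w p * minor u v j q + w q * minor u v p j))
        ≈⟨ solve 12 (λ a b c up uq uj vp vq vj wp wq wj →
             c :* ((up :* vq :- uq :* vp) :* wj :- (wp :* (uj :* vq :- uq :* vj) :+ wq :* (up :* vj :- uj :* vp)))
             := (up :* vq :- uq :* vp) :* (a :* uj :+ b :* vj :+ c :* wj)
                :+ ((:- (uj :* vq :- uq :* vj)) :* (a :* up :+ b :* vp :+ c :* wp)
                :+ (:- (up :* vj :- uj :* vp)) :* (a :* uq :+ b :* vq :+ c :* wq)))
             ≈-refl α β γ (u p) (u q) (u j) (v p) (v q) (v j) (w p) (w q) (w j) ⟩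
      D * rel j + (- minor u v j q * rel p + - minor u v p j * rel q)
        ≈⟨ +-zero (zeroʳ′ D (vanishes j)) (+-zero (zeroʳ′ _ (vanishes p)) (zeroʳ′ _ (vanishes q))) ⟩
      0# ∎))
    where
    open ≈-Reasoning
    open Relation R
    D : Carrier
    D = minor u v p q

    rel : ∀ j → Carrier
    rel j = α * u j + β * v j + γ * w j

    γ≉0 : ¬ γ ≈ 0#
    γ≉0 γ≈0 = nontrivial (*-zero-cancelˡ D≉0 α-part , *-zero-cancelˡ D≉0 β-part , γ≈0)
      where
      α-part : D * α ≈ 0#
      α-part = begin
        D * α
          ≈⟨ solve 9 (λ a b c up uq vp vq wp wq →
               (up :* vq :- uq :* vp) :* a := vq :* (a :* up :+ b :* vp :+ c :* wp)
               :+ ((:- vp) :* (a :* uq :+ b :* vq :+ c :* wq) :+ (vp :* wq :- vq :* wp) :* c))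
               ≈-refl α β γ (u p) (u q) (v p) (v q) (w p) (w q) ⟩
        v q * rel p + (- v p * rel q + (v p * w q - v q * w p) * γ)
          ≈⟨ +-zero (zeroʳ′ _ (vanishes p)) (+-zero (zeroʳ′ _ (vanishes q)) (zeroʳ′ _ γ≈0)) ⟩
        0# ∎

      β-part : D * β ≈ 0#
      β-part = begin
        D * β
          ≈⟨ solve 9 (λ a b c up uq vp vq wp wq →
               (up :* vq :- uq :* vp) :* b := up :* (a :* uq :+ b :* vq :+ c :* wq)
               :+ ((:- uq) :* (a :* up :+ b :* vp :+ c :* wp) :+ (uq :* wp :- up :* wq) :* c))
               ≈-refl α β γ (u p) (u q) (v p) (v q) (w p) (w q) ⟩
        u p * rel q + (- u q * rel p + (u q * w p - u p * w q) * γ)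
          ≈⟨ +-zero (zeroʳ′ _ (vanishes q)) (+-zero (zeroʳ′ _ (vanishes p)) (zeroʳ′ _ γ≈0)) ⟩
        0# ∎

  affine : ∀ {n} → Carrier → Vector Carrier n → Vector Carrier n → Vector Carrier n
  affine v f g j = f j + v * g j

  -- The two affine charts of the pencil as a projective line. Having both allows the coordinate `v`
  -- to stay in [-1, 1].
  member : ∀ {n} → Bool → Carrier → Vector Carrier n → Vector Carrier n → Vector Carrier n
  member true  v f g = affine v f g
  member false v f g = affine v g f

  -- Homogeneous coordinates, in reduced echelon form at the pivots P and Q.
  -- Choosing a maximal minor as pivot makes all entries at most 1.
  record Pencil (d m : ℕ) (h : Fin m → Vector Carrier (suc d)) : Set where
    field
      P     : Fin (suc d)
      -- Counting Q among the places other than P builds P ≠ Q into the type and lets two uses of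
      -- `punchIn` enumerate the places that are not pivots.
      Q′    : Fin d

    Q : Fin (suc d)
    Q = punchIn P Q′

    field
      f g   : Vector Carrier (suc d)
      f≤1   : ∀ j → ∣ f j ∣ ≤ 1#
      g≤1   : ∀ j → ∣ g j ∣ ≤ 1#
      fP≈1  : f P ≈ 1#
      fQ≈0  : f Q ≈ 0#
      gP≈0  : g P ≈ 0#
      gQ≈1  : g Q ≈ 1#
      side  : Fin m → Bool
      v     : Fin m → Carrier
      v≤1   : ∀ i → ∣ v i ∣ ≤ 1#
      spans : ∀ i X → h i · X ≈ 0# → member (side i) (v i) f g · X ≈ 0#

  module _ {d m} (h : Fin m → Vector Carrier (suc d)) (i₁ i₂ : Fin m)
           (minor≉0 : ∃ λ p → ∃ λ q → ¬ minor (h i₁) (h i₂) p q ≈ 0#)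
           (related : ∀ i → Relation (h i₁) (h i₂) (h i))
           (h≉0 : ∀ i → ∃ λ j → ¬ h i j ≈ 0#) where
    private
      M : Fin (suc d) → Fin (suc d) → Carrier
      M = minor (h i₁) (h i₂)

      row-max : ∀ p → ∃ λ q → ∀ j → ∣ M p j ∣ ≤ ∣ M p q ∣
      row-max p = maximal (λ q → ∣ M p q ∣)

      max : ∃ λ p → ∀ j → ∣ M j (proj₁ (row-max j)) ∣ ≤ ∣ M p (proj₁ (row-max p)) ∣
      max = maximal (λ p → ∣ M p (proj₁ (row-max p)) ∣)

      P Q : Fin (suc d)
      P = proj₁ max
      Q = proj₁ (row-max P)

      D : Carrier
      D = M P Q

      M≤D : ∀ p q → ∣ M p q ∣ ≤ ∣ D ∣
      M≤D p q = ≤-trans (proj₂ (row-max p) q) (proj₂ max p)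

      D≉0 : ¬ D ≈ 0#
      D≉0 D≈0 = proj₂ (proj₂ minor≉0) (∣x∣≤0⇒x≈0 (bound (proj₁ minor≉0) (proj₁ (proj₂ minor≉0))))
        where
        bound : ∀ p q → ∣ M p q ∣ ≤ 0#
        bound p q = ≤-trans (M≤D p q) (∣∣-resp-≤ D≈0 (≈⇒≤ (∣x∣≈x ≤-refl)))

      P≢Q : P ≢ Q
      P≢Q P≡Q = D≉0 (subst (λ q → M P q ≈ 0#) P≡Q (-‿inverseʳ (h i₁ P * h i₂ P)))

      r : Carrier
      r = proj₁ (reciprocal D≉0)

      Dr≈1 : D * r ≈ 1#
      Dr≈1 = proj₂ (reciprocal D≉0)

      -- By Cramer's rule `h i` is `h i P` times f plus `h i Q` times g. The entries are minors
      -- divided by the largest minor, hence at most 1 in absolute value.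
      f g : Vector Carrier (suc d)
      f j = M j Q * r
      g j = M P j * r

      ratio≤1 : ∀ p q → ∣ M p q * r ∣ ≤ 1#
      ratio≤1 p q = ≤-trans (∣x*y∣≤ (M≤D p q) ≤-refl)
        (≤-trans (≈⇒≤ (≈-sym (∣x*y∣≈∣x∣*∣y∣ D r))) (∣∣-resp-≤ Dr≈1 (≈⇒≤ (∣x∣≈x 0≤1))))

      decompose : ∀ i j → h i j ≈ h i P * f j + h i Q * g j
      decompose i j = begin
        h i j                             ≈⟨ *-identityʳ (h i j) ⟨
        h i j * 1#                        ≈⟨ *-cong ≈-refl Dr≈1 ⟨
        h i j * (D * r)                   ≈⟨ solve 3 (λ h D r → h :* (D :* r) := D :* h :* r) ≈-refl (h i j) D r ⟩
        D * h i j * r                     ≈⟨ *-cong (cramer (related i) P Q D≉0 j) ≈-refl ⟩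
        (h i P * M j Q + h i Q * M P j) * r ≈⟨ solve 5 (λ a b c e r → (a :* b :+ c :* e) :* r := a :* (b :* r) :+ c :* (e :* r)) ≈-refl
                                               (h i P) (M j Q) (h i Q) (M P j) r ⟩
        h i P * f j + h i Q * g j         ∎
        where open ≈-Reasoning

      record Normalised (i : Fin m) (f g : Vector Carrier (suc d)) : Set where
        field
          v     : Carrier
          v≤1   : ∣ v ∣ ≤ 1#
          spans : ∀ X → h i · X ≈ 0# → affine v f g · X ≈ 0#

      -- Divides by the larger coefficient a, so v = b/a. If a were 0, then b would be too and `h i`
      -- would vanish.
      normalise : ∀ i a b f g → (∀ j → h i j ≈ a * f j + b * g j) → ∣ b ∣ ≤ ∣ a ∣ → Normalised i f g
      normalise i a b f g eq b≤a = record
        { v = b * s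
        ; v≤1 = ≤-trans (∣x*y∣≤ b≤a ≤-refl) (≤-trans (≈⇒≤ (≈-sym (∣x*y∣≈∣x∣*∣y∣ a s))) (∣∣-resp-≤ as≈1 (≈⇒≤ (∣x∣≈x 0≤1))))
        ; spans = λ X hX≈0 → *-zero-cancelˡ a≉0 (begin
            a * (affine (b * s) f g · X)                ≈⟨ ·-*ˡ a (affine (b * s) f g) X ⟨
            (λ j → a * (f j + b * s * g j)) · X         ≈⟨ ·-congˡ X (λ j → begin
                a * (f j + b * s * g j)     ≈⟨ solve 5 (λ a b s f g → a :* (f :+ b :* s :* g) := a :* f :+ b :* (a :* s) :* g) ≈-refl a b s (f j) (g j) ⟩
                a * f j + b * (a * s) * g j ≈⟨ +-cong ≈-refl (*-cong (≈-trans (*-cong ≈-refl as≈1) (*-identityʳ b)) ≈-refl) ⟩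
                a * f j + b * g j           ≈⟨ eq j ⟨
                h i j                       ∎) ⟩
            h i · X                                     ≈⟨ hX≈0 ⟩
            0#                                          ∎)
        }
        where
        open ≈-Reasoning
        a≉0 : ¬ a ≈ 0#
        a≉0 a≈0 = proj₂ (h≉0 i) (≈-trans (eq (proj₁ (h≉0 i))) (+-zero (zeroˡ′ _ a≈0) (zeroˡ′ _ b≈0)))
          where
          ∣b∣≤0 : ∣ b ∣ ≤ 0#
          ∣b∣≤0 = ≤-trans b≤a (∣∣-resp-≤ a≈0 (≈⇒≤ (∣x∣≈x ≤-refl)))

          b≈0 : b ≈ 0#
          b≈0 = ∣x∣≤0⇒x≈0 ∣b∣≤0

        s : Carrier
        s = proj₁ (reciprocal a≉0)

        as≈1 : a * s ≈ 1#
        as≈1 = proj₂ (reciprocal a≉0)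

      choose : ∀ i → Σ Bool λ b → if b then Normalised i f g else Normalised i g f
      choose i = [ (λ Q≤P → true  , normalise i (h i P) (h i Q) f g (decompose i) Q≤P)
                 , (λ P≤Q → false , normalise i (h i Q) (h i P) g f
                     (λ j → ≈-trans (decompose i j) (+-comm (h i P * f j) (h i Q * g j))) P≤Q)
                 ]′ (≤-total ∣ h i Q ∣ ∣ h i P ∣)

      Coordinate : Fin m → Set
      Coordinate i = Σ Bool λ b → Σ Carrier λ v → ∣ v ∣ ≤ 1# × (∀ X → h i · X ≈ 0# → member b v f g · X ≈ 0#)

      coordinate : ∀ i → (Σ Bool λ b → if b then Normalised i f g else Normalised i g f) → Coordinate i
      coordinate i (true  , n) = true  , Normalised.v n , Normalised.v≤1 n , Normalised.spans n
      coordinate i (false , n) = false , Normalised.v n , Normalised.v≤1 n , Normalised.spans n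

      value : ∀ i → Coordinate i
      value i = coordinate i (choose i)

    pencil : Pencil d m h
    pencil = record
      { P = P ; Q′ = Fin.punchOut P≢Q ; f = f ; g = g
      ; f≤1 = λ j → ratio≤1 j Q ; g≤1 = λ j → ratio≤1 P j
      ; fP≈1 = Dr≈1
      ; fQ≈0 = subst (λ q → f q ≈ 0#) (sym Q≡) (zeroˡ′ r (-‿inverseʳ (h i₁ Q * h i₂ Q)))
      ; gP≈0 = zeroˡ′ r (-‿inverseʳ (h i₁ P * h i₂ P))
      ; gQ≈1 = subst (λ q → g q ≈ 1#) (sym Q≡) Dr≈1
      ; side = λ i → proj₁ (value i)
      ; v = λ i → proj₁ (proj₂ (value i))
      ; v≤1 = λ i → proj₁ (proj₂ (proj₂ (value i)))
      ; spans = λ i → proj₂ (proj₂ (proj₂ (value i)))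
      }
      where
      Q≡ : punchIn P (Fin.punchOut P≢Q) ≡ Q
      Q≡ = Fin.punchIn-punchOut P≢Q

  module _ {k m} (A : Arrangement (suc (suc k)) k m) {i₁ i₂ : Fin m} (i₁≢i₂ : i₁ ≢ i₂) (ι : Carrier) (ι≉0 : ¬ ι ≈ 0#) where
    open Arrangement A

    -- The scale ι will be 1/n: the homogenising coordinate of a point is then n instead of 1, which
    -- makes it comparable to the coordinates of a box in the grid.
    homogeneous : Fin m → Vector Carrier (suc (suc (suc k)))
    homogeneous i = - (ι * offset i) Vector.∷ normal i

    private
      h : Fin m → Vector Carrier (suc (suc (suc k)))
      h = homogeneous

      h≉0 : ∀ i → ∃ λ j → ¬ h i j ≈ 0#
      h≉0 i with normal≉0 i
      ... | j , nj≉0 = Fin.suc j , nj≉0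

      related : ∀ i → Relation (h i₁) (h i₂) (h i)
      related i = record
        { α = R.α ; β = R.β ; γ = R.γ ; nontrivial = R.nontrivial
        ; vanishes = λ
          { Fin.zero → ≈-trans (solve 7 (λ a b c u v w i → a :* (:- (i :* u)) :+ b :* (:- (i :* v)) :+ c :* (:- (i :* w))
                := (:- i) :* (a :* u :+ b :* v :+ c :* w)) ≈-refl R.α R.β R.γ (offset i₁) (offset i₂) (offset i) ι)
              (zeroʳ′ (- ι) (R.vanishes Fin.zero))
          ; (Fin.suc j) → R.vanishes (Fin.suc j) }
        }
        where module R = Relation (normals-related A i₁ i₂ i)

      -- Vanishing minors make the two equations proportional, with nonzero factors because neither
      -- normal is 0; the hyperplanes would coincide.
      vanishing-minors : (∀ p q → minor (h i₁) (h i₂) p q ≈ 0#) → ⊥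
      vanishing-minors M≈0 with normal≉0 i₁ | normal≉0 i₂
      ... | p , a≉0 | q , n₂q≉0 = distinct i₁ i₂ i₁≢i₂ λ x → forth x , back x
        where
        open ≈-Reasoning
        a b : Carrier
        a = normal i₁ p
        b = normal i₂ p

        proportional : ∀ j → a * normal i₂ j ≈ b * normal i₁ j
        proportional j = ≈-trans (x-y≈0⇒x≈y (M≈0 (Fin.suc p) (Fin.suc j))) (*-comm _ _)

        offsets : a * offset i₂ ≈ b * offset i₁
        offsets = x-y≈0⇒x≈y (*-zero-cancelˡ ι≉0 (begin
          ι * (a * offset i₂ - b * offset i₁)
            ≈⟨ solve 5 (λ i a b u v → i :* (a :* v :- b :* u) := :- (a :* (:- (i :* v)) :- (:- (i :* u)) :* b)) ≈-refl ι a b (offset i₁) (offset i₂) ⟩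
          - minor (h i₁) (h i₂) (Fin.suc p) Fin.zero
            ≈⟨ -‿cong (M≈0 (Fin.suc p) Fin.zero) ⟩
          - 0#
            ≈⟨ solve 0 (:- con 0ℚ := con 0ℚ) ≈-refl ⟩
          0# ∎))

        b≉0 : ¬ b ≈ 0#
        b≉0 b≈0 = n₂q≉0 (*-zero-cancelˡ a≉0 (≈-trans (proportional q) (zeroˡ′ _ b≈0)))

        dots : ∀ x → a * (normal i₂ · x) ≈ b * (normal i₁ · x)
        dots x = ≈-trans (≈-sym (·-*ˡ a (normal i₂) x)) (≈-trans (·-congˡ x proportional) (·-*ˡ b (normal i₁) x))

        cancel : ∀ {c x y} → ¬ c ≈ 0# → c * x ≈ c * y → x ≈ y
        cancel {c} {x} {y} c≉0 eq = x-y≈0⇒x≈y (*-zero-cancelˡ c≉0 (begin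
          c * (x - y)     ≈⟨ solve 3 (λ c x y → c :* (x :- y) := c :* x :- c :* y) ≈-refl c x y ⟩
          c * x - c * y   ≈⟨ +-cong eq ≈-refl ⟩
          c * y - c * y   ≈⟨ -‿inverseʳ (c * y) ⟩
          0#              ∎))

        forth : ∀ x → normal i₁ · x ≈ offset i₁ → normal i₂ · x ≈ offset i₂
        forth x eq = cancel a≉0 (≈-trans (dots x) (≈-trans (*-cong ≈-refl eq) (≈-sym offsets)))

        back : ∀ x → normal i₂ · x ≈ offset i₂ → normal i₁ · x ≈ offset i₁
        back x eq = cancel b≉0 (≈-trans (≈-sym (dots x)) (≈-trans (*-cong ≈-refl eq) offsets))

      minor≉0 : ∃ λ p → ∃ λ q → ¬ minor (h i₁) (h i₂) p q ≈ 0#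
      minor≉0 with Fin.all? (λ p → Fin.all? (λ q → minor (h i₁) (h i₂) p q ≈? 0#))
      ... | yes all≈0 = ⊥-elim (vanishing-minors all≈0)
      ... | no  ¬all≈0 with Fin.¬∀⟶∃¬ _ _ (λ p → Fin.all? (λ q → minor (h i₁) (h i₂) p q ≈? 0#)) ¬all≈0
      ...   | p , ¬row with Fin.¬∀⟶∃¬ _ _ (λ q → minor (h i₁) (h i₂) p q ≈? 0#) ¬row
      ...     | q , ≉0 = p , q , ≉0

    abstract
      arrangement-pencil : Pencil (suc (suc k)) m homogeneous
      arrangement-pencil = pencil h i₁ i₂ minor≉0 related h≉0

-- Residues, and the number of fingerprints

/-<⇒far : ∀ a b R .{{_ : ℕ.NonZero R}} → a ℕ.% R ≡ b ℕ.% R → a ℕ./ R ℕ.< b ℕ./ R → a ℕ.+ R ℕ.≤ b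
/-<⇒far a b R eq q< = begin
  a ℕ.+ R                                  ≡⟨ cong (ℕ._+ R) (ℕ.m≡m%n+[m/n]*n a R) ⟩
  a ℕ.% R ℕ.+ a ℕ./ R ℕ.* R ℕ.+ R          ≡⟨ ℕ.+-assoc (a ℕ.% R) _ R ⟩
  a ℕ.% R ℕ.+ (a ℕ./ R ℕ.* R ℕ.+ R)        ≡⟨ cong₂ ℕ._+_ eq (ℕ.+-comm _ R) ⟩
  b ℕ.% R ℕ.+ suc (a ℕ./ R) ℕ.* R          ≤⟨ ℕ.+-monoʳ-≤ (b ℕ.% R) (ℕ.*-monoˡ-≤ R q<) ⟩
  b ℕ.% R ℕ.+ b ℕ./ R ℕ.* R                ≡⟨ ℕ.m≡m%n+[m/n]*n b R ⟨
  b                                        ∎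
  where open ℕ.≤-Reasoning

-- Congruent numbers with different quotients are at least R apart. This recovers a coordinate from
-- its residue once it is known up to a bounded error.
%-≡⇒≡ : ∀ a b R .{{_ : ℕ.NonZero R}} → a ℕ.% R ≡ b ℕ.% R → a ℕ.< b ℕ.+ R → b ℕ.< a ℕ.+ R → a ≡ b
%-≡⇒≡ a b R eq a<b+R b<a+R with ℕ.<-cmp (a ℕ./ R) (b ℕ./ R)
... | tri≈ _ q≡ _ = trans (ℕ.m≡m%n+[m/n]*n a R)
        (trans (cong₂ (λ r q → r ℕ.+ q ℕ.* R) eq q≡) (sym (ℕ.m≡m%n+[m/n]*n b R)))
... | tri< q< _ _ = ⊥-elim (ℕ.<-irrefl refl (ℕ.<-≤-trans b<a+R (/-<⇒far a b R eq q<)))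
... | tri> _ _ q> = ⊥-elim (ℕ.<-irrefl refl (ℕ.<-≤-trans a<b+R (/-<⇒far b a R (sym eq) q>)))

funToFin-cong : ∀ {m n} {f g : Fin m → Fin n} → (∀ i → f i ≡ g i) → funToFin f ≡ funToFin g
funToFin-cong {zero}  eq = refl
funToFin-cong {suc m} eq = cong₂ combine (eq Fin.zero) (funToFin-cong (eq ∘ Fin.suc))

funToFin-injective : ∀ {m n} (f g : Fin m → Fin n) → funToFin f ≡ funToFin g → ∀ i → f i ≡ g i
funToFin-injective f g eq i = trans (sym (Fin.finToFun-funToFin f i))
  (trans (cong (λ u → finToFun u i) eq) (Fin.finToFun-funToFin g i))

finToFun-injective : ∀ {m n} {u v : Fin (n ℕ.^ m)} → (∀ i → finToFun {n} {m} u i ≡ finToFun v i) → u ≡ v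
finToFun-injective {m} {n} {u} {v} eq = trans (sym (Fin.funToFin-finToFin {m} {n} u))
  (trans (funToFin-cong eq) (Fin.funToFin-finToFin {m} {n} v))

-- The rounded parameters of a fan and, for each box, a hyperplane meeting it,
-- a coordinate axis, the other coordinates of the box, and a residue.
record Fingerprint (k m N n R : ℕ) : Set where
  field
    P       : Fin (suc (suc (suc k)))
    Q       : Fin (suc (suc k))
    f g     : Fin (suc k) → Fin (n ℕ.+ n)
    side    : Fin m → Fin 2
    v       : Fin m → Fin (n ℕ.+ n)
    index   : Fin N → Fin m
    axis    : Fin N → Fin (suc (suc k))
    rest    : Fin N → Fin (suc k) → Fin n
    residue : Fin N → Fin R

-- Pointwise, because an encoded function is recovered through its values.
record _∼_ {k m N n R : ℕ} (φ ψ : Fingerprint k m N n R) : Set where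
  private
    module φ = Fingerprint φ
    module ψ = Fingerprint ψ
  field
    P≡       : φ.P ≡ ψ.P
    Q≡       : φ.Q ≡ ψ.Q
    f≡       : ∀ l → φ.f l ≡ ψ.f l
    g≡       : ∀ l → φ.g l ≡ ψ.g l
    side≡    : ∀ i → φ.side i ≡ ψ.side i
    v≡       : ∀ i → φ.v i ≡ ψ.v i
    index≡   : ∀ a → φ.index a ≡ ψ.index a
    axis≡    : ∀ a → φ.axis a ≡ ψ.axis a
    rest≡    : ∀ a l → φ.rest a l ≡ ψ.rest a l
    residue≡ : ∀ a → φ.residue a ≡ ψ.residue a

module _ (k m N n R : ℕ) where
  point-codes codes : ℕ
  point-codes = m ℕ.* (suc (suc k) ℕ.* (n ℕ.^ suc k ℕ.* R))
  codes = suc (suc (suc k)) ℕ.* (suc (suc k) ℕ.* ((n ℕ.+ n) ℕ.^ suc k ℕ.* ((n ℕ.+ n) ℕ.^ suc k ℕ.*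
            (2 ℕ.^ m ℕ.* ((n ℕ.+ n) ℕ.^ m ℕ.* point-codes ℕ.^ N)))))

  module _ (φ : Fingerprint k m N n R) where
    open Fingerprint φ

    encode-point : Fin N → Fin point-codes
    encode-point a = combine (index a) (combine (axis a) (combine (funToFin (rest a)) (residue a)))

    encode : Fin codes
    encode = combine P (combine Q (combine (funToFin f) (combine (funToFin g)
               (combine (funToFin side) (combine (funToFin v) (funToFin encode-point))))))

  encode-injective : ∀ φ ψ → encode φ ≡ encode ψ → φ ∼ ψ
  encode-injective φ ψ eq₀ =
    let module φ = Fingerprint φ
        module ψ = Fingerprint ψ
        P≡ , eq₁ = Fin.combine-injective φ.P _ ψ.P _ eq₀
        Q≡ , eq₂ = Fin.combine-injective φ.Q _ ψ.Q _ eq₁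
        f≡ , eq₃ = Fin.combine-injective (funToFin φ.f) _ (funToFin ψ.f) _ eq₂
        g≡ , eq₄ = Fin.combine-injective (funToFin φ.g) _ (funToFin ψ.g) _ eq₃
        s≡ , eq₅ = Fin.combine-injective (funToFin φ.side) _ (funToFin ψ.side) _ eq₄
        v≡ , eq₆ = Fin.combine-injective (funToFin φ.v) _ (funToFin ψ.v) _ eq₅
        p≡ = funToFin-injective (encode-point φ) (encode-point ψ) eq₆
        i≡ = λ a → Fin.combine-injective (φ.index a) _ (ψ.index a) _ (p≡ a)
        j≡ = λ a → Fin.combine-injective (φ.axis a) _ (ψ.axis a) _ (proj₂ (i≡ a))
        r≡ = λ a → Fin.combine-injective (funToFin (φ.rest a)) (φ.residue a) (funToFin (ψ.rest a)) (ψ.residue a) (proj₂ (j≡ a))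
    in record
      { P≡ = P≡ ; Q≡ = Q≡
      ; f≡ = funToFin-injective φ.f ψ.f f≡
      ; g≡ = funToFin-injective φ.g ψ.g g≡
      ; side≡ = funToFin-injective φ.side ψ.side s≡
      ; v≡ = funToFin-injective φ.v ψ.v v≡
      ; index≡ = λ a → proj₁ (i≡ a)
      ; axis≡ = λ a → proj₁ (j≡ a)
      ; rest≡ = λ a → funToFin-injective (φ.rest a) (ψ.rest a) (proj₁ (r≡ a))
      ; residue≡ = λ a → proj₂ (r≡ a)
      }

module ℕ-Solver = ℕ.+-*-Solver

^-distribʳ-* : ∀ o m n → (m ℕ.* n) ℕ.^ o ≡ m ℕ.^ o ℕ.* n ℕ.^ o
^-distribʳ-* zero    m n = refl
^-distribʳ-* (suc o) m n = trans (cong (m ℕ.* n ℕ.*_) (^-distribʳ-* o m n)) (ℕ.[m*n]*[o*p]≡[m*o]*[n*p] m n (m ℕ.^ o) (n ℕ.^ o))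

-- In powers of n, a fingerprint costs 2(k + 1) + m for the pencil and k + 1 for each box, while a
-- placement offers k + 2 for each box. The N surplus factors beat the pencil with at least one to
-- spare, and that one beats the constant.
few-codes : ∀ k m N R n → suc (suc k ℕ.+ suc k ℕ.+ m) ℕ.≤ N →
  suc (suc (suc k)) ℕ.* suc (suc k) ℕ.* 2 ℕ.^ (suc k ℕ.+ suc k ℕ.+ m ℕ.+ m) ℕ.* (m ℕ.* suc (suc k) ℕ.* R) ℕ.^ N ℕ.< n →
  codes k m N n R ℕ.< (n ℕ.^ suc (suc k)) ℕ.^ N
few-codes k m N R n K<N C<n = begin-strict
  codes k m N n R
    ≡⟨ trans (cong₂ (λ a b → shape a b (point-codes k m N n R ℕ.^ N)) (double-^ s) (double-^ m))
         (cong (shape (b₁ ℕ.* t) (b₂ ℕ.* n ℕ.^ m)) point-codes-^) ⟩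
  suc d ℕ.* (d ℕ.* (b₁ ℕ.* t ℕ.* (b₁ ℕ.* t ℕ.* (b₂ ℕ.* (b₂ ℕ.* n ℕ.^ m ℕ.* (e ℕ.* t ℕ.^ N))))))
    ≡⟨ ℕ-Solver.solve 8 (λ d₁ d b₁ t b₂ u e T → d₁ ⊗ (d ⊗ (b₁ ⊗ t ⊗ (b₁ ⊗ t ⊗ (b₂ ⊗ (b₂ ⊗ u ⊗ (e ⊗ T))))))
         ⊜ d₁ ⊗ d ⊗ (b₁ ⊗ b₁ ⊗ b₂ ⊗ b₂) ⊗ e ⊗ (t ⊗ t ⊗ u) ⊗ T) refl (suc d) d b₁ t b₂ (n ℕ.^ m) e (t ℕ.^ N) ⟩
  suc d ℕ.* d ℕ.* (b₁ ℕ.* b₁ ℕ.* b₂ ℕ.* b₂) ℕ.* e ℕ.* (t ℕ.* t ℕ.* n ℕ.^ m) ℕ.* t ℕ.^ N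
    ≡⟨ cong₂ (λ a b → suc d ℕ.* d ℕ.* a ℕ.* e ℕ.* b ℕ.* t ℕ.^ N) powers-of-2 (sym (powers n)) ⟩
  C ℕ.* n ℕ.^ (s ℕ.+ s ℕ.+ m) ℕ.* t ℕ.^ N
    -- One factor n absorbs the constant C; `K<N` then pays for this extra factor.
    <⟨ ℕ.*-monoˡ-< (t ℕ.^ N) {{ℕ.m^n≢0 t N}} (ℕ.*-monoˡ-< (n ℕ.^ (s ℕ.+ s ℕ.+ m)) {{ℕ.m^n≢0 n (s ℕ.+ s ℕ.+ m)}} C<n) ⟩
  n ℕ.^ suc (s ℕ.+ s ℕ.+ m) ℕ.* t ℕ.^ N
    ≤⟨ ℕ.*-monoˡ-≤ (t ℕ.^ N) (ℕ.^-monoʳ-≤ n K<N) ⟩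
  n ℕ.^ N ℕ.* t ℕ.^ N
    ≡⟨ ^-distribʳ-* N n t ⟨
  (n ℕ.* t) ℕ.^ N ∎
  where
  open ℕ.≤-Reasoning
  open ℕ-Solver using () renaming (_:*_ to _⊗_; _:=_ to _⊜_)
  d s t b₁ b₂ e C : ℕ
  d  = suc (suc k)
  s  = suc k
  t  = n ℕ.^ s
  b₁ = 2 ℕ.^ s
  b₂ = 2 ℕ.^ m
  e  = (m ℕ.* d ℕ.* R) ℕ.^ N
  C  = suc d ℕ.* d ℕ.* 2 ℕ.^ (s ℕ.+ s ℕ.+ m ℕ.+ m) ℕ.* e

  shape : ℕ → ℕ → ℕ → ℕ
  shape a b c = suc d ℕ.* (d ℕ.* (a ℕ.* (a ℕ.* (b₂ ℕ.* (b ℕ.* c)))))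

  instance
    n≢0 : ℕ.NonZero n
    n≢0 = ℕ.>-nonZero (ℕ.≤-<-trans ℕ.z≤n C<n)

    t≢0 : ℕ.NonZero t
    t≢0 = ℕ.m^n≢0 n s

  double-^ : ∀ j → (n ℕ.+ n) ℕ.^ j ≡ 2 ℕ.^ j ℕ.* n ℕ.^ j
  double-^ j = trans (cong (ℕ._^ j) (cong (n ℕ.+_) (sym (ℕ.+-identityʳ n)))) (^-distribʳ-* j 2 n)

  point-codes-^ : point-codes k m N n R ℕ.^ N ≡ e ℕ.* t ℕ.^ N
  point-codes-^ = trans (cong (ℕ._^ N) (ℕ-Solver.solve 4 (λ m d t R → m ⊗ (d ⊗ (t ⊗ R)) ⊜ m ⊗ d ⊗ R ⊗ t) refl m d t R))
    (^-distribʳ-* N (m ℕ.* d ℕ.* R) t)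

  powers : ∀ a → a ℕ.^ (s ℕ.+ s ℕ.+ m) ≡ a ℕ.^ s ℕ.* a ℕ.^ s ℕ.* a ℕ.^ m
  powers a = trans (ℕ.^-distribˡ-+-* a (s ℕ.+ s) m) (cong (ℕ._* a ℕ.^ m) (ℕ.^-distribˡ-+-* a s s))

  powers-of-2 : b₁ ℕ.* b₁ ℕ.* b₂ ℕ.* b₂ ≡ 2 ℕ.^ (s ℕ.+ s ℕ.+ m ℕ.+ m)
  powers-of-2 = sym (trans (ℕ.^-distribˡ-+-* 2 (s ℕ.+ s ℕ.+ m) m) (cong (ℕ._* b₂) (powers 2)))

-- Rounding, and recovering a placement from its fingerprint

module Counting (F : OrderedField) where
  open OrderedField F
  open OrderedFieldProperties F
  open LinearAlgebra F
  open Arrangements F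

  -- At an integer either adjacent cell would do: what matters is only that numbers with the same
  -- label lie in one closed unit interval.
  floor : ∀ M → Carrier → Fin (suc M)
  floor zero    y = Fin.zero
  floor (suc M) y with ≤-total y (nat (suc M))
  ... | inj₁ _ = Fin.inject₁ (floor M y)
  ... | inj₂ _ = Fin.fromℕ (suc M)

  InUnit : ℕ → Carrier → Set
  InUnit c y = nat c ≤ y × y ≤ nat (suc c)

  floor-correct : ∀ M y → 0# ≤ y → y ≤ nat (suc M) → InUnit (toℕ (floor M y)) y
  floor-correct zero    y 0≤y y≤ = 0≤y , y≤
  floor-correct (suc M) y 0≤y y≤ with ≤-total y (nat (suc M))
  ... | inj₁ y≤M = subst (λ c → InUnit c y) (sym (Fin.toℕ-inject₁ (floor M y))) (floor-correct M y 0≤y y≤M)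
  ... | inj₂ M≤y = subst (λ c → InUnit c y) (sym (Fin.toℕ-fromℕ (suc M))) (M≤y , y≤)

  InUnit-close : ∀ c {x y} → InUnit c x → InUnit c y → ∣ x - y ∣ ≤ 1#
  InUnit-close c {x} {y} (c≤x , x≤c+1) (c≤y , y≤c+1) = ∣x∣≤y
    (slack ((1# + nat c - x) + (y - nat c)) (0≤+ (x≤y⇒0≤y-x x≤c+1) (x≤y⇒0≤y-x c≤y))
      (solve 4 (λ o c x y → x :- y :+ ((o :+ c :- x) :+ (y :- c)) := o) ≈-refl 1# (nat c) x y))
    (slack ((1# + nat c - y) + (x - nat c)) (0≤+ (x≤y⇒0≤y-x y≤c+1) (x≤y⇒0≤y-x c≤x))
      (solve 4 (λ o c x y → :- (x :- y) :+ ((o :+ c :- y) :+ (x :- c)) := o) ≈-refl 1# (nat c) x y))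

  module _ (n′ : ℕ) where
    private
      n : ℕ
      n = suc n′

      ν : Carrier
      ν = nat n

    -- Shifts n x from [-n, n] to [0, 2n], which has 2n unit cells.
    round : Carrier → Fin (n ℕ.+ n)
    round x = floor (n′ ℕ.+ n) (ν + ν * x)

    round-close : ∀ {x y} → ∣ x ∣ ≤ 1# → ∣ y ∣ ≤ 1# → round x ≡ round y → ∣ ν * x - ν * y ∣ ≤ 1#
    round-close {x} {y} x≤1 y≤1 eq = ∣∣-resp-≤
      (solve 3 (λ n x y → n :* x :- n :* y := (n :+ n :* x) :- (n :+ n :* y)) ≈-refl ν x y)
      (InUnit-close (toℕ (round x)) (correct x≤1) (subst (λ c → InUnit (toℕ c) (ν + ν * y)) (sym eq) (correct y≤1)))
      where
      correct : ∀ {x} → ∣ x ∣ ≤ 1# → InUnit (toℕ (round x)) (ν + ν * x)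
      correct {x} x≤1 = floor-correct (n′ ℕ.+ n) (ν + ν * x)
        (≤-trans (0≤* (0≤nat n) (≤-trans (x≤y⇒0≤y-x -x≤1) (≈⇒≤ (solve 1 (λ x → con 1ℚ :- :- x := con 1ℚ :+ x) ≈-refl x))))
          (≈⇒≤ (solve 2 (λ n x → n :* (con 1ℚ :+ x) := n :+ n :* x) ≈-refl ν x)))
        (≤-trans (+-mono-≤ (≤-refl {ν}) (≤-trans (*-monoˡ-≤ ν (0≤nat n) (≤-trans (x≤∣x∣ x) x≤1)) (≈⇒≤ (*-identityʳ ν))))
          (≈⇒≤ (≈-sym (nat-+ n n))))
        where
        -x≤1 : - x ≤ 1#
        -x≤1 = ≤-trans (-x≤∣x∣ x) x≤1

    Bounded : ∀ {d} → Vector Carrier d → Set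
    Bounded x = ∀ j → 0# ≤ x j × x j ≤ ν

    Bounded⇒∣∣≤ : ∀ {d} {x : Vector Carrier d} → Bounded x → ∀ j → ∣ x j ∣ ≤ ν
    Bounded⇒∣∣≤ b j = ≤-trans (≈⇒≤ (∣x∣≈x (proj₁ (b j)))) (proj₂ (b j))

    abstract
      -- A unit entry at a spatial place is itself large. If it sits at the homogenising place, then
      -- n is at most the sum of the products of spatial coefficients and coordinates, all of the
      -- latter at most n, so some coefficient is at least 1/(d + 1). Along that axis the equation
      -- can be solved with bounded loss.
      large-coefficient : ∀ {d} (h : Vector Carrier (suc (suc d))) (x : Vector Carrier (suc d)) → Bounded x →
        ∀ p → h p ≈ 1# → h · (ν Vector.∷ x) ≈ 0# → ∃ λ j → 1# ≤ nat (suc d) * ∣ h (Fin.suc j) ∣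
      large-coefficient {d} h x bx p hp≈1 hX≈0 = j , bound p hp≈1
        where
        largest : ∃ λ j → ∀ l → ∣ h (Fin.suc l) ∣ ≤ ∣ h (Fin.suc j) ∣
        largest = maximal (λ l → ∣ h (Fin.suc l) ∣)

        j : Fin (suc d)
        j = proj₁ largest

        a : Carrier
        a = ∣ h (Fin.suc j) ∣

        0≤da : ∀ d → 0# ≤ nat d * a
        0≤da d = 0≤* (0≤nat d) (0≤∣x∣ _)

        bound : ∀ p → h p ≈ 1# → 1# ≤ nat (suc d) * a
        bound (Fin.suc l) hl≈1 = begin
          1#                   ≈⟨ hl≈1 ⟨
          h (Fin.suc l)        ≲⟨ x≤∣x∣ _ ⟩
          ∣ h (Fin.suc l) ∣    ≲⟨ proj₂ largest l ⟩
          a                    ≲⟨ slack (nat d * a) (0≤da d) (solve 2 (λ d a → a :+ d :* a := (con 1ℚ :+ d) :* a) ≈-refl (nat d) a) ⟩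
          nat (suc d) * a      ∎
          where open ≤-Reasoning
        bound Fin.zero h₀≈1 = *-cancelʳ-≤ ν (0≤nat n) (nat≉0 n′) (begin
          1# * ν                        ≈⟨ *-cong h₀≈1 ≈-refl ⟨
          h Fin.zero * ν                ≈⟨ solve 2 (λ a b → a := (a :+ b) :- b) ≈-refl (h Fin.zero * ν) rest ⟩
          (h · (ν Vector.∷ x)) - rest   ≈⟨ +-cong hX≈0 ≈-refl ⟩
          0# - rest                     ≈⟨ +-identityˡ (- rest) ⟩
          - rest                        ≲⟨ -x≤∣x∣ rest ⟩
          ∣ rest ∣                      ≲⟨ ∣∑∣≤ (λ l → h (Fin.suc l) * x l) (a * ν) (λ l → ∣x*y∣≤ (proj₂ largest l) (Bounded⇒∣∣≤ bx l)) ⟩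
          nat (suc d) * (a * ν)         ≈⟨ *-assoc _ a ν ⟨
          nat (suc d) * a * ν           ∎)
          where
          open ≤-Reasoning
          rest : Carrier
          rest = sum (λ l → h (Fin.suc l) * x l)

    three two : Carrier
    three = nat 3
    two   = nat 2

    -- In dimension d + 1: the d + 2 coefficients change by at most 3/n each, against entries at
    -- most n; the d other coordinates differ by at most 1, with coefficients at most 2; the factor
    -- d + 1 inverts the lower bound on the large coefficient.
    coordinate-bound : ℕ → ℕ
    coordinate-bound d = suc d ℕ.* (suc (suc d) ℕ.* 3 ℕ.+ d ℕ.* 2)

    -- For X = (ν, x) the number h(X - X′) = (h′ - h)(X′) is bounded, and only the
    -- j-th term of the left-hand side can be large.
    coordinate-determined : ∀ {d} (h h′ : Vector Carrier (suc (suc d))) (x x′ : Vector Carrier (suc d)) → Bounded x′ →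
      (∀ p → ∣ ν * h p - ν * h′ p ∣ ≤ three) → (∀ p → ∣ h p ∣ ≤ two) →
      h · (ν Vector.∷ x) ≈ 0# → h′ · (ν Vector.∷ x′) ≈ 0# →
      ∀ j → 1# ≤ nat (suc d) * ∣ h (Fin.suc j) ∣ → (∀ l → ∣ x (punchIn j l) - x′ (punchIn j l) ∣ ≤ 1#) →
      ∣ x j - x′ j ∣ ≤ nat (coordinate-bound d)
    coordinate-determined {d} h h′ x x′ bx′ h≈h′ h≤2 hX≈0 h′X′≈0 j hj≥ x≈x′ = begin
        ∣ δ j ∣                                   ≈⟨ *-identityˡ _ ⟨
        1# * ∣ δ j ∣                              ≲⟨ *-monoʳ-≤ ∣ δ j ∣ (0≤∣x∣ (δ j)) hj≥ ⟩
        nat (suc d) * ∣ hj ∣ * ∣ δ j ∣            ≈⟨ *-assoc _ _ _ ⟩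
        nat (suc d) * (∣ hj ∣ * ∣ δ j ∣)          ≈⟨ *-cong ≈-refl (∣x*y∣≈∣x∣*∣y∣ hj (δ j)) ⟨
        nat (suc d) * ∣ hj * δ j ∣                ≲⟨ *-monoˡ-≤ (nat (suc d)) (0≤nat (suc d)) product-bound ⟩
        nat (suc d) * nat (suc (suc d) ℕ.* 3 ℕ.+ d ℕ.* 2) ≈⟨ nat-* (suc d) (suc (suc d) ℕ.* 3 ℕ.+ d ℕ.* 2) ⟨
        nat (coordinate-bound d)                  ∎
      where
      open ≤-Reasoning
      δ : Vector Carrier (suc d)
      δ l = x l - x′ l

      hj : Carrier
      hj = h (Fin.suc j)

      X X′ : Vector Carrier (suc (suc d))
      X  = ν Vector.∷ x
      X′ = ν Vector.∷ x′

      X′≤ν : ∀ p → ∣ X′ p ∣ ≤ ν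
      X′≤ν Fin.zero    = ≈⇒≤ (∣x∣≈x (0≤nat n))
      X′≤ν (Fin.suc l) = Bounded⇒∣∣≤ bx′ l

      change : Carrier
      change = sum (λ p → (h p - h′ p) * X′ p)

      others : Carrier
      others = sum (λ l → h (Fin.suc (punchIn j l)) * δ (punchIn j l))

      change≤ : ∣ change ∣ ≤ nat (suc (suc d)) * three
      change≤ = ∣∑∣≤ (λ p → (h p - h′ p) * X′ p) three λ p → ≤-trans (∣x*y∣≤ ≤-refl (X′≤ν p))
        (≤-trans (≈⇒≤ (≈-trans (*-cong ≈-refl (≈-sym (∣x∣≈x (0≤nat n)))) (≈-sym (∣x*y∣≈∣x∣*∣y∣ (h p - h′ p) ν))))
          (∣∣-resp-≤ (solve 3 (λ a b n → (a :- b) :* n := n :* a :- n :* b) ≈-refl (h p) (h′ p) ν) (h≈h′ p)))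

      others≤ : ∣ others ∣ ≤ nat d * two
      others≤ = ∣∑∣≤ _ two (λ l → ≤-trans (∣x*y∣≤ (h≤2 (Fin.suc (punchIn j l))) (x≈x′ l)) (≈⇒≤ (*-identityʳ two)))

      hδ : hj * δ j + others ≈ - change
      hδ = E.begin
        hj * δ j + others
          E.≈⟨ ∑.sum-remove {i = j} (λ l → h (Fin.suc l) * δ l) ⟨
        sum (λ l → h (Fin.suc l) * δ l)
          E.≈⟨ solve 3 (λ h n s → s := h :* (n :- n) :+ s) ≈-refl (h Fin.zero) ν _ ⟩
        h Fin.zero * (ν - ν) + sum (λ l → h (Fin.suc l) * δ l)
          E.≈⟨ +-cong ≈-refl ≈-refl ⟩
        sum (λ p → h p * (X p - X′ p))
          E.≈⟨ ∑-cong (λ p → solve 4 (λ h h′ X X′ → h :* (X :- X′) := (h :* X :+ (:- con 1ℚ) :* (h′ :* X′)) :+ (:- con 1ℚ) :* ((h :- h′) :* X′)) ≈-refl (h p) (h′ p) (X p) (X′ p)) ⟩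
        sum (λ p → (h p * X p + (- 1#) * (h′ p * X′ p)) + (- 1#) * ((h p - h′ p) * X′ p))
          E.≈⟨ ∑.∑-distrib-+ (λ p → h p * X p + (- 1#) * (h′ p * X′ p)) (λ p → (- 1#) * ((h p - h′ p) * X′ p)) ⟩
        sum (λ p → h p * X p + (- 1#) * (h′ p * X′ p)) + sum (λ p → (- 1#) * ((h p - h′ p) * X′ p))
          E.≈⟨ +-cong (∑.∑-distrib-+ (λ p → h p * X p) (λ p → (- 1#) * (h′ p * X′ p))) (≈-sym (∑.*-distribˡ-sum (- 1#) (λ p → (h p - h′ p) * X′ p))) ⟩
        h · X + sum (λ p → (- 1#) * (h′ p * X′ p)) + (- 1#) * change
          E.≈⟨ +-cong (+-zero hX≈0 (≈-trans (≈-sym (∑.*-distribˡ-sum (- 1#) (λ p → h′ p * X′ p))) (zeroʳ′ (- 1#) h′X′≈0))) ≈-refl ⟩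
        0# + (- 1#) * change
          E.≈⟨ solve 1 (λ c → con 0ℚ :+ (:- con 1ℚ) :* c := :- c) ≈-refl change ⟩
        - change E.∎
        where module E = ≈-Reasoning

      product-bound : ∣ hj * δ j ∣ ≤ nat (suc (suc d) ℕ.* 3 ℕ.+ d ℕ.* 2)
      product-bound = begin
        ∣ hj * δ j ∣             ≲⟨ ∣∣-resp-≤ (≈-trans (solve 2 (λ a b → a := (a :+ b) :+ :- b) ≈-refl (hj * δ j) others) (+-cong hδ ≈-refl))
                                      (∣x+y∣≤ (∣-x∣≤ change≤) (∣-x∣≤ others≤)) ⟩
        nat (suc (suc d)) * nat 3 + nat d * nat 2 ≈⟨ +-cong (nat-* (suc (suc d)) 3) (nat-* d 2) ⟨
        nat (suc (suc d) ℕ.* 3) + nat (d ℕ.* 2)   ≈⟨ nat-+ (suc (suc d) ℕ.* 3) (d ℕ.* 2) ⟨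
        nat (suc (suc d) ℕ.* 3 ℕ.+ d ℕ.* 2)       ∎

    -- From a ≤ x ≤ y + B ≤ b + 1 + B one gets a < b + (B + 2), which is the origin of the modulus B
    -- + 2.
    InUnit-determined : ∀ {a b x y} B → InUnit a x → InUnit b y → ∣ x - y ∣ ≤ nat B → a ℕ.< b ℕ.+ suc (suc B)
    InUnit-determined {a} {b} {x} {y} B (a≤x , _) (_ , y≤b+1) x-y≤B = subst (suc a ℕ.≤_)
      (trans (cong suc (sym (ℕ.+-suc b B))) (sym (ℕ.+-suc b (suc B))))
      (ℕ.s≤s (nat-cancel-≤ a (suc b ℕ.+ B) (begin
        nat a                ≲⟨ a≤x ⟩
        x                    ≈⟨ solve 2 (λ x y → x := y :+ (x :- y)) ≈-refl x y ⟩
        y + (x - y)          ≲⟨ +-mono-≤ y≤b+1 (≤-trans (x≤∣x∣ (x - y)) x-y≤B) ⟩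
        nat (suc b) + nat B  ≈⟨ nat-+ (suc b) B ⟨
        nat (suc b ℕ.+ B)    ∎)))
      where open ≤-Reasoning

  close-to-one : ∀ ν x → x ≈ 1# → ∀ y → y ≈ 1# → ∣ ν * x - ν * y ∣ ≤ 1#
  close-to-one ν x x≈1 y y≈1 = ∣∣-resp-≤ (≈-trans (+-cong (*-cong ≈-refl (≈-trans x≈1 (≈-sym y≈1))) ≈-refl) (-‿inverseʳ (ν * y)))
    (≤-trans (≈⇒≤ (∣x∣≈x ≤-refl)) 0≤1)

  close-to-zero : ∀ ν x → x ≈ 0# → ∀ y → y ≈ 0# → ∣ ν * x - ν * y ∣ ≤ 1#
  close-to-zero ν x x≈0 y y≈0 = ∣∣-resp-≤ (≈-trans (+-cong (*-cong ≈-refl (≈-trans x≈0 (≈-sym y≈0))) ≈-refl) (-‿inverseʳ (ν * y)))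
    (≤-trans (≈⇒≤ (∣x∣≈x ≤-refl)) 0≤1)

  affine-≤2 : ∀ {d v} {f g : Vector Carrier d} → ∣ v ∣ ≤ 1# → (∀ j → ∣ f j ∣ ≤ 1#) → (∀ j → ∣ g j ∣ ≤ 1#) →
              ∀ j → ∣ affine v f g j ∣ ≤ nat 2
  affine-≤2 v≤1 f≤1 g≤1 j = ≤-trans (∣x+y∣≤ (f≤1 j) (∣x*y∣≤ v≤1 (g≤1 j)))
    (≈⇒≤ (solve 0 (con 1ℚ :+ con 1ℚ :* con 1ℚ := con 1ℚ :+ (con 1ℚ :+ con 0ℚ)) ≈-refl))

  -- The 3 is one unit for f and, by the product rule, one for the error of v against g and one for
  -- the error of g against v′.
  affine-close : ∀ {d} ν {v v′} {f f′ g g′ : Vector Carrier d} → ∣ v′ ∣ ≤ 1# → (∀ j → ∣ g j ∣ ≤ 1#) →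
                 ∣ ν * v - ν * v′ ∣ ≤ 1# → (∀ j → ∣ ν * f j - ν * f′ j ∣ ≤ 1#) → (∀ j → ∣ ν * g j - ν * g′ j ∣ ≤ 1#) →
                 ∀ j → ∣ ν * affine v f g j - ν * affine v′ f′ g′ j ∣ ≤ nat 3
  affine-close ν {v} {v′} {f} {f′} {g} {g′} v′≤1 g≤1 v≈ f≈ g≈ j = ∣∣-resp-≤
    (solve 7 (λ n v v′ f f′ g g′ → n :* (f :+ v :* g) :- n :* (f′ :+ v′ :* g′) :=
       (n :* f :- n :* f′) :+ ((n :* v :- n :* v′) :* g :+ v′ :* (n :* g :- n :* g′))) ≈-refl ν v v′ (f j) (f′ j) (g j) (g′ j))
    (≤-trans (∣x+y∣≤ (f≈ j) (∣x+y∣≤ (∣x*y∣≤ v≈ (g≤1 j)) (∣x*y∣≤ v′≤1 (g≈ j))))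
      (≈⇒≤ (solve 0 (con 1ℚ :+ (con 1ℚ :* con 1ℚ :+ con 1ℚ :* con 1ℚ) := con 1ℚ :+ (con 1ℚ :+ (con 1ℚ :+ con 0ℚ))) ≈-refl)))

  member-≤2 : ∀ {d v} b {f g : Vector Carrier d} → ∣ v ∣ ≤ 1# → (∀ j → ∣ f j ∣ ≤ 1#) → (∀ j → ∣ g j ∣ ≤ 1#) →
              ∀ j → ∣ member b v f g j ∣ ≤ nat 2
  member-≤2 true  v≤1 f≤1 g≤1 = affine-≤2 v≤1 f≤1 g≤1
  member-≤2 false v≤1 f≤1 g≤1 = affine-≤2 v≤1 g≤1 f≤1

  by-punchIn : ∀ {d} P (R : Fin (suc d) → Set) → R P → (∀ l → R (punchIn P l)) → ∀ j → R j
  by-punchIn P R rP rest j with P Fin.≟ j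
  ... | yes refl = rP
  ... | no P≢j   = subst R (Fin.punchIn-punchOut P≢j) (rest (Fin.punchOut P≢j))

  by-pivots : ∀ {d} P Q (R : Fin (suc (suc d)) → Set) → R P → R (punchIn P Q) →
              (∀ l → R (punchIn P (punchIn Q l))) → ∀ j → R j
  by-pivots P Q R rP rQ rest = by-punchIn P R rP (by-punchIn Q (R ∘ punchIn P) rQ rest)

  module _ (k m N n′ : ℕ) {i₁ i₂ : Fin m} (i₁≢i₂ : i₁ ≢ i₂) where
    private
      d n B R : ℕ
      d = suc (suc k)
      n = suc n′
      B = coordinate-bound n′ (suc k)
      R = suc (suc B)

      ν ι : Carrier
      ν = nat n
      ι = proj₁ (reciprocal (nat≉0 n′))

      νι≈1 : ν * ι ≈ 1#
      νι≈1 = proj₂ (reciprocal (nat≉0 n′))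

      ι≉0 : ¬ ι ≈ 0#
      ι≉0 ι≈0 = 1≉0 (≈-trans (≈-sym νι≈1) (zeroʳ′ ν ι≈0))

    Configuration : Set
    Configuration = Fin N → Fin d → Fin n

    record Stabbed (c : Configuration) : Set where
      field
        arrangement : Arrangement d k m
        index       : Fin N → Fin m
        point       : Fin N → Vector Carrier d
        in-box      : ∀ a j → InUnit (toℕ (c a j)) (point a j)
      open Arrangement arrangement public
      field
        on          : ∀ a → normal (index a) · point a ≈ offset (index a)

      open Pencil (arrangement-pencil arrangement i₁≢i₂ ι ι≉0) public

      bounded : ∀ a → Bounded n′ (point a)
      bounded a j = ≤-trans (0≤nat (toℕ (c a j))) (proj₁ (in-box a j)) ,
                    ≤-trans (proj₂ (in-box a j)) (nat-mono-≤ (Fin.toℕ<n (c a j)))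

      functional : Fin N → Vector Carrier (suc d)
      functional a = member (side (index a)) (v (index a)) f g

      vanishes : ∀ a → functional a · (ν Vector.∷ point a) ≈ 0#
      vanishes a = spans (index a) (ν Vector.∷ point a) (begin
        - (ι * offset (index a)) * ν + normal (index a) · point a
          ≈⟨ solve 4 (λ i o n x → :- (i :* o) :* n :+ x := x :- n :* i :* o) ≈-refl ι (offset (index a)) ν (normal (index a) · point a) ⟩
        normal (index a) · point a - ν * ι * offset (index a)
          ≈⟨ +-cong (on a) (-‿cong (≈-trans (*-cong νι≈1 ≈-refl) (*-identityˡ _))) ⟩
        offset (index a) - offset (index a)
          ≈⟨ -‿inverseʳ (offset (index a)) ⟩
        0# ∎)
        where open ≈-Reasoning

      -- In echelon form the generator with coefficient 1 has entry 1 at its own pivot, where the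
      -- other generator is 0; `large-coefficient` starts from this entry.
      unit-coefficient : ∀ b v → ∃ λ p → member b v f g p ≈ 1#
      unit-coefficient true  v = P , ≈-trans (+-cong fP≈1 (zeroʳ′ v gP≈0)) (+-identityʳ 1#)
      unit-coefficient false v = Q , ≈-trans (+-cong gQ≈1 (zeroʳ′ v fQ≈0)) (+-identityʳ 1#)

      large : ∀ a → ∃ λ j → 1# ≤ nat d * ∣ functional a (Fin.suc j) ∣
      large a = large-coefficient n′ (functional a) (point a) (bounded a)
        (proj₁ (unit-coefficient (side (index a)) (v (index a)))) (proj₂ (unit-coefficient (side (index a)) (v (index a)))) (vanishes a)

      axis : Fin N → Fin d
      axis a = proj₁ (large a)

      rest : Fin (suc k) → Fin (suc d)
      rest l = punchIn P (punchIn Q′ l)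

      bit : Bool → Fin 2
      bit true  = Fin.zero
      bit false = Fin.suc Fin.zero

      fingerprint : Fingerprint k m N n R
      fingerprint = record
        { P = P ; Q = Q′
        ; f = λ l → round n′ (f (rest l)) ; g = λ l → round n′ (g (rest l))
        ; side = λ i → bit (side i) ; v = λ i → round n′ (v i)
        ; index = index ; axis = axis
        ; rest = λ a l → c a (punchIn (axis a) l)
        ; residue = λ a → fromℕ< (ℕ.m%n<n (toℕ (c a (axis a))) R)
        }

    module _ {c c′ : Configuration} (s : Stabbed c) (s′ : Stabbed c′) where
      private
        module S  = Stabbed s
        module S′ = Stabbed s′

      module _ (same : S.fingerprint ∼ S′.fingerprint) where
        open _∼_ same renaming (Q≡ to Q′≡; side≡ to bit≡)
        private
          Q≡ : S.Q ≡ S′.Q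
          Q≡ = cong₂ punchIn P≡ Q′≡

          rest-≡ : ∀ l → S.rest l ≡ S′.rest l
          rest-≡ l = cong₂ (λ P Q → punchIn P (punchIn Q l)) P≡ Q′≡

          bit-injective : ∀ b b′ → S.bit b ≡ S′.bit b′ → b ≡ b′
          bit-injective true  true  _ = refl
          bit-injective false false _ = refl

          side≡ : ∀ i → S.side i ≡ S′.side i
          side≡ i = bit-injective (S.side i) (S′.side i) (bit≡ i)

          mod≡ : ∀ a → toℕ (c a (S.axis a)) ℕ.% R ≡ toℕ (c′ a (S′.axis a)) ℕ.% R
          mod≡ a = trans (sym (Fin.toℕ-fromℕ< (ℕ.m%n<n (toℕ (c a (S.axis a))) R)))
            (trans (cong toℕ (residue≡ a)) (Fin.toℕ-fromℕ< (ℕ.m%n<n (toℕ (c′ a (S′.axis a))) R)))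

          -- The pivot entries are exactly 0 or 1, so only the d - 1 remaining coefficients had to
          -- be rounded.
          f≈ : ∀ j → ∣ ν * S.f j - ν * S′.f j ∣ ≤ 1#
          f≈ = by-pivots S.P S.Q′ (λ j → ∣ ν * S.f j - ν * S′.f j ∣ ≤ 1#)
            (close-to-one ν _ S.fP≈1 _ (subst (λ p → S′.f p ≈ 1#) (sym P≡) S′.fP≈1))
            (close-to-zero ν _ S.fQ≈0 _ (subst (λ p → S′.f p ≈ 0#) (sym Q≡) S′.fQ≈0))
            (λ l → round-close n′ (S.f≤1 _) (S′.f≤1 _) (trans (f≡ l) (cong (round n′ ∘ S′.f) (sym (rest-≡ l)))))

          g≈ : ∀ j → ∣ ν * S.g j - ν * S′.g j ∣ ≤ 1#
          g≈ = by-pivots S.P S.Q′ (λ j → ∣ ν * S.g j - ν * S′.g j ∣ ≤ 1#)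
            (close-to-zero ν _ S.gP≈0 _ (subst (λ p → S′.g p ≈ 0#) (sym P≡) S′.gP≈0))
            (close-to-one ν _ S.gQ≈1 _ (subst (λ p → S′.g p ≈ 1#) (sym Q≡) S′.gQ≈1))
            (λ l → round-close n′ (S.g≤1 _) (S′.g≤1 _) (trans (g≡ l) (cong (round n′ ∘ S′.g) (sym (rest-≡ l)))))

          v≈ : ∀ {i i′} → i ≡ i′ → ∣ ν * S.v i - ν * S′.v i′ ∣ ≤ 1#
          v≈ {i} refl = round-close n′ (S.v≤1 i) (S′.v≤1 i) (v≡ i)

          member-close : ∀ {b b′ v v′} → b ≡ b′ → ∣ v′ ∣ ≤ 1# → ∣ ν * v - ν * v′ ∣ ≤ 1# →
            ∀ p → ∣ ν * member b v S.f S.g p - ν * member b′ v′ S′.f S′.g p ∣ ≤ nat 3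
          member-close {true}  refl v′≤1 v≈ = affine-close ν v′≤1 S.g≤1 v≈ f≈ g≈
          member-close {false} refl v′≤1 v≈ = affine-close ν v′≤1 S.f≤1 v≈ g≈ f≈

          functional-close : ∀ a p → ∣ ν * S.functional a p - ν * S′.functional a p ∣ ≤ nat 3
          functional-close a = member-close
            (trans (side≡ (S.index a)) (cong S′.side (index≡ a))) (S′.v≤1 (S′.index a)) (v≈ (index≡ a))

          points-close : ∀ a l → ∣ S.point a (punchIn (S.axis a) l) - S′.point a (punchIn (S.axis a) l) ∣ ≤ 1#
          points-close a l = InUnit-close (toℕ (c a p)) (S.in-box a p)
            (subst (λ b → InUnit (toℕ b) (S′.point a p))
              (sym (trans (rest≡ a l) (cong (λ q → c′ a (punchIn q l)) (sym (axis≡ a))))) (S′.in-box a p))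
            where
            p : Fin d
            p = punchIn (S.axis a) l

          axis-close : ∀ a → ∣ S.point a (S.axis a) - S′.point a (S.axis a) ∣ ≤ nat B
          axis-close a = coordinate-determined n′ (S.functional a) (S′.functional a) (S.point a) (S′.point a) (S′.bounded a)
            (functional-close a) (member-≤2 (S.side (S.index a)) (S.v≤1 (S.index a)) S.f≤1 S.g≤1)
            (S.vanishes a) (S′.vanishes a) (S.axis a) (proj₂ (S.large a)) (points-close a)

          axis-equal : ∀ a → c a (S.axis a) ≡ c′ a (S.axis a)
          axis-equal a = Fin.toℕ-injective (%-≡⇒≡ _ _ R
            (trans (mod≡ a) (cong (λ q → toℕ (c′ a q) ℕ.% R) (sym (axis≡ a))))
            (InUnit-determined n′ B (S.in-box a _) (S′.in-box a _) (axis-close a))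
            (InUnit-determined n′ B (S′.in-box a _) (S.in-box a _)
              (∣∣-resp-≤ (solve 2 (λ x y → y :- x := :- (x :- y)) ≈-refl (S.point a (S.axis a)) (S′.point a (S.axis a))) (∣-x∣≤ (axis-close a)))))

        -- Off the chosen axis the coordinates are recorded outright. Along it they are recorded
        -- modulo R, and the nearly equal functionals confine the two candidates to less than R from
        -- each other.
        fingerprint-determines : ∀ a j → c a j ≡ c′ a j
        fingerprint-determines a = by-punchIn (S.axis a) (λ j → c a j ≡ c′ a j) (axis-equal a)
          λ l → trans (rest≡ a l) (cong (λ q → c′ a (punchIn q l)) (sym (axis≡ a)))

    unstabbed : codes k m N n R ℕ.< (n ℕ.^ d) ℕ.^ N → ¬ (∀ c → Stabbed c)
    unstabbed few stabbed = collide (Fin.pigeonhole few code)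
      where
      configuration : Fin ((n ℕ.^ d) ℕ.^ N) → Configuration
      configuration u a = finToFun (finToFun {n ℕ.^ d} {N} u a)

      code : Fin ((n ℕ.^ d) ℕ.^ N) → Fin (codes k m N n R)
      code u = encode k m N n R (Stabbed.fingerprint (stabbed (configuration u)))

      collide : ¬ ∃ λ u → ∃ λ w → u Fin.< w × code u ≡ code w
      collide (u , w , u<w , eq) = Fin.<⇒≢ u<w (finToFun-injective {N} {n ℕ.^ d} λ a →
        finToFun-injective {d} {n} (fingerprint-determines (stabbed (configuration u)) (stabbed (configuration w))
          (encode-injective k m N n R (Stabbed.fingerprint (stabbed (configuration u))) (Stabbed.fingerprint (stabbed (configuration w))) eq) a))

  abstract
    not-all-stabbed : ∀ k m N {i₁ i₂ : Fin m} (i₁≢i₂ : i₁ ≢ i₂) → suc (suc k ℕ.+ suc k ℕ.+ m) ℕ.≤ N →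
      ∃ λ n′ → ¬ (∀ c → Stabbed k m N n′ i₁≢i₂ c)
    not-all-stabbed k m N i₁≢i₂ K<N = C , unstabbed k m N C i₁≢i₂ (few-codes k m N R (suc C) K<N ℕ.≤-refl)
      where
      R C : ℕ
      -- The coordinate bound is the same for every grid size, so it can be evaluated at 0 before
      -- the size C + 1 is chosen from it.
      R = suc (suc (coordinate-bound 0 (suc k)))
      C = suc (suc (suc k)) ℕ.* suc (suc k) ℕ.* 2 ℕ.^ (suc k ℕ.+ suc k ℕ.+ m ℕ.+ m) ℕ.* (m ℕ.* suc (suc k) ℕ.* R) ℕ.^ N

open +-*-Solver using (solve; _:=_; _:+_; _:*_; _:-_; :-_; con)

-- Real numbers

-- Linear inequalities are proved by exhibiting the nonnegative difference of
-- the two sides, which the ring solver then verifies.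
slack-≤ : ∀ {p q} r → 0ℚ ℚ.≤ r → p ℚ.+ r ≡ q → p ℚ.≤ q
slack-≤ {p} r 0≤r eq =
  subst₂ ℚ._≤_ (ℚ.+-identityʳ p) eq (ℚ.+-monoʳ-≤ p 0≤r)

slack-< : ∀ {p q} r → 0ℚ ℚ.< r → p ℚ.+ r ≡ q → p ℚ.< q
slack-< {p} r 0<r eq =
  subst₂ ℚ._<_ (ℚ.+-identityʳ p) eq (ℚ.+-monoʳ-< p 0<r)

p≤q⇒0≤q-p : ∀ {p q} → p ℚ.≤ q → 0ℚ ℚ.≤ q ℚ.- p
p≤q⇒0≤q-p {p} {q} p≤q = subst (ℚ._≤ q ℚ.- p) (ℚ.+-inverseʳ p) (ℚ.+-monoˡ-≤ (ℚ.- p) p≤q)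

p<q⇒0<q-p : ∀ {p q} → p ℚ.< q → 0ℚ ℚ.< q ℚ.- p
p<q⇒0<q-p {p} {q} p<q = subst (ℚ._< q ℚ.- p) (ℚ.+-inverseʳ p) (ℚ.+-monoˡ-< (ℚ.- p) p<q)

0≤+ : ∀ {p q} → 0ℚ ℚ.≤ p → 0ℚ ℚ.≤ q → 0ℚ ℚ.≤ p ℚ.+ q
0≤+ = ℚ.+-mono-≤

0<+ : ∀ {p q} → 0ℚ ℚ.< p → 0ℚ ℚ.≤ q → 0ℚ ℚ.< p ℚ.+ q
0<+ = ℚ.+-mono-<-≤

0≤* : ∀ {p q} → 0ℚ ℚ.≤ p → 0ℚ ℚ.≤ q → 0ℚ ℚ.≤ p ℚ.* q
0≤* {p} {q} 0≤p 0≤q = ℚ.nonNegative⁻¹ (p ℚ.* q)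
  {{ℚ.nonNeg*nonNeg⇒nonNeg p {{ℚ.nonNegative 0≤p}} q {{ℚ.nonNegative 0≤q}}}}

0<* : ∀ {p q} → 0ℚ ℚ.< p → 0ℚ ℚ.< q → 0ℚ ℚ.< p ℚ.* q
0<* {p} {q} 0<p 0<q = ℚ.positive⁻¹ (p ℚ.* q)
  {{ℚ.pos*pos⇒pos p {{ℚ.positive 0<p}} q {{ℚ.positive 0<q}}}}

0<1 : 0ℚ ℚ.< 1ℚ
0<1 = ℚ.positive⁻¹ 1ℚ

0<½ : 0ℚ ℚ.< ½
0<½ = ℚ.positive⁻¹ ½

half : ∀ {ε} → 0ℚ ℚ.< ε → 0ℚ ℚ.< ε ℚ.* ½
half 0<ε = 0<* 0<ε 0<½

half+half : ∀ ε → ε ℚ.* ½ ℚ.+ ε ℚ.* ½ ≡ ε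
half+half = solve 1 (λ e → e :* con ½ :+ e :* con ½ := e) refl

abstract
  divide : ∀ {K ε} → 0ℚ ℚ.< K → 0ℚ ℚ.< ε → ∃ λ δ → 0ℚ ℚ.< δ × K ℚ.* δ ≡ ε
  divide {K} {ε} 0<K 0<ε = K⁻¹ ℚ.* ε , 0<* 0<K⁻¹ 0<ε , eq
    where
    instance
      K>0 : ℚ.Positive K
      K>0 = ℚ.positive 0<K

      K≢0 : ℚ.NonZero K
      K≢0 = ℚ.pos⇒nonZero K

    K⁻¹ : ℚ
    K⁻¹ = ℚ.1/ K

    0<K⁻¹ : 0ℚ ℚ.< K⁻¹
    0<K⁻¹ = ℚ.positive⁻¹ K⁻¹ {{ℚ.1/pos⇒pos K}}

    eq : K ℚ.* (K⁻¹ ℚ.* ε) ≡ ε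
    eq = trans (sym (ℚ.*-assoc K K⁻¹ ε))
               (trans (cong (ℚ._* ε) (ℚ.*-inverseʳ K)) (ℚ.*-identityˡ ε))

*-monoˡ-≤-0≤ : ∀ {r p q} → 0ℚ ℚ.≤ r → p ℚ.≤ q → r ℚ.* p ℚ.≤ r ℚ.* q
*-monoˡ-≤-0≤ {r} 0≤r = ℚ.*-monoˡ-≤-nonNeg r {{ℚ.nonNegative 0≤r}}

*-monoʳ-≤-0≤ : ∀ {r p q} → 0ℚ ℚ.≤ r → p ℚ.≤ q → p ℚ.* r ℚ.≤ q ℚ.* r
*-monoʳ-≤-0≤ {r} 0≤r = ℚ.*-monoʳ-≤-nonNeg r {{ℚ.nonNegative 0≤r}}

*-mono-≤-0≤ : ∀ {p q r s} → 0ℚ ℚ.≤ q → 0ℚ ℚ.≤ r → p ℚ.≤ q → r ℚ.≤ s → p ℚ.* r ℚ.≤ q ℚ.* s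
*-mono-≤-0≤ 0≤q 0≤r p≤q r≤s =
  ℚ.≤-trans (*-monoʳ-≤-0≤ 0≤r p≤q) (*-monoˡ-≤-0≤ 0≤q r≤s)

p≤∣p∣ : ∀ p → p ℚ.≤ ℚ.∣ p ∣
p≤∣p∣ p with ℚ.≤-total 0ℚ p
... | inj₁ 0≤p = ℚ.≤-reflexive (sym (ℚ.0≤p⇒∣p∣≡p 0≤p))
... | inj₂ p≤0 = ℚ.≤-trans p≤0 (ℚ.0≤∣p∣ p)

-p≤∣p∣ : ∀ p → ℚ.- p ℚ.≤ ℚ.∣ p ∣
-p≤∣p∣ p = subst (ℚ.- p ℚ.≤_) (ℚ.∣-p∣≡∣p∣ p) (p≤∣p∣ (ℚ.- p))

∣p∣≤q : ∀ {p q} → p ℚ.≤ q → ℚ.- p ℚ.≤ q → ℚ.∣ p ∣ ℚ.≤ q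
∣p∣≤q {p} p≤q -p≤q with ℚ.∣p∣≡p∨∣p∣≡-p p
... | inj₁ eq = subst (ℚ._≤ _) (sym eq) p≤q
... | inj₂ eq = subst (ℚ._≤ _) (sym eq) -p≤q

∣p∣<q : ∀ {p q} → p ℚ.< q → ℚ.- p ℚ.< q → ℚ.∣ p ∣ ℚ.< q
∣p∣<q {p} p<q -p<q with ℚ.∣p∣≡p∨∣p∣≡-p p
... | inj₁ eq = subst (ℚ._< _) (sym eq) p<q
... | inj₂ eq = subst (ℚ._< _) (sym eq) -p<q

∣p-q∣≡∣q-p∣ : ∀ p q → ℚ.∣ p ℚ.- q ∣ ≡ ℚ.∣ q ℚ.- p ∣
∣p-q∣≡∣q-p∣ p q = trans (cong ℚ.∣_∣ (solve 2 (λ p q → p :- q := :- (q :- p)) refl p q))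
                        (ℚ.∣-p∣≡∣p∣ (q ℚ.- p))

triangle : ∀ p q r → ℚ.∣ p ℚ.- r ∣ ℚ.≤ ℚ.∣ p ℚ.- q ∣ ℚ.+ ℚ.∣ q ℚ.- r ∣
triangle p q r = subst (λ s → ℚ.∣ s ∣ ℚ.≤ ℚ.∣ p ℚ.- q ∣ ℚ.+ ℚ.∣ q ℚ.- r ∣)
  (solve 3 (λ p q r → (p :- q) :+ (q :- r) := p :- r) refl p q r)
  (ℚ.∣p+q∣≤∣p∣+∣q∣ (p ℚ.- q) (q ℚ.- r))

∣p-q∣<r⇒p<q+r : ∀ {p q r} → ℚ.∣ p ℚ.- q ∣ ℚ.< r → p ℚ.< q ℚ.+ r
∣p-q∣<r⇒p<q+r {p} {q} {r} h =
  slack-< (r ℚ.- (p ℚ.- q)) (p<q⇒0<q-p (ℚ.≤-<-trans (p≤∣p∣ _) h))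
    (solve 3 (λ p q r → p :+ (r :- (p :- q)) := q :+ r) refl p q r)

∣p-q∣<r⇒q<p+r : ∀ {p q r} → ℚ.∣ p ℚ.- q ∣ ℚ.< r → q ℚ.< p ℚ.+ r
∣p-q∣<r⇒q<p+r {p} {q} h = ∣p-q∣<r⇒p<q+r (subst (ℚ._< _) (∣p-q∣≡∣q-p∣ p q) h)

fromℕ : ℕ → ℚ
fromℕ zero    = 0ℚ
fromℕ (suc n) = 1ℚ ℚ.+ fromℕ n

0≤fromℕ : ∀ n → 0ℚ ℚ.≤ fromℕ n
0≤fromℕ zero    = ℚ.≤-refl
0≤fromℕ (suc n) = 0≤+ (ℚ.<⇒≤ 0<1) (0≤fromℕ n)

0<fromℕ : ∀ n → 0ℚ ℚ.< fromℕ (suc n)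
0<fromℕ n = 0<+ 0<1 (0≤fromℕ n)

fromℕ-/1 : ∀ n → fromℕ n ≡ + n / 1
fromℕ-/1 zero    = refl
fromℕ-/1 (suc n) = trans (cong (1ℚ ℚ.+_) (fromℕ-/1 n)) (ℚ.toℚᵘ-injective (begin
    ℚ.toℚᵘ (1ℚ ℚ.+ + n / 1)
      ≈⟨ ℚ.toℚᵘ-homo-+ 1ℚ (+ n / 1) ⟩
    ℚ.toℚᵘ 1ℚ ℚᵘ.+ ℚ.toℚᵘ (+ n / 1)
      ≈⟨ ℚᵘ.+-congʳ (ℚ.toℚᵘ 1ℚ) (ℚ.toℚᵘ-fromℚᵘ (ℚᵘ.mkℚᵘ (+ n) 0)) ⟩
    ℚ.toℚᵘ 1ℚ ℚᵘ.+ ℚᵘ.mkℚᵘ (+ n) 0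
      ≈⟨ ℚᵘ.*≡* (cong (λ k → (+ 1 ℤ.+ k) ℤ.* + 1) (ℤ.*-identityʳ (+ n))) ⟩
    ℚᵘ.mkℚᵘ (+ suc n) 0
      ≈⟨ ℚ.toℚᵘ-fromℚᵘ (ℚᵘ.mkℚᵘ (+ suc n) 0) ⟨
    ℚ.toℚᵘ (+ suc n / 1) ∎))
  where open ℚᵘ.≃-Reasoning

abstract
  -- The absolute value of the numerator suffices, as the denominator is at least 1.
  archimedean : ∀ p → ∃ λ n → p ℚ.≤ fromℕ n
  archimedean p@record{} = n , subst (p ℚ.≤_) (sym (fromℕ-/1 n)) (ℚ.toℚᵘ-cancel-≤
    (ℚᵘ.≤-respʳ-≃ (ℚᵘ.≃-sym (ℚ.toℚᵘ-fromℚᵘ (ℚᵘ.mkℚᵘ (+ n) 0))) (ℚᵘ.*≤* bound)))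
    where
    n : ℕ
    n = ℤ.∣ ℚ.↥ p ∣

    i≤∣i∣ : ∀ i → i ℤ.≤ + ℤ.∣ i ∣
    i≤∣i∣ (+ n)        = ℤ.≤-refl
    i≤∣i∣ (ℤ.-[1+ n ]) = ℤ.-≤+

    bound : ℚ.↥ p ℤ.* + 1 ℤ.≤ + n ℤ.* ℚ.↧ p
    bound = ℤ.≤-trans (ℤ.≤-reflexive (ℤ.*-identityʳ _)) (ℤ.≤-trans (i≤∣i∣ (ℚ.↥ p))
      (subst (+ n ℤ.≤_) (ℤ.pos-* n (ℚ.↧ₙ p)) (ℤ.+≤+ (ℕ.m≤m*n n (ℚ.↧ₙ p)))))

½^_ : ℕ → ℚ
½^ zero  = 1ℚ
½^ suc n = ½ ℚ.* ½^ n

0<½^ : ∀ n → 0ℚ ℚ.< ½^ n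
0<½^ zero    = 0<1
0<½^ (suc n) = 0<* 0<½ (0<½^ n)

½^≤1 : ∀ n → ½^ n ℚ.≤ 1ℚ
½^≤1 zero    = ℚ.≤-refl
½^≤1 (suc n) = slack-≤ (½ ℚ.* (1ℚ ℚ.- ½^ n) ℚ.+ ½)
  (0≤+ (0≤* (ℚ.<⇒≤ 0<½) (p≤q⇒0≤q-p (½^≤1 n))) (ℚ.<⇒≤ 0<½))
  (solve 1 (λ x → con ½ :* x :+ (con ½ :* (con 1ℚ :- x) :+ con ½) := con 1ℚ) refl (½^ n))

½^-antitone : ∀ {m n} → m ℕ.≤ n → ½^ n ℚ.≤ ½^ m
½^-antitone {n = n} ℕ.z≤n = ½^≤1 n
½^-antitone (ℕ.s≤s m≤n)   = *-monoˡ-≤-0≤ (ℚ.<⇒≤ 0<½) (½^-antitone m≤n)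

-- This is n + 1 ≤ 2^n without division; it drives `½^-small`.
½^*n≤1 : ∀ n → ½^ n ℚ.* fromℕ (suc n) ℚ.≤ 1ℚ
½^*n≤1 zero    = ℚ.≤-refl
½^*n≤1 (suc n) = slack-≤ ((1ℚ ℚ.- h ℚ.* (1ℚ ℚ.+ f)) ℚ.+ ½ ℚ.* (h ℚ.* f))
  (0≤+ (p≤q⇒0≤q-p (½^*n≤1 n)) (0≤* (ℚ.<⇒≤ 0<½) (0≤* (ℚ.<⇒≤ (0<½^ n)) (0≤fromℕ n))))
  (solve 2 (λ h f → con ½ :* h :* (con 1ℚ :+ (con 1ℚ :+ f)) :+ ((con 1ℚ :- h :* (con 1ℚ :+ f)) :+ con ½ :* (h :* f)) := con 1ℚ)
    refl h f)
  where
  h = ½^ n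
  f = fromℕ n

abstract
  ½^-small : ∀ {ε} → 0ℚ ℚ.< ε → ∃ λ n → ½^ n ℚ.< ε
  ½^-small {ε} 0<ε with divide 0<ε 0<1
  ... | K , 0<K , εK≡1 with archimedean K
  ... | n , K≤n = n , ℚ.≰⇒> λ ε≤h → ℚ.<-irrefl refl (ℚ.≤-<-trans (1≤hn ε≤h) hn<1)
    where
    1≤hn : ε ℚ.≤ ½^ n → 1ℚ ℚ.≤ ½^ n ℚ.* fromℕ n
    1≤hn ε≤h = subst (ℚ._≤ _) εK≡1 (*-mono-≤-0≤ (ℚ.<⇒≤ (0<½^ n)) (ℚ.<⇒≤ 0<K) ε≤h K≤n)

    hn<1 : ½^ n ℚ.* fromℕ n ℚ.< 1ℚ
    hn<1 = slack-< (½^ n ℚ.+ (1ℚ ℚ.- ½^ n ℚ.* (1ℚ ℚ.+ fromℕ n)))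
      (0<+ (0<½^ n) (p≤q⇒0≤q-p (½^*n≤1 n)))
      (solve 2 (λ h f → h :* f :+ (h :+ (con 1ℚ :- h :* (con 1ℚ :+ f))) := con 1ℚ)
        refl (½^ n) (fromℕ n))

open import Defs

ev-map₂ : ∀ {P Q R : ℕ → Set} → (∀ n → P n → Q n → R n) →
          Eventually P → Eventually Q → Eventually R
ev-map₂ f (M , p) (N , q) = M ℕ.⊔ N , λ n n≥ →
  f n (p n (ℕ.m⊔n≤o⇒m≤o M N n≥)) (q n (ℕ.m⊔n≤o⇒n≤o M N n≥))

ev-map : ∀ {P Q : ℕ → Set} → (∀ n → P n → Q n) → Eventually P → Eventually Q
ev-map f (M , p) = M , λ n n≥ → f n (p n n≥)

always : ∀ {P : ℕ → Set} → (∀ n → P n) → Eventually P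
always p = 0 , λ n _ → p n

-- The field operations of ℝ act termwise on approximations, so identities and
-- inequalities valid for all rationals transfer pointwise.
pt≈ : ∀ {x y} → (∀ n → approx x n ≡ approx y n) → x ≈ y
pt≈ {x} {y} eq = mk≈ λ ε 0<ε → always λ n →
  subst (λ q → ℚ.∣ q ∣ ℚ.< ε) (sym (trans (cong (ℚ._- approx y n) (eq n)) (ℚ.+-inverseʳ (approx y n)))) 0<ε

ev≤ : ∀ {x y} → (Eventually λ n → approx x n ℚ.≤ approx y n) → x ≤ᴿ y
ev≤ {x} {y} ev = mk≤ λ ε 0<ε → ev-map (λ n h → slack-≤ ((approx y n ℚ.- approx x n) ℚ.+ ε)
  (0≤+ (p≤q⇒0≤q-p h) (ℚ.<⇒≤ 0<ε))
  (solve 3 (λ x y e → x :+ ((y :- x) :+ e) := y :+ e) refl (approx x n) (approx y n) ε)) ev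

pt≤ : ∀ {x y} → (∀ n → approx x n ℚ.≤ approx y n) → x ≤ᴿ y
pt≤ h = ev≤ (always h)

≈-refl : ∀ {x} → x ≈ x
≈-refl = pt≈ (λ n → refl)

≈-sym : ∀ {x y} → x ≈ y → y ≈ x
≈-sym {x} {y} (mk≈ c) = mk≈ λ ε 0<ε →
  ev-map (λ n → subst (ℚ._< ε) (∣p-q∣≡∣q-p∣ (approx x n) (approx y n))) (c ε 0<ε)

≈-trans : ∀ {x y z} → x ≈ y → y ≈ z → x ≈ z
≈-trans {x} {y} {z} (mk≈ c) (mk≈ d) = mk≈ λ ε 0<ε → ev-map₂
  (λ n p q → subst (ℚ.∣ approx x n ℚ.- approx z n ∣ ℚ.<_) (half+half ε)
    (ℚ.≤-<-trans (triangle (approx x n) (approx y n) (approx z n)) (ℚ.+-mono-< p q)))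
  (c _ (half 0<ε)) (d _ (half 0<ε))

≈⇒≤ : ∀ {x y} → x ≈ y → x ≤ᴿ y
≈⇒≤ (mk≈ c) = mk≤ λ ε 0<ε → ev-map (λ n h → ℚ.<⇒≤ (∣p-q∣<r⇒p<q+r h)) (c ε 0<ε)

≤-refl : ∀ {x} → x ≤ᴿ x
≤-refl = ≈⇒≤ ≈-refl

≤-trans : ∀ {x y z} → x ≤ᴿ y → y ≤ᴿ z → x ≤ᴿ z
≤-trans {x} {y} {z} (mk≤ c) (mk≤ d) = mk≤ λ ε 0<ε → ev-map₂
  (λ n p q → subst (approx x n ℚ.≤_) (trans (ℚ.+-assoc (approx z n) _ _) (cong (approx z n ℚ.+_) (half+half ε)))
    (ℚ.≤-trans p (ℚ.+-monoˡ-≤ (ε ℚ.* ½) q)))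
  (c _ (half 0<ε)) (d _ (half 0<ε))

≤-antisym : ∀ {x y} → x ≤ᴿ y → y ≤ᴿ x → x ≈ y
≤-antisym {x} {y} (mk≤ c) (mk≤ d) = mk≈ λ ε 0<ε → ev-map₂
  (λ n p q → ∣p∣<q
    (slack-< ((approx y n ℚ.+ ε ℚ.* ½ ℚ.- approx x n) ℚ.+ ε ℚ.* ½) (lt ε 0<ε p)
      (solve 3 (λ x y e → x :- y :+ ((y :+ e :* con ½ :- x) :+ e :* con ½) := e) refl (approx x n) (approx y n) ε))
    (slack-< ((approx x n ℚ.+ ε ℚ.* ½ ℚ.- approx y n) ℚ.+ ε ℚ.* ½) (lt ε 0<ε q)
      (solve 3 (λ x y e → :- (x :- y) :+ ((x :+ e :* con ½ :- y) :+ e :* con ½) := e) refl (approx x n) (approx y n) ε)))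
  (c _ (half 0<ε)) (d _ (half 0<ε))
  where
  lt : ∀ {p q} ε → 0ℚ ℚ.< ε → p ℚ.≤ q → 0ℚ ℚ.< (q ℚ.- p) ℚ.+ ε ℚ.* ½
  lt ε 0<ε h = ℚ.+-mono-≤-< (p≤q⇒0≤q-p h) (half 0<ε)

<⇒≤ : ∀ {x y} → x <ᴿ y → x ≤ᴿ y
<⇒≤ {x} {y} (mk< g 0<g a) = ev≤ (ev-map (λ n h → ℚ.≤-trans
  (slack-≤ g (ℚ.<⇒≤ 0<g) refl) h) a)

<-≤-trans : ∀ {x y z} → x <ᴿ y → y ≤ᴿ z → x <ᴿ z
<-≤-trans {x} {y} {z} (mk< g 0<g a) (mk≤ c) = mk< (g ℚ.* ½) (half 0<g) (ev-map₂
  (λ n p q → slack-≤ ((approx y n ℚ.- (approx x n ℚ.+ g)) ℚ.+ (approx z n ℚ.+ g ℚ.* ½ ℚ.- approx y n))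
    (0≤+ (p≤q⇒0≤q-p p) (p≤q⇒0≤q-p q))
    (solve 4 (λ x y z g → x :+ g :* con ½ :+ ((y :- (x :+ g)) :+ (z :+ g :* con ½ :- y)) := z)
      refl (approx x n) (approx y n) (approx z n) g))
  a (c _ (half 0<g)))

≤-<-trans : ∀ {x y z} → x ≤ᴿ y → y <ᴿ z → x <ᴿ z
≤-<-trans {x} {y} {z} (mk≤ c) (mk< g 0<g a) = mk< (g ℚ.* ½) (half 0<g) (ev-map₂
  (λ n p q → slack-≤ ((approx y n ℚ.+ g ℚ.* ½ ℚ.- approx x n) ℚ.+ (approx z n ℚ.- (approx y n ℚ.+ g)))
    (0≤+ (p≤q⇒0≤q-p p) (p≤q⇒0≤q-p q))
    (solve 4 (λ x y z g → x :+ g :* con ½ :+ ((y :+ g :* con ½ :- x) :+ (z :- (y :+ g))) := z)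
      refl (approx x n) (approx y n) (approx z n) g))
  (c _ (half 0<g)) a)

<-irrefl : ∀ {x} → ¬ x <ᴿ x
<-irrefl {x} (mk< g 0<g (N , a)) = ℚ.<-irrefl refl (ℚ.<-≤-trans
  (slack-< g 0<g refl) (a N ℕ.≤-refl))

<⇒≱ : ∀ {x y} → x <ᴿ y → ¬ y ≤ᴿ x
<⇒≱ x<y y≤x = <-irrefl (<-≤-trans x<y y≤x)

fromℚ-mono-≤ : ∀ {p q} → p ℚ.≤ q → fromℚ p ≤ᴿ fromℚ q
fromℚ-mono-≤ p≤q = pt≤ (λ _ → p≤q)

fromℚ-mono-< : ∀ {p q} → p ℚ.< q → fromℚ p <ᴿ fromℚ q
fromℚ-mono-< {p} {q} p<q = mk< (q ℚ.- p) (p<q⇒0<q-p p<q) (always λ _ → ℚ.≤-reflexive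
  (solve 2 (λ p q → p :+ (q :- p) := q) refl p q))

fromℚ-cancel-≤ : ∀ {p q} → fromℚ p ≤ᴿ fromℚ q → p ℚ.≤ q
fromℚ-cancel-≤ {p} {q} p≤q = ℚ.≮⇒≥ λ q<p → <⇒≱ (fromℚ-mono-< q<p) p≤q

0ᴿ<1ᴿ : 0ᴿ <ᴿ 1ᴿ
0ᴿ<1ᴿ = fromℚ-mono-< 0<1

+ᴿ-mono-≤ : ∀ {x y u v} → x ≤ᴿ y → u ≤ᴿ v → x +ᴿ u ≤ᴿ y +ᴿ v
+ᴿ-mono-≤ {x} {y} {u} {v} (mk≤ c) (mk≤ d) = mk≤ λ ε 0<ε → ev-map₂
  (λ n p q → slack-≤ ((approx y n ℚ.+ ε ℚ.* ½ ℚ.- approx x n) ℚ.+ (approx v n ℚ.+ ε ℚ.* ½ ℚ.- approx u n))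
    (0≤+ (p≤q⇒0≤q-p p) (p≤q⇒0≤q-p q))
    (solve 5 (λ x y u v e → x :+ u :+ ((y :+ e :* con ½ :- x) :+ (v :+ e :* con ½ :- u)) := y :+ v :+ e)
       refl (approx x n) (approx y n) (approx u n) (approx v n) ε))
  (c _ (half 0<ε)) (d _ (half 0<ε))

Bounded : (ℕ → ℚ) → ℚ → Set
Bounded z B = 0ℚ ℚ.< B × (Eventually λ n → ℚ.∣ z n ∣ ℚ.≤ B)

abstract
  approx-bounded : ∀ x → ∃ (Bounded (approx x))
  approx-bounded (mkℝ x cx) with cx 1ℚ 0<1
  ... | N , c = ℚ.∣ x N ∣ ℚ.+ 1ℚ , ℚ.+-mono-≤-< (ℚ.0≤∣p∣ (x N)) 0<1 , N , λ n n≥ → begin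
      ℚ.∣ x n ∣
        ≡⟨ cong ℚ.∣_∣ (solve 2 (λ a b → a := b :+ (a :- b)) refl (x n) (x N)) ⟩
      ℚ.∣ x N ℚ.+ (x n ℚ.- x N) ∣
        ≤⟨ ℚ.∣p+q∣≤∣p∣+∣q∣ (x N) (x n ℚ.- x N) ⟩
      ℚ.∣ x N ∣ ℚ.+ ℚ.∣ x n ℚ.- x N ∣
        ≤⟨ ℚ.+-monoʳ-≤ ℚ.∣ x N ∣ (ℚ.<⇒≤ (c n N n≥ ℕ.≤-refl)) ⟩
      ℚ.∣ x N ∣ ℚ.+ 1ℚ ∎
    where open ℚ.≤-Reasoning

abstract
  upper-bound : ∀ x → ∃ λ B → 0ℚ ℚ.< B × x ≤ᴿ fromℚ B
  upper-bound x = B , proj₁ bound , ev≤ {x} {fromℚ B} (proj₁ (proj₂ bound) , λ n n≥ →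
    ℚ.≤-trans {approx x n} {ℚ.∣ approx x n ∣} {B} (p≤∣p∣ (approx x n)) (proj₂ (proj₂ bound) n n≥))
    where
    B : ℚ
    B = proj₁ (approx-bounded x)

    bound : Bounded (approx x) B
    bound = proj₂ (approx-bounded x)

+ᴿ-cong : ∀ {x y u v} → x ≈ y → u ≈ v → x +ᴿ u ≈ y +ᴿ v
+ᴿ-cong {x} {y} {u} {v} p q = ≤-antisym
  (+ᴿ-mono-≤ (≈⇒≤ p) (≈⇒≤ q)) (+ᴿ-mono-≤ (≈⇒≤ (≈-sym p)) (≈⇒≤ (≈-sym q)))

fromℚ-+ : ∀ p q → fromℚ p +ᴿ fromℚ q ≈ fromℚ (p ℚ.+ q)
fromℚ-+ p q = pt≈ λ n → refl

-ᴿ_ : ℝ → ℝ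
-ᴿ x = 0ᴿ -ᴿ x

infix 8 -ᴿ_

neg-mono-≤ : ∀ {x y} → x ≤ᴿ y → -ᴿ y ≤ᴿ -ᴿ x
neg-mono-≤ {x} {y} (mk≤ c) = mk≤ λ ε 0<ε → ev-map
  (λ n p → slack-≤ (approx y n ℚ.+ ε ℚ.- approx x n) (p≤q⇒0≤q-p p)
    (solve 3 (λ x y e → con 0ℚ :- y :+ (y :+ e :- x) := con 0ℚ :- x :+ e) refl (approx x n) (approx y n) ε))
  (c ε 0<ε)

neg-cong : ∀ {x y} → x ≈ y → -ᴿ x ≈ -ᴿ y
neg-cong p = ≤-antisym (neg-mono-≤ (≈⇒≤ (≈-sym p))) (neg-mono-≤ (≈⇒≤ p))

*ᴿ-congʳ : ∀ {x y} z → x ≈ y → x *ᴿ z ≈ y *ᴿ z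
*ᴿ-congʳ {x} {y} z (mk≈ c) = mk≈ near
  where
  near : ∀ ε → 0ℚ ℚ.< ε → Eventually λ n → ℚ.∣ approx x n ℚ.* approx z n ℚ.- approx y n ℚ.* approx z n ∣ ℚ.< ε
  near ε 0<ε with approx-bounded z
  ... | B , 0<B , bound with divide 0<B 0<ε
  ... | δ , 0<δ , Bδ≡ε = ev-map₂ step bound (c δ 0<δ)
    where
    step : ∀ n → ℚ.∣ approx z n ∣ ℚ.≤ B → ℚ.∣ approx x n ℚ.- approx y n ∣ ℚ.< δ →
           ℚ.∣ approx x n ℚ.* approx z n ℚ.- approx y n ℚ.* approx z n ∣ ℚ.< ε
    step n z≤B x-y<δ = begin-strict
      ℚ.∣ approx x n ℚ.* approx z n ℚ.- approx y n ℚ.* approx z n ∣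
        ≡⟨ cong ℚ.∣_∣ (solve 3 (λ x y z → x :* z :- y :* z := z :* (x :- y)) refl (approx x n) (approx y n) (approx z n)) ⟩
      ℚ.∣ approx z n ℚ.* (approx x n ℚ.- approx y n) ∣
        ≡⟨ ℚ.∣p*q∣≡∣p∣*∣q∣ (approx z n) _ ⟩
      ℚ.∣ approx z n ∣ ℚ.* ℚ.∣ approx x n ℚ.- approx y n ∣
        ≤⟨ *-monoʳ-≤-0≤ (ℚ.0≤∣p∣ (approx x n ℚ.- approx y n)) z≤B ⟩
      B ℚ.* ℚ.∣ approx x n ℚ.- approx y n ∣
        <⟨ ℚ.*-monoʳ-<-pos B {{ℚ.positive 0<B}} x-y<δ ⟩
      B ℚ.* δ
        ≡⟨ Bδ≡ε ⟩
      ε ∎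
      where open ℚ.≤-Reasoning

*ᴿ-comm : ∀ x y → x *ᴿ y ≈ y *ᴿ x
*ᴿ-comm x y = pt≈ λ n → ℚ.*-comm (approx x n) (approx y n)

*ᴿ-cong : ∀ {x y u v} → x ≈ y → u ≈ v → x *ᴿ u ≈ y *ᴿ v
*ᴿ-cong {x} {y} {u} {v} p q = ≈-trans (*ᴿ-congʳ u p)
  (≈-trans (*ᴿ-comm y u) (≈-trans (*ᴿ-congʳ y q) (*ᴿ-comm v y)))

ℝ-commutativeRing : CommutativeRing 0ℓ 0ℓ
ℝ-commutativeRing = record
  { Carrier = ℝ
  ; _≈_ = _≈_
  ; _+_ = _+ᴿ_
  ; _*_ = _*ᴿ_
  ; -_ = -ᴿ_
  ; 0# = 0ᴿ
  ; 1# = 1ᴿ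
  ; isCommutativeRing = record
    { isRing = record
      { +-isAbelianGroup = record
        { isGroup = record
          { isMonoid = record
            { isSemigroup = record
              { isMagma = record
                { isEquivalence = record { refl = ≈-refl ; sym = ≈-sym ; trans = ≈-trans }
                ; ∙-cong = +ᴿ-cong
                }
              ; assoc = λ x y z → pt≈ λ n → ℚ.+-assoc (approx x n) (approx y n) (approx z n)
              }
            ; identity = (λ x → pt≈ λ n → ℚ.+-identityˡ (approx x n))
                       , (λ x → pt≈ λ n → ℚ.+-identityʳ (approx x n))
            }
          ; inverse = (λ x → pt≈ λ n → solve 1 (λ x → (con 0ℚ :- x) :+ x := con 0ℚ) refl (approx x n))
                    , (λ x → pt≈ λ n → solve 1 (λ x → x :+ (con 0ℚ :- x) := con 0ℚ) refl (approx x n))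
          ; ⁻¹-cong = neg-cong
          }
        ; comm = λ x y → pt≈ λ n → ℚ.+-comm (approx x n) (approx y n)
        }
      ; *-cong = *ᴿ-cong
      ; *-assoc = λ x y z → pt≈ λ n → ℚ.*-assoc (approx x n) (approx y n) (approx z n)
      ; *-identity = (λ x → pt≈ λ n → ℚ.*-identityˡ (approx x n))
                   , (λ x → pt≈ λ n → ℚ.*-identityʳ (approx x n))
      ; distrib = (λ x y z → pt≈ λ n → ℚ.*-distribˡ-+ (approx x n) (approx y n) (approx z n))
                , (λ x y z → pt≈ λ n → ℚ.*-distribʳ-+ (approx x n) (approx y n) (approx z n))
      }
    ; *-comm = *ᴿ-comm
    }
  }

module ∑ = SemiringSum (CommutativeRing.semiring ℝ-commutativeRing)
module ≈-Reasoning = SetoidReasoning (CommutativeRing.setoid ℝ-commutativeRing)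

≤-isPreorder : IsPreorder _≈_ _≤ᴿ_
≤-isPreorder = record
  { isEquivalence = CommutativeRing.isEquivalence ℝ-commutativeRing
  ; reflexive = ≈⇒≤
  ; trans = ≤-trans
  }

module ≤-Reasoning = PreorderReasoning ≤-isPreorder

slack : ∀ {x y} r → 0ᴿ ≤ᴿ r → x +ᴿ r ≈ y → x ≤ᴿ y
slack {x} {y} r 0≤r eq = begin
  x          ≈⟨ pt≈ {x} {x +ᴿ 0ᴿ} (λ n → sym (ℚ.+-identityʳ (approx x n))) ⟩
  x +ᴿ 0ᴿ    ≲⟨ +ᴿ-mono-≤ (≤-refl {x}) 0≤r ⟩
  x +ᴿ r     ≈⟨ eq ⟩
  y          ∎
  where open ≤-Reasoning

x≤y⇒0≤y-x : ∀ {x y} → x ≤ᴿ y → 0ᴿ ≤ᴿ y -ᴿ x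
x≤y⇒0≤y-x {x} {y} x≤y = begin
  0ᴿ       ≈⟨ pt≈ {0ᴿ} {x -ᴿ x} (λ n → sym (ℚ.+-inverseʳ (approx x n))) ⟩
  x -ᴿ x   ≈⟨ pt≈ {x -ᴿ x} {x +ᴿ -ᴿ x} (λ n → solve 1 (λ x → x :- x := x :+ (con 0ℚ :- x)) refl (approx x n)) ⟩
  x +ᴿ -ᴿ x ≲⟨ +ᴿ-mono-≤ x≤y (≤-refl { -ᴿ x}) ⟩
  y +ᴿ -ᴿ x ≈⟨ pt≈ {y +ᴿ -ᴿ x} {y -ᴿ x} (λ n → solve 2 (λ x y → y :+ (con 0ℚ :- x) := y :- x) refl (approx x n) (approx y n)) ⟩
  y -ᴿ x   ∎
  where open ≤-Reasoning

0≤+ᴿ : ∀ {x y} → 0ᴿ ≤ᴿ x → 0ᴿ ≤ᴿ y → 0ᴿ ≤ᴿ x +ᴿ y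
0≤+ᴿ {x} {y} p q = ≤-trans (pt≤ {0ᴿ} {0ᴿ +ᴿ 0ᴿ} λ _ → ℚ.≤-refl) (+ᴿ-mono-≤ p q)

0<*ᴿ : ∀ {x y} → 0ᴿ <ᴿ x → 0ᴿ <ᴿ y → 0ᴿ <ᴿ x *ᴿ y
0<*ᴿ {x} {y} (mk< g 0<g a) (mk< h 0<h b) = mk< (g ℚ.* h) (0<* 0<g 0<h)
  (ev-map₂ (λ n p q → subst (ℚ._≤ approx x n ℚ.* approx y n) (sym (ℚ.+-identityˡ (g ℚ.* h)))
     (*-mono-≤-0≤ {g} {approx x n} {h} {approx y n}
       (ℚ.≤-trans {0ℚ} {g} {approx x n} (ℚ.<⇒≤ 0<g) (≤′ g p)) (ℚ.<⇒≤ 0<h) (≤′ g p) (≤′ h q))) a b)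
  where
  ≤′ : ∀ p {q} → 0ℚ ℚ.+ p ℚ.≤ q → p ℚ.≤ q
  ≤′ p {q} = subst (ℚ._≤ q) (ℚ.+-identityˡ p)

abstract
  ∣∣-cauchy : ∀ x → IsCauchy x → IsCauchy (λ n → ℚ.∣ x n ∣)
  ∣∣-cauchy x cx ε 0<ε = proj₁ (cx ε 0<ε) , λ m n m≥ n≥ →
    ℚ.≤-<-trans (∣p∣≤q (one-sided (x m) (x n))
      (subst₂ ℚ._≤_ (solve 2 (λ a b → b :- a := :- (a :- b)) refl ℚ.∣ x m ∣ ℚ.∣ x n ∣) (∣p-q∣≡∣q-p∣ (x n) (x m)) (one-sided (x n) (x m))))
      (proj₂ (cx ε 0<ε) m n m≥ n≥)
    where
    one-sided : ∀ p q → ℚ.∣ p ∣ ℚ.- ℚ.∣ q ∣ ℚ.≤ ℚ.∣ p ℚ.- q ∣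
    one-sided p q = slack-≤ (ℚ.∣ p ℚ.- q ∣ ℚ.+ ℚ.∣ q ∣ ℚ.- ℚ.∣ p ∣)
      (p≤q⇒0≤q-p (subst (λ r → ℚ.∣ r ∣ ℚ.≤ ℚ.∣ p ℚ.- q ∣ ℚ.+ ℚ.∣ q ∣)
        (solve 2 (λ p q → (p :- q) :+ q := p) refl p q) (ℚ.∣p+q∣≤∣p∣+∣q∣ (p ℚ.- q) q)))
      (solve 3 (λ a b c → a :- b :+ (c :+ b :- a) := c) refl ℚ.∣ p ∣ ℚ.∣ q ∣ ℚ.∣ p ℚ.- q ∣)

∣_∣ᴿ : ℝ → ℝ
∣ mkℝ x cx ∣ᴿ = mkℝ (λ n → ℚ.∣ x n ∣) (∣∣-cauchy x cx)

x≤∣x∣ : ∀ x → x ≤ᴿ ∣ x ∣ᴿ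
x≤∣x∣ x = pt≤ λ n → p≤∣p∣ (approx x n)

-x≤∣x∣ : ∀ x → -ᴿ x ≤ᴿ ∣ x ∣ᴿ
-x≤∣x∣ x = pt≤ λ n → subst (ℚ._≤ ℚ.∣ approx x n ∣) (sym (ℚ.+-identityˡ _)) (-p≤∣p∣ (approx x n))

0≤∣x∣ : ∀ x → 0ᴿ ≤ᴿ ∣ x ∣ᴿ
0≤∣x∣ x = pt≤ λ n → ℚ.0≤∣p∣ (approx x n)

∣x∣≤y : ∀ {x y} → x ≤ᴿ y → -ᴿ x ≤ᴿ y → ∣ x ∣ᴿ ≤ᴿ y
∣x∣≤y {x} {y} (mk≤ c) (mk≤ d) = mk≤ λ ε 0<ε → ev-map₂
  (λ n p q → ∣p∣≤q p (subst (ℚ._≤ approx y n ℚ.+ ε) (ℚ.+-identityˡ _) q)) (c ε 0<ε) (d ε 0<ε)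

∣∣-cong : ∀ {x y} → x ≈ y → ∣ x ∣ᴿ ≈ ∣ y ∣ᴿ
∣∣-cong {x} {y} x≈y = ≤-antisym (one x≈y) (one (≈-sym x≈y))
  where
  one : ∀ {x y} → x ≈ y → ∣ x ∣ᴿ ≤ᴿ ∣ y ∣ᴿ
  one {x} {y} x≈y = ∣x∣≤y (≤-trans (≈⇒≤ x≈y) (x≤∣x∣ y)) (≤-trans (≈⇒≤ (neg-cong x≈y)) (-x≤∣x∣ y))

∣x*y∣≈∣x∣*∣y∣ : ∀ x y → ∣ x *ᴿ y ∣ᴿ ≈ ∣ x ∣ᴿ *ᴿ ∣ y ∣ᴿ
∣x*y∣≈∣x∣*∣y∣ x y = pt≈ λ n → ℚ.∣p*q∣≡∣p∣*∣q∣ (approx x n) (approx y n)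

-- Order, reciprocals, bisection and infima in the classical reals

module Classically (lem : Classical) where

  dec : ∀ {ℓ} (P : Set ℓ) → Dec P
  dec P = lem

  ¬¬-elim : ∀ {ℓ} {P : Set ℓ} → ¬ ¬ P → P
  ¬¬-elim {P = P} ¬¬p with dec P
  ... | yes p = p
  ... | no ¬p = ⊥-elim (¬¬p ¬p)

  ¬∀⇒∃¬ : ∀ {a b} {A : Set a} {B : A → Set b} → ¬ (∀ x → B x) → ∃ λ x → ¬ B x
  ¬∀⇒∃¬ ¬∀ = ¬¬-elim λ ¬∃ → ¬∀ λ x → ¬¬-elim λ ¬b → ¬∃ (x , ¬b)

  -- If x ≤ y fails for ε, then x exceeds y + ε at arbitrarily late indices. One such index beyond
  -- the point where both sequences vary by less than ε/4 leaves a gap of ε/2 at all later indices.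
  ≤-or-> : ∀ x y → x ≤ᴿ y ⊎ y <ᴿ x
  ≤-or-> x y with dec (x ≤ᴿ y)
  ... | yes x≤y = inj₁ x≤y
  ... | no  x≰y = inj₂ y<x
    where
    not-below : ∃ λ ε → ¬ (0ℚ ℚ.< ε → Eventually λ n → approx x n ℚ.≤ approx y n ℚ.+ ε)
    not-below = ¬∀⇒∃¬ (λ h → x≰y (mk≤ h))

    ε : ℚ
    ε = proj₁ not-below

    0<ε : 0ℚ ℚ.< ε
    0<ε = ¬¬-elim λ ≮ → proj₂ not-below λ < → ⊥-elim (≮ <)

    frequently : ∀ N → ∃ λ n → N ℕ.≤ n × approx y n ℚ.+ ε ℚ.< approx x n
    frequently N = ¬¬-elim λ none → proj₂ not-below λ _ → N , λ n n≥ →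
      ℚ.≮⇒≥ λ gt → none (n , n≥ , gt)

    δ : ℚ
    δ = ε ℚ.* ½ ℚ.* ½

    y<x : y <ᴿ x
    y<x = mk< (ε ℚ.* ½) (half 0<ε) (N , λ n n≥ → slack-≤
      ((approx x k ℚ.- (approx y k ℚ.+ ε)) ℚ.+ ((approx y k ℚ.+ δ ℚ.- approx y n) ℚ.+ (approx x n ℚ.+ δ ℚ.- approx x k)))
      (0≤+ (p≤q⇒0≤q-p (ℚ.<⇒≤ (proj₂ (proj₂ (frequently N)))))
        (0≤+ (p≤q⇒0≤q-p (ℚ.<⇒≤ (∣p-q∣<r⇒q<p+r {approx y k} {approx y n} (close y Ny k n (ℕ.m⊔n≤o⇒n≤o (proj₁ Nx) (proj₁ Ny) k≥N) (ℕ.m⊔n≤o⇒n≤o (proj₁ Nx) (proj₁ Ny) n≥)))))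
             (p≤q⇒0≤q-p (ℚ.<⇒≤ (∣p-q∣<r⇒p<q+r {approx x k} {approx x n} (close x Nx k n (ℕ.m⊔n≤o⇒m≤o (proj₁ Nx) (proj₁ Ny) k≥N) (ℕ.m⊔n≤o⇒m≤o (proj₁ Nx) (proj₁ Ny) n≥)))))))
      (solve 5 (λ xk yk xn yn e → yn :+ e :* con ½ :+ ((xk :- (yk :+ e)) :+ ((yk :+ e :* con ½ :* con ½ :- yn) :+ (xn :+ e :* con ½ :* con ½ :- xk))) := xn)
        refl (approx x k) (approx y k) (approx x n) (approx y n) ε))
      where
      Close : ℝ → Set
      Close z = ∃ λ N → ∀ m n → N ℕ.≤ m → N ℕ.≤ n → ℚ.∣ approx z m ℚ.- approx z n ∣ ℚ.< δ

      close : ∀ z (c : Close z) m n → proj₁ c ℕ.≤ m → proj₁ c ℕ.≤ n → ℚ.∣ approx z m ℚ.- approx z n ∣ ℚ.< δ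
      close z = proj₂

      Nx : Close x
      Nx = isCauchy x δ (half (half 0<ε))

      Ny : Close y
      Ny = isCauchy y δ (half (half 0<ε))

      N k : ℕ
      N = proj₁ Nx ℕ.⊔ proj₁ Ny
      k = proj₁ (frequently N)

      k≥N : N ℕ.≤ k
      k≥N = proj₁ (proj₂ (frequently N))

  ≤-total : ∀ x y → x ≤ᴿ y ⊎ y ≤ᴿ x
  ≤-total x y with ≤-or-> x y
  ... | inj₁ x≤y = inj₁ x≤y
  ... | inj₂ y<x = inj₂ (<⇒≤ y<x)

  ≮⇒≥ : ∀ {x y} → ¬ x <ᴿ y → y ≤ᴿ x
  ≮⇒≥ {x} {y} x≮y with ≤-or-> y x
  ... | inj₁ y≤x = y≤x
  ... | inj₂ x<y = ⊥-elim (x≮y x<y)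

  ≰⇒> : ∀ {x y} → ¬ x ≤ᴿ y → y <ᴿ x
  ≰⇒> {x} {y} x≰y with ≤-or-> x y
  ... | inj₁ x≤y = ⊥-elim (x≰y x≤y)
  ... | inj₂ y<x = y<x

  ≤-or-≈ : ∀ {x y} → x ≤ᴿ y → x <ᴿ y ⊎ x ≈ y
  ≤-or-≈ {x} {y} x≤y with ≤-or-> y x
  ... | inj₁ y≤x = inj₂ (≤-antisym x≤y y≤x)
  ... | inj₂ x<y = inj₁ x<y

  ≤∧≉⇒< : ∀ {x y} → x ≤ᴿ y → ¬ x ≈ y → x <ᴿ y
  ≤∧≉⇒< x≤y x≉y with ≤-or-≈ x≤y
  ... | inj₁ x<y = x<y
  ... | inj₂ x≈y = ⊥-elim (x≉y x≈y)

  zeroˡ : ∀ {x} y → x ≈ 0ᴿ → x *ᴿ y ≈ 0ᴿ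
  zeroˡ y x≈0 = ≈-trans (*ᴿ-congʳ y x≈0) (pt≈ λ n → ℚ.*-zeroˡ (approx y n))

  zeroʳ : ∀ x {y} → y ≈ 0ᴿ → x *ᴿ y ≈ 0ᴿ
  zeroʳ x {y} y≈0 = ≈-trans (*ᴿ-comm x y) (zeroˡ x y≈0)

  0≤*ᴿ : ∀ {x y} → 0ᴿ ≤ᴿ x → 0ᴿ ≤ᴿ y → 0ᴿ ≤ᴿ x *ᴿ y
  0≤*ᴿ {x} {y} 0≤x 0≤y with ≤-or-≈ 0≤x | ≤-or-≈ 0≤y
  ... | inj₁ 0<x | inj₁ 0<y = <⇒≤ (0<*ᴿ 0<x 0<y)
  ... | inj₂ 0≈x | _        = ≈⇒≤ (≈-sym (zeroˡ y (≈-sym 0≈x)))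
  ... | inj₁ _   | inj₂ 0≈y = ≈⇒≤ (≈-sym (zeroʳ x (≈-sym 0≈y)))

  rational-above : ∀ x {ε} → 0ℚ ℚ.< ε → ∃ λ q → x <ᴿ fromℚ q × fromℚ q ≤ᴿ x +ᴿ fromℚ ε
  rational-above x {ε} 0<ε = approx x N ℚ.+ ε ℚ.* ½ ,
      mk< (ε ℚ.* ½ ℚ.* ½) (half (half 0<ε)) (N , λ n n≥ → slack-≤ (approx x N ℚ.+ δ ℚ.- approx x n)
        (p≤q⇒0≤q-p (ℚ.<⇒≤ (∣p-q∣<r⇒p<q+r {approx x n} {approx x N} (proj₂ c n N n≥ ℕ.≤-refl))))
        (solve 3 (λ xn xN e → xn :+ e :* con ½ :* con ½ :+ (xN :+ e :* con ½ :* con ½ :- xn) := xN :+ e :* con ½)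
          refl (approx x n) (approx x N) ε)) ,
      ev≤ (N , λ n n≥ → slack-≤ ((approx x n ℚ.+ δ ℚ.- approx x N) ℚ.+ δ)
        (0≤+ (p≤q⇒0≤q-p (ℚ.<⇒≤ (∣p-q∣<r⇒p<q+r {approx x N} {approx x n} (proj₂ c N n ℕ.≤-refl n≥)))) (ℚ.<⇒≤ (half (half 0<ε))))
        (solve 3 (λ xn xN e → xN :+ e :* con ½ :+ ((xn :+ e :* con ½ :* con ½ :- xN) :+ e :* con ½ :* con ½) := xn :+ e)
          refl (approx x n) (approx x N) ε))
    where
    δ : ℚ
    δ = ε ℚ.* ½ ℚ.* ½

    c : ∃ λ N → ∀ m n → N ℕ.≤ m → N ℕ.≤ n → ℚ.∣ approx x m ℚ.- approx x n ∣ ℚ.< δ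
    c = isCauchy x δ (half (half 0<ε))

    N : ℕ
    N = proj₁ c

  <⇒gap : ∀ {x y} → x <ᴿ y → ∃ λ g → 0ℚ ℚ.< g × x +ᴿ fromℚ g ≤ᴿ y
  <⇒gap (mk< g 0<g a) = g , 0<g , ev≤ a

  gap⇒< : ∀ {x y g} → 0ℚ ℚ.< g → x +ᴿ fromℚ g ≤ᴿ y → x <ᴿ y
  gap⇒< {x} {y} {g} 0<g h = <-≤-trans (mk< {x} {x +ᴿ fromℚ g} g 0<g (always λ n → ℚ.≤-refl)) h

  abstract
    -- Early approximations may be 0 or negative. Replacing each by its maximum with the gap g
    -- changes no late one and bounds all the inverses by 1/g, which gives the Cauchy estimate.
    reciprocal⁺ : ∀ {x} → 0ᴿ <ᴿ x → ∃ λ y → x *ᴿ y ≈ 1ᴿ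
    reciprocal⁺ {x} (mk< g 0<g (N , above)) = mkℝ y y-cauchy , mk≈ λ ε 0<ε → N , λ n n≥ →
        subst (λ q → ℚ.∣ q ∣ ℚ.< ε) (sym (trans (cong (ℚ._- 1ℚ) (xy≡1 n n≥)) (ℚ.+-inverseʳ 1ℚ))) 0<ε
      where
      a y : ℕ → ℚ
      a n = g ℚ.⊔ approx x n

      0<a : ∀ n → 0ℚ ℚ.< a n
      0<a n = ℚ.<-≤-trans 0<g (ℚ.p≤p⊔q g (approx x n))

      y n = proj₁ (divide (0<a n) 0<1)

      0<y : ∀ n → 0ℚ ℚ.< y n
      0<y n = proj₁ (proj₂ (divide (0<a n) 0<1))

      ay≡1 : ∀ n → a n ℚ.* y n ≡ 1ℚ
      ay≡1 n = proj₂ (proj₂ (divide (0<a n) 0<1))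

      a≡x : ∀ n → N ℕ.≤ n → a n ≡ approx x n
      a≡x n n≥ = ℚ.p≤q⇒p⊔q≡q (subst (ℚ._≤ approx x n) (ℚ.+-identityˡ g) (above n n≥))

      xy≡1 : ∀ n → N ℕ.≤ n → approx x n ℚ.* y n ≡ 1ℚ
      xy≡1 n n≥ = trans (cong (ℚ._* y n) (sym (a≡x n n≥))) (ay≡1 n)

      h : ℚ
      h = proj₁ (divide 0<g 0<1)

      gh≡1 : g ℚ.* h ≡ 1ℚ
      gh≡1 = proj₂ (proj₂ (divide 0<g 0<1))

      0<h : 0ℚ ℚ.< h
      0<h = proj₁ (proj₂ (divide 0<g 0<1))

      y≤h : ∀ n → y n ℚ.≤ h
      y≤h n = begin
        y n                   ≡⟨ ℚ.*-identityˡ (y n) ⟨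
        1ℚ ℚ.* y n            ≡⟨ cong (ℚ._* y n) gh≡1 ⟨
        g ℚ.* h ℚ.* y n       ≡⟨ solve 3 (λ g h y → g :* h :* y := h :* y :* g) refl g h (y n) ⟩
        h ℚ.* y n ℚ.* g       ≤⟨ *-monoˡ-≤-0≤ (0≤* (ℚ.<⇒≤ 0<h) (ℚ.<⇒≤ (0<y n))) (ℚ.p≤p⊔q g (approx x n)) ⟩
        h ℚ.* y n ℚ.* a n     ≡⟨ solve 3 (λ h y a → h :* y :* a := h :* (a :* y)) refl h (y n) (a n) ⟩
        h ℚ.* (a n ℚ.* y n)   ≡⟨ cong (h ℚ.*_) (ay≡1 n) ⟩
        h ℚ.* 1ℚ              ≡⟨ ℚ.*-identityʳ h ⟩
        h                     ∎
        where open ℚ.≤-Reasoning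

      difference : ∀ m n → y m ℚ.- y n ≡ (y m ℚ.* y n) ℚ.* (a n ℚ.- a m)
      difference m n = sym (trans
        (solve 4 (λ ym yn am an → (ym :* yn) :* (an :- am) := ym :* (an :* yn) :- yn :* (am :* ym)) refl (y m) (y n) (a m) (a n))
        (cong₂ ℚ._-_ (trans (cong (y m ℚ.*_) (ay≡1 n)) (ℚ.*-identityʳ (y m)))
                     (trans (cong (y n ℚ.*_) (ay≡1 m)) (ℚ.*-identityʳ (y n)))))

      y-cauchy : IsCauchy y
      y-cauchy ε 0<ε = M ℕ.⊔ N , λ m n m≥ n≥ → begin-strict
          ℚ.∣ y m ℚ.- y n ∣
            ≡⟨ trans (cong ℚ.∣_∣ (difference m n)) (ℚ.∣p*q∣≡∣p∣*∣q∣ (y m ℚ.* y n) _) ⟩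
          ℚ.∣ y m ℚ.* y n ∣ ℚ.* ℚ.∣ a n ℚ.- a m ∣
            ≡⟨ cong (ℚ._* ℚ.∣ a n ℚ.- a m ∣) (ℚ.0≤p⇒∣p∣≡p (0≤* (ℚ.<⇒≤ (0<y m)) (ℚ.<⇒≤ (0<y n)))) ⟩
          y m ℚ.* y n ℚ.* ℚ.∣ a n ℚ.- a m ∣
            ≤⟨ *-monoʳ-≤-0≤ (ℚ.0≤∣p∣ (a n ℚ.- a m)) (*-mono-≤-0≤ (ℚ.<⇒≤ 0<h) (ℚ.<⇒≤ (0<y n)) (y≤h m) (y≤h n)) ⟩
          h ℚ.* h ℚ.* ℚ.∣ a n ℚ.- a m ∣
            ≡⟨ cong (λ r → h ℚ.* h ℚ.* ℚ.∣ r ∣) (cong₂ ℚ._-_ (a≡x n (ℕ.m⊔n≤o⇒n≤o M N n≥)) (a≡x m (ℕ.m⊔n≤o⇒n≤o M N m≥))) ⟩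
          h ℚ.* h ℚ.* ℚ.∣ approx x n ℚ.- approx x m ∣
            <⟨ ℚ.*-monoʳ-<-pos (h ℚ.* h) {{ℚ.positive (0<* 0<h 0<h)}} (proj₂ near n m (ℕ.m⊔n≤o⇒m≤o M N n≥) (ℕ.m⊔n≤o⇒m≤o M N m≥)) ⟩
          h ℚ.* h ℚ.* δ
            ≡⟨ proj₂ (proj₂ small) ⟩
          ε ∎
        where
        open ℚ.≤-Reasoning
        small : ∃ λ δ → 0ℚ ℚ.< δ × h ℚ.* h ℚ.* δ ≡ ε
        small = divide (0<* 0<h 0<h) 0<ε

        δ : ℚ
        δ = proj₁ small

        near : ∃ λ M → ∀ m n → M ℕ.≤ m → M ℕ.≤ n → ℚ.∣ approx x m ℚ.- approx x n ∣ ℚ.< δ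
        near = isCauchy x δ (proj₁ (proj₂ small))

        M : ℕ
        M = proj₁ near

  reciprocal : ∀ {x} → ¬ x ≈ 0ᴿ → ∃ λ y → x *ᴿ y ≈ 1ᴿ
  reciprocal {x} x≉0 = [ negative , reciprocal⁺ ]′ (≤-or-> x 0ᴿ)
    where
    0<-x : x <ᴿ 0ᴿ → 0ᴿ <ᴿ -ᴿ x
    0<-x (mk< g 0<g a) = mk< g 0<g (ev-map (λ n h → slack-≤ (0ℚ ℚ.- (approx x n ℚ.+ g)) (p≤q⇒0≤q-p h)
      (solve 2 (λ x g → con 0ℚ :+ g :+ (con 0ℚ :- (x :+ g)) := con 0ℚ :- x) refl (approx x n) g)) a)

    negate : (∃ λ y → (-ᴿ x) *ᴿ y ≈ 1ᴿ) → ∃ λ y → x *ᴿ y ≈ 1ᴿ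
    negate (y , eq) = -ᴿ y , ≈-trans
      (pt≈ {x *ᴿ -ᴿ y} { -ᴿ x *ᴿ y} λ n → solve 2 (λ x y → x :* (con 0ℚ :- y) := (con 0ℚ :- x) :* y) refl (approx x n) (approx y n)) eq

    negative : x ≤ᴿ 0ᴿ → ∃ λ y → x *ᴿ y ≈ 1ᴿ
    negative x≤0 = [ (λ x<0 → negate (reciprocal⁺ (0<-x x<0))) , (λ x≈0 → ⊥-elim (x≉0 x≈0)) ]′ (≤-or-≈ x≤0)

  record Squeeze {ℓ} (S : ℚ → Set ℓ) (lo w : ℚ) (limit : ℝ) (ε : ℚ) : Set ℓ where
    field
      left right    : ℚ
      left∉         : ¬ S left
      right∈        : S right
      lo≤left       : lo ℚ.≤ left
      left≤right    : left ℚ.≤ right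
      right≤hi      : right ℚ.≤ lo ℚ.+ w
      right≤left+ε  : right ℚ.≤ left ℚ.+ ε
      left≤limit    : fromℚ left ≤ᴿ limit
      limit≤right   : limit ≤ᴿ fromℚ right

  -- The invariant is that S fails at the left end and holds at the right. It serves both for infima
  -- of sets of upper bounds and for tracing an open set along a segment.
  module Bisection {ℓ} (S : ℚ → Set ℓ) (lo w : ℚ) (0≤w : 0ℚ ℚ.≤ w) (¬Slo : ¬ S lo) (Shi : S (lo ℚ.+ w)) where
    mid : ℕ → ℚ → ℚ
    mid k p = p ℚ.+ w ℚ.* ½^ suc k

    a b : ℕ → ℚ
    a zero    = lo
    a (suc k) with dec (S (mid k (a k)))
    ... | yes _ = a k
    ... | no  _ = mid k (a k)
    b k = a k ℚ.+ w ℚ.* ½^ k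

    0≤w½^ : ∀ k → 0ℚ ℚ.≤ w ℚ.* ½^ k
    0≤w½^ k = 0≤* 0≤w (ℚ.<⇒≤ (0<½^ k))

    ¬Sa : ∀ k → ¬ S (a k)
    ¬Sa zero = ¬Slo
    ¬Sa (suc k) with dec (S (mid k (a k)))
    ... | yes _  = ¬Sa k
    ... | no ¬Sm = ¬Sm

    half-step : ∀ k p → mid k p ℚ.+ w ℚ.* ½^ suc k ≡ p ℚ.+ w ℚ.* ½^ k
    half-step k p = solve 3 (λ p w h → p :+ w :* (con ½ :* h) :+ w :* (con ½ :* h) := p :+ w :* h) refl p w (½^ k)

    Sb : ∀ k → S (b k)
    Sb zero = subst (λ r → S (lo ℚ.+ r)) (sym (ℚ.*-identityʳ w)) Shi
    Sb (suc k) with dec (S (mid k (a k)))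
    ... | yes Sm = Sm
    ... | no  _  = subst S (sym (half-step k (a k))) (Sb k)

    a-step : ∀ k → a k ℚ.≤ a (suc k)
    a-step k with dec (S (mid k (a k)))
    ... | yes _ = ℚ.≤-refl
    ... | no  _ = slack-≤ _ (0≤w½^ (suc k)) refl

    b-step : ∀ k → b (suc k) ℚ.≤ b k
    b-step k with dec (S (mid k (a k)))
    ... | yes _ = slack-≤ _ (0≤w½^ (suc k)) (half-step k (a k))
    ... | no  _ = ℚ.≤-reflexive (half-step k (a k))

    a-mono : ∀ {k n} → k ℕ.≤′ n → a k ℚ.≤ a n
    a-mono (ℕ.≤′-reflexive refl) = ℚ.≤-refl
    a-mono {k} {suc n} (ℕ.≤′-step k≤n) = ℚ.≤-trans (a-mono k≤n) (a-step n)

    b-mono : ∀ {k n} → k ℕ.≤′ n → b n ℚ.≤ b k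
    b-mono (ℕ.≤′-reflexive refl) = ℚ.≤-refl
    b-mono {k} {suc n} (ℕ.≤′-step k≤n) = ℚ.≤-trans (b-step n) (b-mono k≤n)

    a≤b : ∀ k → a k ℚ.≤ b k
    a≤b k = slack-≤ _ (0≤w½^ k) refl

    -- Comparing with w + 1 makes the division legitimate also for w = 0.
    small : ∀ {ε} → 0ℚ ℚ.< ε → ∃ λ k → w ℚ.* ½^ k ℚ.< ε
    small {ε} 0<ε = proj₁ s , (begin-strict
        w ℚ.* ½^ proj₁ s            ≤⟨ slack-≤ (½^ proj₁ s) (ℚ.<⇒≤ (0<½^ (proj₁ s)))
                                         (solve 2 (λ w h → w :* h :+ h := (w :+ con 1ℚ) :* h) refl w (½^ proj₁ s)) ⟩
        (w ℚ.+ 1ℚ) ℚ.* ½^ proj₁ s   <⟨ ℚ.*-monoʳ-<-pos (w ℚ.+ 1ℚ) {{ℚ.positive 0<w+1}} (proj₂ s) ⟩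
        (w ℚ.+ 1ℚ) ℚ.* proj₁ d      ≡⟨ proj₂ (proj₂ d) ⟩
        ε                           ∎)
      where
      open ℚ.≤-Reasoning
      0<w+1 : 0ℚ ℚ.< w ℚ.+ 1ℚ
      0<w+1 = ℚ.+-mono-≤-< 0≤w 0<1

      d : ∃ λ δ → 0ℚ ℚ.< δ × (w ℚ.+ 1ℚ) ℚ.* δ ≡ ε
      d = divide 0<w+1 0<ε

      s : ∃ λ k → ½^ k ℚ.< proj₁ d
      s = ½^-small (proj₁ (proj₂ d))

    a-cauchy : IsCauchy a
    a-cauchy ε 0<ε = k , λ m n m≥ n≥ → ∣p∣<q (one m n m≥ n≥)
        (subst (ℚ._< ε) (solve 2 (λ p q → q :- p := :- (p :- q)) refl (a m) (a n)) (one n m n≥ m≥))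
      where
      k : ℕ
      k = proj₁ (small 0<ε)

      one : ∀ m n → k ℕ.≤ m → k ℕ.≤ n → a m ℚ.- a n ℚ.< ε
      one m n m≥ n≥ = slack-< ((a n ℚ.- a k) ℚ.+ ((b k ℚ.- a m) ℚ.+ (ε ℚ.- w ℚ.* ½^ k)))
        (ℚ.+-mono-≤-< (p≤q⇒0≤q-p (a-mono (ℕ.≤⇒≤′ n≥)))
          (ℚ.+-mono-≤-< (p≤q⇒0≤q-p (ℚ.≤-trans (a≤b m) (b-mono (ℕ.≤⇒≤′ m≥)))) (p<q⇒0<q-p (proj₂ (small 0<ε)))))
        (solve 5 (λ am an ak r e → am :- an :+ ((an :- ak) :+ ((ak :+ r :- am) :+ (e :- r))) := e) refl (a m) (a n) (a k) (w ℚ.* ½^ k) ε)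

    limit : ℝ
    limit = mkℝ a a-cauchy

    a≤limit : ∀ k → fromℚ (a k) ≤ᴿ limit
    a≤limit k = ev≤ (k , λ n n≥ → a-mono (ℕ.≤⇒≤′ n≥))

    limit≤b : ∀ k → limit ≤ᴿ fromℚ (b k)
    limit≤b k = ev≤ (k , λ n n≥ → ℚ.≤-trans (a≤b n) (b-mono (ℕ.≤⇒≤′ n≥)))

    b≤hi : ∀ k → b k ℚ.≤ lo ℚ.+ w
    b≤hi k = subst (λ r → b k ℚ.≤ lo ℚ.+ r) (ℚ.*-identityʳ w) (b-mono {0} {k} ℕ.z≤′n)

    b≤a+ε : ∀ k {ε} → w ℚ.* ½^ k ℚ.< ε → b k ℚ.≤ a k ℚ.+ ε
    b≤a+ε k {ε} h = ℚ.+-monoʳ-≤ (a k) {w ℚ.* ½^ k} {ε} (ℚ.<⇒≤ h)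

    squeeze-at : ∀ k {ε} → w ℚ.* ½^ k ℚ.< ε → Squeeze S lo w limit ε
    squeeze-at k h = record
      { left = a k ; right = b k ; left∉ = ¬Sa k ; right∈ = Sb k
      ; lo≤left = a-mono {0} {k} ℕ.z≤′n
      ; left≤right = a≤b k
      ; right≤hi = b≤hi k
      ; right≤left+ε = b≤a+ε k h
      ; left≤limit = a≤limit k ; limit≤right = limit≤b k
      }

    abstract
      squeeze : ∀ {ε} → 0ℚ ℚ.< ε → Squeeze S lo w limit ε
      squeeze 0<ε = squeeze-at (proj₁ (small 0<ε)) (proj₂ (small 0<ε))

  module Infimum {ℓ} (S : ℚ → Set ℓ) (S-up : ∀ {p q} → p ℚ.≤ q → S p → S q)
                 (S≥0 : ∀ {q} → S q → 0ℚ ℚ.≤ q) (S1 : S 1ℚ) where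
    private
      -1ℚ : ℚ
      -1ℚ = ℚ.- 1ℚ

      ¬S-1 : ¬ S -1ℚ
      ¬S-1 s = ℚ.<⇒≢ 0<1 (ℚ.≤-antisym (ℚ.<⇒≤ 0<1) (ℚ.neg-antimono-≤ (S≥0 s)))

      -- The search starts at -1 because S may hold at 0, whereas nonnegativity of its members
      -- excludes -1; the width 2 reaches the known member 1.
      module B = Bisection S -1ℚ (1ℚ ℚ.+ 1ℚ) (0≤+ (ℚ.<⇒≤ 0<1) (ℚ.<⇒≤ 0<1)) ¬S-1 S1

    abstract
      inf : ℝ
      inf = B.limit

      inf-lower : ∀ {q} → S q → inf ≤ᴿ fromℚ q
      inf-lower {q} Sq = ≮⇒≥ λ q<inf → contra (<⇒gap q<inf)
        where
        contra : ¬ ∃ λ g → 0ℚ ℚ.< g × fromℚ q +ᴿ fromℚ g ≤ᴿ inf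
        contra (g , 0<g , h) = left∉ (S-up q≤left Sq)
          where
          open Squeeze (B.squeeze 0<g)
          q+g≤left+g : q ℚ.+ g ℚ.≤ left ℚ.+ g
          q+g≤left+g = ℚ.≤-trans (fromℚ-cancel-≤ (≤-trans (≈⇒≤ (≈-sym (fromℚ-+ q g))) (≤-trans h limit≤right))) right≤left+ε

          q≤left : q ℚ.≤ left
          q≤left = slack-≤ (left ℚ.+ g ℚ.- (q ℚ.+ g)) (p≤q⇒0≤q-p q+g≤left+g)
            (solve 3 (λ q l g → q :+ (l :+ g :- (q :+ g)) := l) refl q left g)

      inf-greatest : ∀ {q} → inf <ᴿ fromℚ q → S q
      inf-greatest {q} inf<q = S-up (ℚ.≤-trans right≤left+ε left+g≤q) right∈
        where
        g : ∃ λ g → 0ℚ ℚ.< g × inf +ᴿ fromℚ g ≤ᴿ fromℚ q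
        g = <⇒gap inf<q

        open Squeeze (B.squeeze (proj₁ (proj₂ g)))
        left+g≤q : left ℚ.+ proj₁ g ℚ.≤ q
        left+g≤q = fromℚ-cancel-≤ (≤-trans (≈⇒≤ (≈-sym (fromℚ-+ left (proj₁ g))))
          (≤-trans (+ᴿ-mono-≤ left≤limit (≤-refl {fromℚ (proj₁ g)})) (proj₂ (proj₂ g))))

  ℝ-orderedField : OrderedField
  ℝ-orderedField = record
    { Carrier = ℝ ; _≈_ = _≈_ ; _≤_ = _≤ᴿ_ ; _+_ = _+ᴿ_ ; _*_ = _*ᴿ_ ; -_ = -ᴿ_ ; ∣_∣ = ∣_∣ᴿ ; embed = fromℚ
    ; isCommutativeRing = CommutativeRing.isCommutativeRing ℝ-commutativeRing
    ; embed-+ = λ p q → pt≈ λ n → refl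
    ; embed-* = λ p q → pt≈ λ n → refl
    ; embed-- = λ p → pt≈ λ n → sym (ℚ.+-identityˡ (ℚ.- p))
    ; _≈?_ = λ x y → dec (x ≈ y)
    ; ≤-isPreorder = ≤-isPreorder
    ; ≤-antisym = ≤-antisym
    ; ≤-total = ≤-total
    ; +-mono-≤ = +ᴿ-mono-≤
    ; 0≤* = 0≤*ᴿ
    ; 1≉0 = λ 1≈0 → <⇒≱ 0ᴿ<1ᴿ (≈⇒≤ 1≈0)
    ; reciprocal = reciprocal
    ; x≤∣x∣ = x≤∣x∣
    ; -x≤∣x∣ = -x≤∣x∣
    ; ∣x∣≤y = ∣x∣≤y
    ; ∣x*y∣≈∣x∣*∣y∣ = ∣x*y∣≈∣x∣*∣y∣
    }

  module ℝ′ = OrderedFieldProperties ℝ-orderedField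
  module Lin = LinearAlgebra ℝ-orderedField
  module Arr = Arrangements ℝ-orderedField
  module Cnt = Counting ℝ-orderedField

  -- Unit boxes that a fan misses

  module _ {d k m} (H : Fin m → Hyperplane d)
           (distinct : ∀ i j → i ≢ j → ¬ Hyperplane.points (H i) ≐ Hyperplane.points (H j))
           (axis : Flat d k) (axis⊆ : ∀ i → Flat.points axis ⊆ Hyperplane.points (H i)) where

    toArrangement : Arr.Arrangement d k m
    toArrangement = record
      { normal = λ i → Hyperplane.normal (H i)
      ; offset = λ i → Hyperplane.offset (H i)
      ; normal≉0 = λ i → Hyperplane.normal≉0 (H i)
      ; distinct = λ i j i≢j same → distinct i j i≢j ((λ {x} → proj₁ (same x)) , (λ {x} → proj₂ (same x)))
      ; base = Flat.base axis
      ; directions = Flat.directions axis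
      ; independent = Flat.linearlyIndependent axis
      ; axis⊆ = λ i t → axis⊆ i (t , λ j → ≈-refl)
      }

  UnitBox : ∀ {d n} → (Fin d → Fin n) → Pred (Space d) 0ℓ
  UnitBox c x = ∀ j → Cnt.InUnit (toℕ (c j)) (x j)

  Misses : ∀ {d m n} → (Fin m → Hyperplane d) → (Fin d → Fin n) → Set
  Misses H c = ∀ i x → x ∈ UnitBox c → ¬ x ∈ Hyperplane.points (H i)

  module _ (k m N : ℕ) {i₁ i₂ : Fin m} (i₁≢i₂ : i₁ ≢ i₂) where
    stabbed : ∀ n′ (F : Fan (suc (suc k)) m) (c : Fin N → Fin (suc (suc k)) → Fin (suc n′)) →
      (∀ a → ∃ λ i → ∃ λ x → x ∈ UnitBox (c a) × x ∈ Hyperplane.points (Fan.hyperplane F i)) → Cnt.Stabbed k m N n′ i₁≢i₂ c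
    stabbed n′ F c hit = record
      { arrangement = toArrangement (Fan.hyperplane F) (Fan.distinct F) (Fan.axis F) (Fan.axis⊆ F)
      ; index = λ a → proj₁ (hit a)
      ; point = λ a → proj₁ (proj₂ (hit a))
      ; in-box = λ a → proj₁ (proj₂ (proj₂ (hit a)))
      ; on = λ a → proj₂ (proj₂ (proj₂ (hit a)))
      }

    -- The placement is fixed before the fan: a fan meeting every one of its boxes would make it
    -- `Stabbed`.
    unstabbed-boxes : suc (suc k ℕ.+ suc k ℕ.+ m) ℕ.≤ N →
      ∃ λ n′ → Σ (Fin N → Fin (suc (suc k)) → Fin (suc n′)) λ c → ∀ (F : Fan (suc (suc k)) m) → ∃ λ a → Misses (Fan.hyperplane F) (c a)
    unstabbed-boxes K<N = n′ , c , λ F → ¬¬-elim λ none → proj₂ some (stabbed n′ F c λ a → ¬¬-elim λ ¬hit →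
        none (a , λ i x x∈box x∈H → ¬hit (i , x , x∈box , x∈H)))
      where
      n′ : ℕ
      n′ = proj₁ (Cnt.not-all-stabbed k m N i₁≢i₂ K<N)

      some : ∃ λ c → ¬ Cnt.Stabbed k m N n′ i₁≢i₂ c
      some = ¬∀⇒∃¬ (proj₂ (Cnt.not-all-stabbed k m N i₁≢i₂ K<N))

      c : Fin N → Fin (suc (suc k)) → Fin (suc n′)
      c = proj₁ some

  -- Components of the complement of a fan

  nat≈fromℕ : ∀ n → ℝ′.nat n ≈ fromℚ (fromℕ n)
  nat≈fromℕ zero    = ≈-refl
  nat≈fromℕ (suc n) = ≈-trans (+ᴿ-cong (≈-refl {1ᴿ}) (nat≈fromℕ n)) (fromℚ-+ 1ℚ (fromℕ n))

  rational-below : ∀ {x} → 0ᴿ <ᴿ x → ∃ λ q → 0ℚ ℚ.< q × fromℚ q ≤ᴿ x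
  rational-below {x} 0<x = proj₁ g , proj₁ (proj₂ g) ,
    ≤-trans (pt≤ {fromℚ (proj₁ g)} {0ᴿ +ᴿ fromℚ (proj₁ g)} λ n → ℚ.≤-reflexive (sym (ℚ.+-identityˡ (proj₁ g)))) (proj₂ (proj₂ g))
    where
    g : ∃ λ g → 0ℚ ℚ.< g × 0ᴿ +ᴿ fromℚ g ≤ᴿ x
    g = <⇒gap 0<x

  -- Within is stated with the subtraction of Defs, which differs from that of
  -- the ring, x + (0 - y), by a pointwise identity only.
  within⇒∣∣≤ : ∀ {ε x y} → Within ε x y → ∣ y +ᴿ -ᴿ x ∣ᴿ ≤ᴿ ε
  within⇒∣∣≤ {ε} {x} {y} (x-ε<y , y<x+ε) = ∣x∣≤y {y +ᴿ -ᴿ x} {ε}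
    (slack (x +ᴿ ε -ᴿ y) (x≤y⇒0≤y-x (<⇒≤ y<x+ε))
      (pt≈ λ n → solve 3 (λ e x y → (y :+ (con 0ℚ :- x)) :+ (x :+ e :- y) := e) refl (approx ε n) (approx x n) (approx y n)))
    (slack (y -ᴿ (x -ᴿ ε)) (x≤y⇒0≤y-x (<⇒≤ x-ε<y))
      (pt≈ λ n → solve 3 (λ e x y → (con 0ℚ :- (y :+ (con 0ℚ :- x))) :+ (y :- (x :- e)) := e) refl (approx ε n) (approx x n) (approx y n)))

  -- `Within` is strict, so half of e is spent on the distance and the other half is the gap that
  -- `<ᴿ` asks for.
  ∣∣≤⇒within : ∀ {e ε x y} → 0ℚ ℚ.< e → fromℚ e ≤ᴿ ε → ∣ y +ᴿ -ᴿ x ∣ᴿ ≤ᴿ fromℚ (e ℚ.* ½) → Within ε x y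
  ∣∣≤⇒within {e} {ε} {x} {y} 0<e e≤ε h =
    gap⇒< (half 0<e) (slack ((fromℚ (e ℚ.* ½) -ᴿ -ᴿ (y +ᴿ -ᴿ x)) +ᴿ (ε -ᴿ fromℚ e))
      (0≤+ᴿ (x≤y⇒0≤y-x (≤-trans (-x≤∣x∣ (y +ᴿ -ᴿ x)) h)) (x≤y⇒0≤y-x e≤ε))
      (pt≈ λ n → solve 4 (λ e ε x y → x :- ε :+ e :* con ½ :+ ((e :* con ½ :- (con 0ℚ :- (y :+ (con 0ℚ :- x)))) :+ (ε :- e)) := y)
        refl e (approx ε n) (approx x n) (approx y n))) ,
    gap⇒< (half 0<e) (slack ((fromℚ (e ℚ.* ½) -ᴿ (y +ᴿ -ᴿ x)) +ᴿ (ε -ᴿ fromℚ e))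
      (0≤+ᴿ (x≤y⇒0≤y-x (≤-trans (x≤∣x∣ (y +ᴿ -ᴿ x)) h)) (x≤y⇒0≤y-x e≤ε))
      (pt≈ λ n → solve 4 (λ e ε x y → y :+ e :* con ½ :+ ((e :* con ½ :- (y :+ (con 0ℚ :- x))) :+ (ε :- e)) := x :+ ε)
        refl e (approx ε n) (approx x n) (approx y n)))

  -- Openness at a point in terms of closed balls of rational radius, which fit the estimates with
  -- `∣_∣ᴿ`.
  record Neighbourhood {d} (A : Pred (Space d) 0ℓ) (x : Space d) : Set where
    field
      radius   : ℚ
      radius>0 : 0ℚ ℚ.< radius
      near     : ∀ y → (∀ j → ∣ y j +ᴿ -ᴿ x j ∣ᴿ ≤ᴿ fromℚ radius) → y ∈ A

  open Neighbourhood

  neighbourhood : ∀ {d} {A : Pred (Space d) 0ℓ} → IsOpen A → ∀ {x} → x ∈ A → Neighbourhood A x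
  neighbourhood {A = A} open-A {x} x∈A = record
    { radius = proj₁ q ℚ.* ½
    ; radius>0 = half (proj₁ (proj₂ q))
    ; near = λ y y≈x → proj₂ (proj₂ o) y λ j → ∣∣≤⇒within (proj₁ (proj₂ q)) (proj₂ (proj₂ q)) (y≈x j)
    }
    where
    o : ∃ λ ε → 0ᴿ <ᴿ ε × (∀ y → (∀ i → Within ε (x i) (y i)) → y ∈ A)
    o = open-A x x∈A

    q : ∃ λ q → 0ℚ ℚ.< q × fromℚ q ≤ᴿ proj₁ o
    q = rational-below (proj₁ (proj₂ o))

  neighbourhoods⇒open : ∀ {d} {A : Pred (Space d) 0ℓ} → (∀ {x} → x ∈ A → Neighbourhood A x) → IsOpen A
  neighbourhoods⇒open nb x x∈A = fromℚ (radius (nb x∈A)) , fromℚ-mono-< (radius>0 (nb x∈A)) ,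
    λ y w → near (nb x∈A) y (λ j → within⇒∣∣≤ (w j))

  open-resp : ∀ {d} {A : Pred (Space d) 0ℓ} → IsOpen A → ∀ {x y} → (∀ j → x j ≈ y j) → x ∈ A → y ∈ A
  open-resp open-A {x} {y} x≈y x∈A = near n y λ j → ≤-trans
    (≈⇒≤ (∣∣-cong {y j +ᴿ -ᴿ x j} {0ᴿ} (≈-trans (+ᴿ-cong (≈-sym (x≈y j)) (≈-refl { -ᴿ x j})) (pt≈ {x j +ᴿ -ᴿ x j} {0ᴿ} λ n → solve 1 (λ x → x :+ (con 0ℚ :- x) := con 0ℚ) refl (approx (x j) n)))))
    (∣x∣≤y {0ᴿ} {fromℚ (radius n)} 0≤r (≤-trans (pt≤ { -ᴿ 0ᴿ} {0ᴿ} λ _ → ℚ.≤-refl) 0≤r))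
    where
    n : Neighbourhood _ x
    n = neighbourhood open-A x∈A

    0≤r : 0ᴿ ≤ᴿ fromℚ (radius n)
    0≤r = fromℚ-mono-≤ (ℚ.<⇒≤ (radius>0 n))

  ⋂-open : ∀ {d} m (A : Fin m → Pred (Space d) 0ℓ) → (∀ i → IsOpen (A i)) → IsOpen (λ x → ∀ i → x ∈ A i)
  ⋂-open zero    A op = neighbourhoods⇒open λ x∈A → record { radius = 1ℚ ; radius>0 = 0<1 ; near = λ _ _ () }
  ⋂-open (suc m) A op = neighbourhoods⇒open λ {x} x∈A → meet (neighbourhood (op Fin.zero) (x∈A Fin.zero))
      (neighbourhood (⋂-open m (A ∘ Fin.suc) (op ∘ Fin.suc)) (x∈A ∘ Fin.suc))
    where
    meet : ∀ {x} → Neighbourhood (A Fin.zero) x → Neighbourhood (λ x → ∀ i → x ∈ A (Fin.suc i)) x → Neighbourhood (λ x → ∀ i → x ∈ A i) x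
    meet n n′ = record
      { radius = radius n ℚ.⊓ radius n′
      ; radius>0 = [ (λ eq → subst (0ℚ ℚ.<_) (sym eq) (radius>0 n)) , (λ eq → subst (0ℚ ℚ.<_) (sym eq) (radius>0 n′)) ]′ (ℚ.⊓-sel (radius n) (radius n′))
      ; near = λ y y≈x → λ
          { Fin.zero    → near n y (λ j → ≤-trans (y≈x j) (fromℚ-mono-≤ (ℚ.p⊓q≤p (radius n) (radius n′))))
          ; (Fin.suc i) → near n′ y (λ j → ≤-trans (y≈x j) (fromℚ-mono-≤ (ℚ.p⊓q≤q (radius n) (radius n′)))) i }
      }

  uniform-bound : ∀ {d} (u : Space d) → ∃ λ B → 0ℚ ℚ.< B × (∀ j → ∣ u j ∣ᴿ ≤ᴿ fromℚ B)
  uniform-bound {zero}  u = 1ℚ , 0<1 , λ ()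
  uniform-bound {suc d} u = B₀ ℚ.+ B₁ , 0<+ 0<B₀ (ℚ.<⇒≤ 0<B₁) , λ
      { Fin.zero    → ≤-trans u₀≤ (fromℚ-mono-≤ (slack-≤ B₁ (ℚ.<⇒≤ 0<B₁) refl))
      ; (Fin.suc j) → ≤-trans (u≤ j) (fromℚ-mono-≤ (slack-≤ B₀ (ℚ.<⇒≤ 0<B₀) (ℚ.+-comm B₁ B₀))) }
    where
    B₀ B₁ : ℚ
    B₀ = proj₁ (upper-bound ∣ u Fin.zero ∣ᴿ)
    B₁ = proj₁ (uniform-bound (u ∘ Fin.suc))

    0<B₀ : 0ℚ ℚ.< B₀
    0<B₀ = proj₁ (proj₂ (upper-bound ∣ u Fin.zero ∣ᴿ))

    0<B₁ : 0ℚ ℚ.< B₁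
    0<B₁ = proj₁ (proj₂ (uniform-bound (u ∘ Fin.suc)))

    u₀≤ : ∣ u Fin.zero ∣ᴿ ≤ᴿ fromℚ B₀
    u₀≤ = proj₂ (proj₂ (upper-bound ∣ u Fin.zero ∣ᴿ))

    u≤ : ∀ j → ∣ u (Fin.suc j) ∣ᴿ ≤ᴿ fromℚ B₁
    u≤ = proj₂ (proj₂ (uniform-bound (u ∘ Fin.suc)))

  Positive : ∀ {d} → Space d → ℝ → Pred (Space d) 0ℓ
  Positive w c x = 0ᴿ <ᴿ w · x +ᴿ c

  positive-open : ∀ {d} (w : Space d) c → IsOpen (Positive w c)
  positive-open {d} w c = neighbourhoods⇒open λ {x} 0<gx → nb x (rational-below 0<gx)
    where
    W : ℚ
    W = proj₁ (uniform-bound w)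

    0<W : 0ℚ ℚ.< W
    0<W = proj₁ (proj₂ (uniform-bound w))

    nb : ∀ x → (∃ λ q → 0ℚ ℚ.< q × fromℚ q ≤ᴿ w · x +ᴿ c) → Neighbourhood (Positive w c) x
    nb x (q , 0<q , q≤gx) = record { radius = e ; radius>0 = 0<e ; near = near′ }
      where
      K : ℚ
      -- The affine form moves by at most d W e when the coordinates move by e; `suc d` keeps the
      -- divisor positive in dimension 0 as well.
      K = fromℕ (suc d) ℚ.* W

      e : ℚ
      e = proj₁ (divide (0<* (0<fromℕ d) 0<W) (half 0<q))

      0<e : 0ℚ ℚ.< e
      0<e = proj₁ (proj₂ (divide (0<* (0<fromℕ d) 0<W) (half 0<q)))

      Ke≡ : K ℚ.* e ≡ q ℚ.* ½
      Ke≡ = proj₂ (proj₂ (divide (0<* (0<fromℕ d) 0<W) (half 0<q)))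

      dWe≤ : fromℕ d ℚ.* (W ℚ.* e) ℚ.≤ q ℚ.* ½
      dWe≤ = subst (fromℕ d ℚ.* (W ℚ.* e) ℚ.≤_) Ke≡ (slack-≤ (W ℚ.* e) (ℚ.<⇒≤ (0<* 0<W 0<e))
        (solve 3 (λ d W e → d :* (W :* e) :+ W :* e := (con 1ℚ :+ d) :* W :* e) refl (fromℕ d) W e))

      near′ : ∀ y → (∀ j → ∣ y j +ᴿ -ᴿ x j ∣ᴿ ≤ᴿ fromℚ e) → Positive w c y
      near′ y y≈x = gap⇒< (half 0<q) (slack ((fromℚ (q ℚ.* ½) -ᴿ -ᴿ (w · y +ᴿ -ᴿ (w · x))) +ᴿ (w · x +ᴿ c -ᴿ fromℚ q))
        (0≤+ᴿ (x≤y⇒0≤y-x (≤-trans (-x≤∣x∣ (w · y +ᴿ -ᴿ (w · x))) change)) (x≤y⇒0≤y-x q≤gx))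
        (pt≈ λ n → solve 4 (λ q a b c → con 0ℚ :+ q :* con ½ :+ ((q :* con ½ :- (con 0ℚ :- (b :+ (con 0ℚ :- a)))) :+ (a :+ c :- q)) := b :+ c)
          refl q (approx (w · x) n) (approx (w · y) n) (approx c n)))
        where
        change : ∣ w · y +ᴿ -ᴿ (w · x) ∣ᴿ ≤ᴿ fromℚ (q ℚ.* ½)
        change = ≤-trans (Lin.·-close w x y (fromℚ W) (fromℚ e) (proj₂ (proj₂ (uniform-bound w))) y≈x)
          (≤-trans (≈⇒≤ (*ᴿ-cong (nat≈fromℕ d) (≈-refl {fromℚ W *ᴿ fromℚ e}))) (pt≤ λ n → dWe≤))

  segment : ∀ {d} → Space d → Space d → ℝ → Space d
  segment x y t j = ℝ′.lerp (x j) (y j) t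

  Convex : ∀ {d} → Pred (Space d) 0ℓ → Set
  Convex C = ∀ {x y} → x ∈ C → y ∈ C → ∀ {t} → 0ᴿ ≤ᴿ t → t ≤ᴿ 1ᴿ → segment x y t ∈ C

  -- On a segment an affine function is at least the smaller of its two end values.
  positive-convex : ∀ {d} (w : Space d) c → Convex (Positive w c)
  positive-convex w c {x} {y} 0<gx 0<gy {t} 0≤t t≤1 = [ below 0<gx (≤-refl {gx}) , (λ gy≤gx → below 0<gy gy≤gx (≤-refl {gy})) ]′ (≤-total gx gy)
    where
    gx gy : ℝ
    gx = w · x +ᴿ c
    gy = w · y +ᴿ c

    expand : w · segment x y t +ᴿ c ≈ ℝ′.lerp gx gy t
    expand = ≈-trans (+ᴿ-cong (Lin.·-lerp w x y t) (≈-refl {c}))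
      (pt≈ λ n → solve 4 (λ a b c t → a :+ t :* (b :+ (con 0ℚ :- a)) :+ c := a :+ c :+ t :* (b :+ c :+ (con 0ℚ :- (a :+ c))))
        refl (approx (w · x) n) (approx (w · y) n) (approx c n) (approx t n))

    below : ∀ {l} → 0ᴿ <ᴿ l → l ≤ᴿ gx → l ≤ᴿ gy → Positive w c (segment x y t)
    below {l} 0<l l≤gx l≤gy = <-≤-trans 0<l (≤-trans (ℝ′.lerp-≥ {l} {gx} {gy} {t} l≤gx l≤gy 0≤t t≤1) (≈⇒≤ (≈-sym expand)))

  -- Bisect the segment from x to y for membership in W; the limit point lies in V or in W. In V, a
  -- nearby right end lies in both sets. In W, a nearby left end would lie in W, against its choice.
  convex⇒connected : ∀ {d} {C : Pred (Space d) 0ℓ} → Convex C → IsConnected C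
  convex⇒connected {d} {C} convex V W open-V open-W C⊆V∪W (x , x∈C , x∈V) (y , y∈C , y∈W) with dec (segment x y (fromℚ 0ℚ) ∈ W)
  ... | yes S0 = x , x∈C , x∈V , open-resp open-W (λ j → ℝ′.lerp-0 (x j) (y j)) S0
  ... | no ¬S0 = split (C⊆V∪W limit∈C)
    where
    S : ℚ → Set
    S t = segment x y (fromℚ t) ∈ W

    module B = Bisection S 0ℚ 1ℚ (ℚ.<⇒≤ 0<1) ¬S0 (open-resp open-W (λ j → ≈-sym (ℝ′.lerp-1 (x j) (y j))) y∈W)

    z : ℝ → Space d
    z = segment x y

    z∈C : ∀ {t} → 0ℚ ℚ.≤ t → t ℚ.≤ 1ℚ → z (fromℚ t) ∈ C
    z∈C 0≤t t≤1 = convex x∈C y∈C (fromℚ-mono-≤ 0≤t) (fromℚ-mono-≤ t≤1)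

    limit∈C : z B.limit ∈ C
    limit∈C = convex x∈C y∈C (≤-trans (fromℚ-mono-≤ lo≤left) left≤limit) (≤-trans limit≤right (fromℚ-mono-≤ right≤hi))
      where open Squeeze (B.squeeze 0<1)

    u : Space d
    u j = y j +ᴿ -ᴿ x j

    bound : ℚ
    bound = proj₁ (uniform-bound u)

    0<bound : 0ℚ ℚ.< bound
    0<bound = proj₁ (proj₂ (uniform-bound u))

    module _ {A} (n : Neighbourhood A (z B.limit)) where
      δ : ∃ λ δ → 0ℚ ℚ.< δ × bound ℚ.* δ ≡ radius n
      δ = divide 0<bound (radius>0 n)

      sq : Squeeze S 0ℚ 1ℚ B.limit (proj₁ δ)
      sq = B.squeeze (proj₁ (proj₂ δ))

      open Squeeze sq public

      close : ∀ t → ∣ fromℚ t +ᴿ -ᴿ B.limit ∣ᴿ ≤ᴿ fromℚ (proj₁ δ) → z (fromℚ t) ∈ A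
      close t t≈ = near n (z (fromℚ t)) λ j → ≤-trans
        (ℝ′.lerp-close {x j} {y j} {B.limit} {fromℚ t} {fromℚ (proj₁ δ)} {fromℚ bound} t≈ (proj₂ (proj₂ (uniform-bound u)) j))
        (pt≤ λ _ → ℚ.≤-reflexive (trans (ℚ.*-comm (proj₁ δ) bound) (proj₂ (proj₂ δ))))

      bracket : ∀ {l r t : ℝ} {e} → l ≤ᴿ t → t ≤ᴿ r → l ≤ᴿ B.limit → B.limit ≤ᴿ r → r ≤ᴿ l +ᴿ e → ∣ t +ᴿ -ᴿ B.limit ∣ᴿ ≤ᴿ e
      bracket {l} {r} {t} {e} l≤t t≤r l≤τ τ≤r r≤l+e = ∣x∣≤y {t +ᴿ -ᴿ B.limit} {e}
        (slack ((r -ᴿ t) +ᴿ ((B.limit -ᴿ l) +ᴿ (l +ᴿ e -ᴿ r))) (0≤+ᴿ (x≤y⇒0≤y-x t≤r) (0≤+ᴿ (x≤y⇒0≤y-x l≤τ) (x≤y⇒0≤y-x r≤l+e)))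
          (pt≈ λ n → solve 5 (λ l r t e τ → t :+ (con 0ℚ :- τ) :+ ((r :- t) :+ ((τ :- l) :+ (l :+ e :- r))) := e) refl
            (approx l n) (approx r n) (approx t n) (approx e n) (approx B.limit n)))
        (slack ((t -ᴿ l) +ᴿ ((r -ᴿ B.limit) +ᴿ (l +ᴿ e -ᴿ r))) (0≤+ᴿ (x≤y⇒0≤y-x l≤t) (0≤+ᴿ (x≤y⇒0≤y-x τ≤r) (x≤y⇒0≤y-x r≤l+e)))
          (pt≈ λ n → solve 5 (λ l r t e τ → (con 0ℚ :- (t :+ (con 0ℚ :- τ))) :+ ((t :- l) :+ ((r :- τ) :+ (l :+ e :- r))) := e) refl
            (approx l n) (approx r n) (approx t n) (approx e n) (approx B.limit n)))

      r≤l+δ : fromℚ right ≤ᴿ fromℚ left +ᴿ fromℚ (proj₁ δ)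
      r≤l+δ = pt≤ λ _ → right≤left+ε

      left∈A : z (fromℚ left) ∈ A
      left∈A = close left (bracket {fromℚ left} {fromℚ right} {fromℚ left} {fromℚ (proj₁ δ)} (≤-refl {fromℚ left}) (fromℚ-mono-≤ left≤right) left≤limit limit≤right r≤l+δ)

      right∈A : z (fromℚ right) ∈ A
      right∈A = close right (bracket {fromℚ left} {fromℚ right} {fromℚ right} {fromℚ (proj₁ δ)} (fromℚ-mono-≤ left≤right) (≤-refl {fromℚ right}) left≤limit limit≤right r≤l+δ)

    split : z B.limit ∈ V ∪ W → Satisfiable (C ∩ (V ∩ W))
    split (inj₁ ∈V) = z (fromℚ (right n)) , z∈C (ℚ.≤-trans (lo≤left n) (left≤right n)) (right≤hi n) , right∈A n , right∈ n
      where n = neighbourhood open-V ∈V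
    split (inj₂ ∈W) = ⊥-elim (left∉ n (left∈A n))
      where n = neighbourhood open-W ∈W

  module SignCell {d m} (H : Fin m → Hyperplane d) (b : Space d)
                  (off : ∀ i → ¬ b ∈ Hyperplane.points (H i)) where
    private
      n : Fin m → Space d
      n i = Hyperplane.normal (H i)

      o : Fin m → ℝ
      o i = Hyperplane.offset (H i)

      level : Fin m → Space d → ℝ
      level i x = n i · x +ᴿ -ᴿ o i

    w : Fin m → Space d
    w i j = level i b *ᴿ n i j

    c : Fin m → ℝ
    c i = level i b *ᴿ -ᴿ o i

    -- w i · x + c i is the product of the levels of b and x, which is positive
    -- when both lie on the same side of the i-th hyperplane.
    Cell : Pred (Space d) 0ℓ
    Cell x = ∀ i → x ∈ Positive (w i) (c i)

    Opposite : Pred (Space d) 0ℓ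
    Opposite x = ∃ λ i → x ∈ Positive (λ j → -ᴿ 1ᴿ *ᴿ w i j) (-ᴿ c i)

    level-product : ∀ i x → w i · x +ᴿ c i ≈ level i b *ᴿ level i x
    level-product i x = ≈-trans (+ᴿ-cong (Lin.·-*ˡ (level i b) (n i) x) (≈-refl {c i}))
      (pt≈ λ k → solve 3 (λ l a e → l :* a :+ l :* (con 0ℚ :- e) := l :* (a :+ (con 0ℚ :- e))) refl
        (approx (level i b) k) (approx (n i · x) k) (approx (o i) k))

    opposite : ∀ i x → (λ j → -ᴿ 1ᴿ *ᴿ w i j) · x +ᴿ -ᴿ c i ≈ -ᴿ (w i · x +ᴿ c i)
    opposite i x = ≈-trans (+ᴿ-cong (Lin.·-*ˡ (-ᴿ 1ᴿ) (w i) x) (≈-refl { -ᴿ c i}))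
      (pt≈ λ k → solve 2 (λ a c → (con 0ℚ :- con 1ℚ) :* a :+ (con 0ℚ :- c) := con 0ℚ :- (a :+ c)) refl
        (approx (w i · x) k) (approx (c i) k))

    level≉0 : ∀ i x → ¬ x ∈ Hyperplane.points (H i) → ¬ level i x ≈ 0ᴿ
    level≉0 i x ∉H level≈0 = ∉H (ℝ′.x-y≈0⇒x≈y {n i · x} {o i} level≈0)

    b∈Cell : b ∈ Cell
    b∈Cell i = <-≤-trans (≤∧≉⇒< (ℝ′.0≤x*x (level i b)) λ 0≈ → level≉0 i b (off i) (ℝ′.x*x≈0⇒x≈0 {level i b} (≈-sym 0≈)))
      (≈⇒≤ (≈-sym (level-product i b)))

    cell-open : IsOpen Cell
    cell-open = ⋂-open m (λ i → Positive (w i) (c i)) (λ i → positive-open (w i) (c i))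

    opposite-open : IsOpen Opposite
    opposite-open x (i , p) = proj₁ nb , proj₁ (proj₂ nb) , λ y close → i , proj₂ (proj₂ nb) y close
      where
      nb : ∃ λ ε → 0ᴿ <ᴿ ε × (∀ y → (∀ i → Within ε (x i) (y i)) → y ∈ Positive (λ j → -ᴿ 1ᴿ *ᴿ w i j) (-ᴿ c i))
      nb = positive-open (λ j → -ᴿ 1ᴿ *ᴿ w i j) (-ᴿ c i) x p

    disjoint : ∀ {x} → x ∈ Cell → ¬ x ∈ Opposite
    disjoint {x} ∈C (i , p) = <⇒≱ (<-≤-trans p (≈⇒≤ (opposite i x)))
      (≤-trans (neg-mono-≤ (<⇒≤ (∈C i))) (pt≤ { -ᴿ 0ᴿ} {0ᴿ} λ _ → ℚ.≤-refl))

    Complement : Pred (Space d) 0ℓ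
    Complement = ∁ (⋃ (Fin m) (λ i → Hyperplane.points (H i)))

    neg≈0 : ∀ x → -ᴿ x ≈ 0ᴿ → x ≈ 0ᴿ
    neg≈0 x eq = ≈-trans (pt≈ {x} { -ᴿ -ᴿ x} λ k → solve 1 (λ g → g := con 0ℚ :- (con 0ℚ :- g)) refl (approx x k))
      (≈-trans (neg-cong eq) (pt≈ { -ᴿ 0ᴿ} {0ᴿ} λ _ → refl))

    0<neg : ∀ x → x ≤ᴿ 0ᴿ → ¬ x ≈ 0ᴿ → 0ᴿ <ᴿ -ᴿ x
    0<neg x x≤0 x≉0 = ≤∧≉⇒< (≤-trans (pt≤ {0ᴿ} { -ᴿ 0ᴿ} λ _ → ℚ.≤-refl) (neg-mono-≤ x≤0))
      (λ 0≈-x → x≉0 (neg≈0 x (≈-sym 0≈-x)))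

    other-side : ∀ i x → ¬ x ∈ Hyperplane.points (H i) → ¬ x ∈ Positive (w i) (c i) →
                 x ∈ Positive (λ j → -ᴿ 1ᴿ *ᴿ w i j) (-ᴿ c i)
    other-side i x ∉H ≯0 = <-≤-trans (0<neg (w i · x +ᴿ c i) (≮⇒≥ ≯0) ≉0) (≈⇒≤ (≈-sym (opposite i x)))
      where
      ≉0 : ¬ w i · x +ᴿ c i ≈ 0ᴿ
      ≉0 ≈0 = level≉0 i x ∉H (ℝ′.*-zero-cancelˡ {level i b} {level i x} (level≉0 i b (off i))
        (≈-trans (≈-sym (level-product i x)) ≈0))

    covered : Complement ⊆ Cell ∪ Opposite
    covered {x} ∉H = decide (dec (x ∈ Cell))
      where
      decide : Dec (x ∈ Cell) → x ∈ Cell ∪ Opposite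
      decide (yes ∈C) = inj₁ ∈C
      decide (no ∉C)  = inj₂ (proj₁ bad , other-side (proj₁ bad) x (λ ∈H → ∉H (proj₁ bad , ∈H)) (proj₂ bad))
        where
        bad : ∃ λ i → ¬ x ∈ Positive (w i) (c i)
        bad = ¬∀⇒∃¬ ∉C

    cell⊆complement : Cell ⊆ Complement
    cell⊆complement {x} ∈C (i , ∈H) = <⇒≱ (∈C i) (≈⇒≤ (≈-trans (level-product i x)
      (zeroʳ (level i b) (≈-trans (+ᴿ-cong ∈H (≈-refl { -ᴿ o i})) (pt≈ λ k → solve 1 (λ x → x :+ (con 0ℚ :- x) := con 0ℚ) refl (approx (o i) k))))))

    -- `Cell` and `Opposite` are disjoint open sets that cover the complement, so a connected set
    -- meeting the first cannot meet the second.
    maximal : ∀ D → IsConnected D → D ⊆ Complement → Satisfiable (Cell ∩ D) → D ⊆ Cell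
    maximal D connected D⊆ (p , p∈C , p∈D) {y} y∈D = [ id , (λ y∈O → ⊥-elim (clash (connected Cell Opposite cell-open opposite-open
      (λ {x} x∈D → covered {x} (D⊆ x∈D)) (p , p∈D , p∈C) (y , y∈D , y∈O)))) ]′ (covered {y} (D⊆ y∈D))
      where
      clash : ¬ Satisfiable (D ∩ (Cell ∩ Opposite))
      clash (x , _ , ∈C , ∈O) = disjoint {x} ∈C ∈O

    cell-convex : Convex Cell
    cell-convex x∈C y∈C 0≤t t≤1 i = positive-convex (w i) (c i) (x∈C i) (y∈C i) 0≤t t≤1

    isComponent : IsComponent Complement Cell
    isComponent = record
      { nonempty = b , b∈Cell
      ; subset = cell⊆complement
      ; connected = convex⇒connected cell-convex
      ; maximal = maximal
      }

    convex⊆cell : ∀ {K} → Convex K → b ∈ K → K ⊆ Complement → K ⊆ Cell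
    convex⊆cell {K} convex b∈K K⊆ = maximal K (convex⇒connected convex) K⊆ (b , b∈Cell , b∈K)

  unitBox-convex : ∀ {d n} (c : Fin d → Fin n) → Convex (UnitBox c)
  unitBox-convex c {x} {y} x∈ y∈ {t} 0≤t t≤1 j =
    ℝ′.lerp-≥ {ℝ′.nat (toℕ (c j))} {x j} {y j} {t} (proj₁ (x∈ j)) (proj₁ (y∈ j)) 0≤t t≤1 ,
    ℝ′.lerp-≤ {ℝ′.nat (suc (toℕ (c j)))} {x j} {y j} {t} (proj₂ (x∈ j)) (proj₂ (y∈ j)) 0≤t t≤1

  corner∈unitBox : ∀ {d n} (c : Fin d → Fin n) → (λ j → ℝ′.nat (toℕ (c j))) ∈ UnitBox c
  corner∈unitBox c j = ≤-refl , slack 1ᴿ (<⇒≤ 0ᴿ<1ᴿ) (+-comm-1 (ℝ′.nat (toℕ (c j))))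
    where
    +-comm-1 : ∀ x → x +ᴿ 1ᴿ ≈ 1ᴿ +ᴿ x
    +-comm-1 x = pt≈ λ k → ℚ.+-comm (approx x k) 1ℚ

  -- The sign cell of a corner of the box is a component, hence one of the parts; the box is convex
  -- and avoids the hyperplanes, so it stays in that cell.
  part-contains-box : ∀ {d m n} (F : Fan d m) (μ : ProbabilityMeasure d) (E : Equipartitions F μ) (c : Fin d → Fin n) →
    Misses (Fan.hyperplane F) c → ∃ λ i → UnitBox c ⊆ set (Equipartitions.part E i)
  part-contains-box F μ E c misses = proj₁ found , λ x∈box → proj₁ (proj₂ found)
      (convex⊆cell (unitBox-convex c) (corner∈unitBox c) (λ {x} x∈ (i , x∈H) → misses i x x∈ x∈H) x∈box)
    where
    open SignCell (Fan.hyperplane F) (λ j → ℝ′.nat (toℕ (c j))) (λ i → misses i _ (corner∈unitBox c)) using (Cell; isComponent; convex⊆cell)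
    found : ∃ λ i → Cell ≐ set (Equipartitions.part E i)
    found = Equipartitions.exhaustive E Cell isComponent

  -- Measures on spaces of infinite words

  ind : ∀ {ℓ} → Set ℓ → ℚ
  ind P with dec P
  ... | yes _ = 1ℚ
  ... | no  _ = 0ℚ

  0≤1 : 0ℚ ℚ.≤ 1ℚ
  0≤1 = ℚ.<⇒≤ 0<1

  0≤ind : ∀ {ℓ} (P : Set ℓ) → 0ℚ ℚ.≤ ind P
  0≤ind P with dec P
  ... | yes _ = 0≤1
  ... | no  _ = ℚ.≤-refl

  ind≤1 : ∀ {ℓ} (P : Set ℓ) → ind P ℚ.≤ 1ℚ
  ind≤1 P with dec P
  ... | yes _ = ℚ.≤-refl
  ... | no  _ = 0≤1

  ind-yes : ∀ {ℓ} {P : Set ℓ} → P → ind P ≡ 1ℚ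
  ind-yes {P = P} p with dec P
  ... | yes _ = refl
  ... | no ¬p = ⊥-elim (¬p p)

  ind-no : ∀ {ℓ} {P : Set ℓ} → ¬ P → ind P ≡ 0ℚ
  ind-no {P = P} ¬p with dec P
  ... | yes p = ⊥-elim (¬p p)
  ... | no  _ = refl

  ind-mono : ∀ {p q} {P : Set p} {Q : Set q} → (P → Q) → ind P ℚ.≤ ind Q
  ind-mono {P = P} {Q} f with dec P | dec Q
  ... | yes p | yes _ = ℚ.≤-refl
  ... | yes p | no ¬q = ⊥-elim (¬q (f p))
  ... | no  _ | yes _ = 0≤1
  ... | no  _ | no  _ = ℚ.≤-refl

  -- Inclusion-exclusion as an inequality, R containing the union and S the intersection. Averaged,
  -- it is the source of `prob-+`, on which the additivity arguments rest.
  ind-+ : ∀ {p q r s} {P : Set p} {Q : Set q} {R : Set r} {S : Set s} →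
          (P → R) → (Q → R) → (P → Q → S) → ind P ℚ.+ ind Q ℚ.≤ ind R ℚ.+ ind S
  ind-+ {P = P} {Q} {R} {S} P→R Q→R both with dec P | dec Q
  ... | yes p | yes q = subst₂ (λ r s → 1ℚ ℚ.+ 1ℚ ℚ.≤ r ℚ.+ s) (sym (ind-yes (P→R p))) (sym (ind-yes (both p q))) ℚ.≤-refl
  ... | yes p | no  _ = subst (λ r → 1ℚ ℚ.+ 0ℚ ℚ.≤ r ℚ.+ ind S) (sym (ind-yes (P→R p))) (ℚ.+-monoʳ-≤ 1ℚ (0≤ind S))
  ... | no  _ | yes q = subst (λ r → 0ℚ ℚ.+ 1ℚ ℚ.≤ r ℚ.+ ind S) (sym (ind-yes (Q→R q))) (ℚ.+-monoʳ-≤ 1ℚ (0≤ind S))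
  ... | no  _ | no  _ = ℚ.+-mono-≤ (0≤ind R) (0≤ind S)

  -- A finite probability space, given by its expectation operator.
  record Alphabet (L : Set) : Set where
    field
      E       : (L → ℚ) → ℚ
      E-mono  : ∀ f g → (∀ a → f a ℚ.≤ g a) → E f ℚ.≤ E g
      E-+     : ∀ f g → E (λ a → f a ℚ.+ g a) ≡ E f ℚ.+ E g
      E-*     : ∀ c f → E (λ a → c ℚ.* f a) ≡ c ℚ.* E f
      E-1     : E (λ _ → 1ℚ) ≡ 1ℚ
      -- How finiteness is used: stages chosen separately for each letter have a common bound.
      bounded : ∀ (f : L → ℕ) → ∃ λ M → ∀ a → f a ℕ.≤ M

    E-cong : ∀ f g → (∀ a → f a ≡ g a) → E f ≡ E g
    E-cong f g eq = ℚ.≤-antisym (E-mono f g (λ a → ℚ.≤-reflexive (eq a))) (E-mono g f (λ a → ℚ.≤-reflexive (sym (eq a))))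

    E-const : ∀ c → E (λ _ → c) ≡ c
    E-const c = trans (E-cong _ _ (λ _ → sym (ℚ.*-identityʳ c))) (trans (E-* c (λ _ → 1ℚ)) (trans (cong (c ℚ.*_) E-1) (ℚ.*-identityʳ c)))

    E-≤ : ∀ f c → (∀ a → f a ℚ.≤ c) → E f ℚ.≤ c
    E-≤ f c h = ℚ.≤-trans (E-mono f (λ _ → c) h) (ℚ.≤-reflexive (E-const c))

    E-≥ : ∀ f c → (∀ a → c ℚ.≤ f a) → c ℚ.≤ E f
    E-≥ f c h = ℚ.≤-trans (ℚ.≤-reflexive (sym (E-const c))) (E-mono (λ _ → c) f h)

    E-mono-+ : ∀ f g h k → (∀ a → f a ℚ.+ g a ℚ.≤ h a ℚ.+ k a) → E f ℚ.+ E g ℚ.≤ E h ℚ.+ E k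
    E-mono-+ f g h k le = subst₂ ℚ._≤_ (E-+ f g) (E-+ h k) (E-mono _ _ le)

  open Alphabet

  power : ∀ {L} → Alphabet L → ∀ k → Alphabet (Vec L k)
  power 𝓛 zero = record
    { E = λ f → f []
    ; E-mono = λ f g h → h []
    ; E-+ = λ f g → refl
    ; E-* = λ c f → refl
    ; E-1 = refl
    ; bounded = λ f → f [] , λ { [] → ℕ.≤-refl }
    }
  power {L} 𝓛 (suc k) = record
    { E = λ f → E 𝓛 (λ a → E 𝓥 (λ w → f (a ∷ w)))
    ; E-mono = λ f g h → E-mono 𝓛 _ _ (λ a → E-mono 𝓥 _ _ (λ w → h (a ∷ w)))
    ; E-+ = λ f g → trans (E-cong 𝓛 _ _ (λ a → E-+ 𝓥 (λ w → f (a ∷ w)) (λ w → g (a ∷ w)))) (E-+ 𝓛 _ _)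
    ; E-* = λ c f → trans (E-cong 𝓛 _ _ (λ a → E-* 𝓥 c (λ w → f (a ∷ w)))) (E-* 𝓛 c _)
    ; E-1 = trans (E-cong 𝓛 _ _ (λ a → E-1 𝓥)) (E-1 𝓛)
    ; bounded = λ f → proj₁ (bounded 𝓛 (λ a → proj₁ (bounded 𝓥 (λ w → f (a ∷ w))))) , λ
        { (a ∷ w) → ℕ.≤-trans (proj₂ (bounded 𝓥 (λ w → f (a ∷ w))) w) (proj₂ (bounded 𝓛 (λ a → proj₁ (bounded 𝓥 (λ w → f (a ∷ w))))) a) }
    }
    where
    𝓥 : Alphabet (Vec L k)
    𝓥 = power 𝓛 k

  ∑ℚ : ℕ → (ℕ → ℚ) → ℚ
  ∑ℚ zero    f = 0ℚ
  ∑ℚ (suc M) f = f 0 ℚ.+ ∑ℚ M (f ∘ suc)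

  ∑ℚ-mono : ∀ M f g → (∀ n → f n ℚ.≤ g n) → ∑ℚ M f ℚ.≤ ∑ℚ M g
  ∑ℚ-mono zero    f g h = ℚ.≤-refl
  ∑ℚ-mono (suc M) f g h = ℚ.+-mono-≤ (h 0) (∑ℚ-mono M (f ∘ suc) (g ∘ suc) (h ∘ suc))

  E-∑ : ∀ {L} (𝓛 : Alphabet L) M (f : ℕ → L → ℚ) → E 𝓛 (λ a → ∑ℚ M (λ n → f n a)) ≡ ∑ℚ M (λ n → E 𝓛 (f n))
  E-∑ 𝓛 zero    f = E-const 𝓛 0ℚ
  E-∑ 𝓛 (suc M) f = trans (E-+ 𝓛 (f 0) (λ a → ∑ℚ M (λ n → f (suc n) a))) (cong (E 𝓛 (f 0) ℚ.+_) (E-∑ 𝓛 M (f ∘ suc)))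

  Some< : ℕ → (ℕ → Set) → Set
  Some< M P = ∃ λ n → n ℕ.< M × P n

  ind-Some< : ∀ M (P : ℕ → Set) → ind (Some< M P) ℚ.≤ ∑ℚ M (λ n → ind (P n))
  ind-Some< zero    P = ℚ.≤-reflexive (ind-no λ { (n , () , _) })
  ind-Some< (suc M) P = begin
    ind (Some< (suc M) P)                              ≡⟨ ℚ.+-identityʳ _ ⟨
    ind (Some< (suc M) P) ℚ.+ 0ℚ                       ≡⟨ cong (ind (Some< (suc M) P) ℚ.+_) (ind-no {P = ⊥} (λ ())) ⟨
    ind (Some< (suc M) P) ℚ.+ ind ⊥                    ≤⟨ split ⟩
    ind (P 0) ℚ.+ ind (Some< M (P ∘ suc))              ≤⟨ ℚ.+-monoʳ-≤ (ind (P 0)) (ind-Some< M (P ∘ suc)) ⟩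
    ind (P 0) ℚ.+ ∑ℚ M (λ n → ind (P (suc n)))         ∎
    where
    open ℚ.≤-Reasoning
    split : ind (Some< (suc M) P) ℚ.+ ind ⊥ ℚ.≤ ind (P 0) ℚ.+ ind (Some< M (P ∘ suc))
    split with dec (P 0)
    ... | yes p = ℚ.+-mono-≤ (ind≤1 (Some< (suc M) P)) (ind-mono {P = ⊥} (λ ()))
    ... | no ¬p = ℚ.≤-trans (ℚ.≤-reflexive (ℚ.+-comm (ind (Some< (suc M) P)) (ind ⊥)))
          (ℚ.+-mono-≤ (ℚ.≤-reflexive (ind-no {P = ⊥} (λ ()))) (ind-mono λ
            { (zero , _ , p) → ⊥-elim (¬p p) ; (suc n , ℕ.s≤s n<M , p) → n , n<M , p }))

  module Tree {L : Set} (𝓛 : Alphabet L) where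
    Ω : Set
    Ω = ℕ → L

    prefix : ∀ k → Ω → Vec L k
    prefix zero    ω = []
    prefix (suc k) ω = ω 0 ∷ prefix k (ω ∘ suc)

    prefix-∷ʳ : ∀ k ω → prefix (suc k) ω ≡ prefix k ω ∷ʳ ω k
    prefix-∷ʳ zero    ω = refl
    prefix-∷ʳ (suc k) ω = cong (ω 0 ∷_) (prefix-∷ʳ k (ω ∘ suc))

    -- A closed event, one that persists under extension of the word, stands for
    -- the open set of infinite words having a prefix in it.
    Event : Set₁
    Event = ∀ k → Vec L k → Set

    shift : L → Event → Event
    shift a T k w = T (suc k) (a ∷ w)

    Closed : Event → Set
    Closed T = ∀ k w a → T k w → T (suc k) (w ∷ʳ a)

    shift-closed : ∀ {T} a → Closed T → Closed (shift a T)
    shift-closed a cl k w b = cl (suc k) (a ∷ w) b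

    𝔼 : ∀ k → (Vec L k → ℚ) → ℚ
    𝔼 k = E (power 𝓛 k)

    prob : Event → ℕ → ℚ
    prob T k = 𝔼 k (λ w → ind (T k w))

    𝔼-∷ʳ : ∀ k (f : Vec L (suc k) → ℚ) → 𝔼 (suc k) f ≡ 𝔼 k (λ w → E 𝓛 (λ a → f (w ∷ʳ a)))
    𝔼-∷ʳ zero    f = refl
    𝔼-∷ʳ (suc k) f = E-cong 𝓛 _ _ (λ a → 𝔼-∷ʳ k (λ w → f (a ∷ w)))

    prob-step : ∀ {T} → Closed T → ∀ k → prob T k ℚ.≤ prob T (suc k)
    prob-step {T} cl k = subst (prob T k ℚ.≤_) (sym (𝔼-∷ʳ k (λ w → ind (T (suc k) w))))
      (E-mono (power 𝓛 k) _ _ λ w → E-≥ 𝓛 _ _ λ a → ind-mono (cl k w a))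

    prob-mono : ∀ {T} → Closed T → ∀ {k l} → k ℕ.≤′ l → prob T k ℚ.≤ prob T l
    prob-mono {T} cl {k} (ℕ.≤′-reflexive refl) = ℚ.≤-refl {prob T k}
    prob-mono {T} cl {k} {suc l} (ℕ.≤′-step k≤l) = ℚ.≤-trans {prob T k} {prob T l} {prob T (suc l)} (prob-mono cl k≤l) (prob-step cl l)

    prob-⊆ : ∀ {S T : Event} k → (∀ w → S k w → T k w) → prob S k ℚ.≤ prob T k
    prob-⊆ k S⊆T = E-mono (power 𝓛 k) _ _ (λ w → ind-mono (S⊆T w))

    prob-+ : ∀ {A B C D : Event} k → (∀ w → A k w → C k w) → (∀ w → B k w → C k w) → (∀ w → A k w → B k w → D k w) →
             prob A k ℚ.+ prob B k ℚ.≤ prob C k ℚ.+ prob D k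
    prob-+ {A} {B} {C} {D} k A⊆C B⊆C A∩B⊆D = E-mono-+ (power 𝓛 k) (λ w → ind (A k w)) (λ w → ind (B k w)) (λ w → ind (C k w)) (λ w → ind (D k w))
      (λ w → ind-+ (A⊆C w) (B⊆C w) (A∩B⊆D w))

    prob≤1 : ∀ T k → prob T k ℚ.≤ 1ℚ
    prob≤1 T k = E-≤ (power 𝓛 k) _ 1ℚ (λ w → ind≤1 (T k w))

    0≤prob : ∀ T k → 0ℚ ℚ.≤ prob T k
    0≤prob T k = E-≥ (power 𝓛 k) _ 0ℚ (λ w → 0≤ind (T k w))

    _⊓_ : Event → Event → Event
    (S ⊓ T) k w = S k w × T k w

    ⊓-closed : ∀ {S T} → Closed S → Closed T → Closed (S ⊓ T)
    ⊓-closed cs ct k w a (s , t) = cs k w a s , ct k w a t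

    ⨆ : (ℕ → Event) → Event
    ⨆ T k w = ∃ λ n → T n k w

    ⨆< : ℕ → (ℕ → Event) → Event
    ⨆< M T k w = Some< M (λ n → T n k w)

    ⨅< : ℕ → (ℕ → Event) → Event
    ⨅< M T k w = ∀ n → n ℕ.< M → T n k w

    prob-⨆< : ∀ M T k → prob (⨆< M T) k ℚ.≤ ∑ℚ M (λ n → prob (T n) k)
    prob-⨆< M T k = ℚ.≤-trans
      (E-mono (power 𝓛 k) _ _ (λ w → ind-Some< M (λ n → T n k w)))
      (ℚ.≤-reflexive (E-∑ (power 𝓛 k) M (λ n w → ind (T n k w))))

    -- There are finitely many words of length k, and one index for each suffices. The index comes
    -- from `dec` instead of the given witness, so that it depends on w alone.
    ⨆-finite : ∀ T k → ∃ λ M → ∀ w → ⨆ T k w → ⨆< M T k w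
    ⨆-finite T k = suc (proj₁ b) , λ w ∃n → first w ∃n , ℕ.s≤s (subst (ℕ._≤ proj₁ b) (index-yes w ∃n) (proj₂ b w)) , proj₂ (found w ∃n)
      where
      found : ∀ w → ⨆ T k w → ⨆ T k w
      found w ∃n with dec (⨆ T k w)
      ... | yes t = t
      ... | no  _ = ∃n

      first : ∀ w → ⨆ T k w → ℕ
      first w ∃n = proj₁ (found w ∃n)

      index : Vec L k → ℕ
      index w with dec (⨆ T k w)
      ... | yes (n , _) = n
      ... | no  _       = 0

      index-yes : ∀ w ∃n → index w ≡ first w ∃n
      index-yes w ∃n with dec (⨆ T k w)
      ... | yes _ = refl
      ... | no ¬t = ⊥-elim (¬t ∃n)

      b : ∃ λ M → ∀ w → index w ℕ.≤ M
      b = bounded (power 𝓛 k) index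

    -- A bound for the measure of the open set given by T, which for closed T is the supremum of the
    -- increasing numbers `prob T k`.
    Small : Event → ℚ → Set
    Small T q = ∀ k → prob T k ℚ.≤ q

    small-from : ∀ {T q} K → Closed T → (∀ k → K ℕ.≤ k → prob T k ℚ.≤ q) → Small T q
    small-from {T} {q} K cl h k = ℚ.≤-trans {prob T k} {prob T (k ℕ.⊔ K)} {q} (prob-mono cl (ℕ.≤⇒≤′ (ℕ.m≤m⊔n k K))) (h (k ℕ.⊔ K) (ℕ.m≤n⊔m k K))

    -- Otherwise every level could be followed by one whose probability is larger by ε, and after
    -- more than 1/ε such steps it would exceed 1. The level K stands in for the limit of `prob T`.
    almost-limit : ∀ T {ε} → 0ℚ ℚ.< ε → ∃ λ K → ∀ l → prob T l ℚ.≤ prob T K ℚ.+ ε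
    almost-limit T {ε} 0<ε = ¬¬-elim λ none → too-large none
      where
      climb : (∀ K → ∃ λ l → prob T K ℚ.+ ε ℚ.≤ prob T l) → ∀ j → ∃ λ K → fromℕ j ℚ.* ε ℚ.≤ prob T K
      climb up zero    = 0 , subst (ℚ._≤ prob T 0) (sym (ℚ.*-zeroˡ ε)) (0≤prob T 0)
      climb up (suc j) = proj₁ (up K) , ℚ.≤-trans
          (slack-≤ (prob T K ℚ.- fromℕ j ℚ.* ε) (p≤q⇒0≤q-p (proj₂ (climb up j)))
            (solve 3 (λ j e p → (con 1ℚ :+ j) :* e :+ (p :- j :* e) := p :+ e) refl (fromℕ j) ε (prob T K)))
          (proj₂ (up K))
        where
        K : ℕ
        K = proj₁ (climb up j)

      inverse : ∃ λ c → 0ℚ ℚ.< c × ε ℚ.* c ≡ 1ℚ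
      inverse = divide 0<ε 0<1

      J : ∃ λ j → proj₁ inverse ℚ.≤ fromℕ j
      J = archimedean (proj₁ inverse)

      too-large : ¬ ¬ ∃ λ K → ∀ l → prob T l ℚ.≤ prob T K ℚ.+ ε
      too-large none = ℚ.<-irrefl refl (ℚ.<-≤-trans 1<jε (ℚ.≤-trans (proj₂ top) (prob≤1 T (proj₁ top))))
        where
        up : ∀ K → ∃ λ l → prob T K ℚ.+ ε ℚ.≤ prob T l
        up K = ¬¬-elim λ stuck → none (K , λ l → ℚ.≮⇒≥ λ lt → stuck (l , ℚ.<⇒≤ lt))

        j : ℕ
        j = proj₁ J

        top : ∃ λ K → fromℕ (suc j) ℚ.* ε ℚ.≤ prob T K
        top = climb up (suc j)

        1<jε : 1ℚ ℚ.< fromℕ (suc j) ℚ.* ε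
        1<jε = ℚ.≤-<-trans (subst (ℚ._≤ fromℕ j ℚ.* ε) (trans (ℚ.*-comm (proj₁ inverse) ε) (proj₂ (proj₂ inverse))) (*-monoʳ-≤-0≤ (ℚ.<⇒≤ 0<ε) (proj₂ J)))
          (slack-< ε 0<ε (solve 2 (λ j e → j :* e :+ e := (con 1ℚ :+ j) :* e) refl (fromℕ j) ε))

    -- A cylinder: the first k letters satisfy R. A word shorter than k does not belong to it yet.
    Decided : ∀ k → (Vec L k → Set) → Event
    Decided zero    R l       w       = R []
    Decided (suc k) R zero    []      = ⊥
    Decided (suc k) R (suc l) (a ∷ w) = Decided k (λ v → R (a ∷ v)) l w

    Decided-closed : ∀ k R → Closed (Decided k R)
    Decided-closed zero    R l       w       b r = r
    Decided-closed (suc k) R (suc l) (a ∷ w) b r = Decided-closed k (λ v → R (a ∷ v)) l w b r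

    Decided-intro : ∀ k R ω → R (prefix k ω) → Decided k R k (prefix k ω)
    Decided-intro zero    R ω r = r
    Decided-intro (suc k) R ω r = Decided-intro k (λ v → R (ω 0 ∷ v)) (ω ∘ suc) r

    Decided-contradictory : ∀ k R R′ → (∀ v → R v → ¬ R′ v) → ∀ l w → Decided k R l w → ¬ Decided k R′ l w
    Decided-contradictory zero    R R′ h l       w       = h []
    Decided-contradictory (suc k) R R′ h (suc l) (a ∷ w) = Decided-contradictory k _ _ (λ v → h (a ∷ v)) l w

    prob-Decided-≤ : ∀ k R l → prob (Decided k R) l ℚ.≤ 𝔼 k (λ v → ind (R v))
    prob-Decided-≤ zero    R l       = E-≤ (power 𝓛 l) _ _ (λ w → ℚ.≤-refl)
    prob-Decided-≤ (suc k) R zero    = E-≥ (power 𝓛 (suc k)) (λ v → ind (R v)) (ind ⊥)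
      (λ w → ℚ.≤-trans (ℚ.≤-reflexive (ind-no {P = ⊥} (λ ()))) (0≤ind (R w)))
    prob-Decided-≤ (suc k) R (suc l) = E-mono 𝓛 _ _ (λ a → prob-Decided-≤ k (λ v → R (a ∷ v)) l)

    prob-Decided-≥ : ∀ k R l → k ℕ.≤ l → 𝔼 k (λ v → ind (R v)) ℚ.≤ prob (Decided k R) l
    prob-Decided-≥ zero    R l       _           = E-≥ (power 𝓛 l) _ _ (λ w → ℚ.≤-refl)
    prob-Decided-≥ (suc k) R (suc l) (ℕ.s≤s k≤l) = E-mono 𝓛 _ _ (λ a → prob-Decided-≥ k (λ v → R (a ∷ v)) l k≤l)

    extend : ∀ {T} → Closed T → ∀ l (w : Vec L l) → T 0 [] → T l w
    extend {T} cl zero    []      t = t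
    extend {T} cl (suc l) (a ∷ w) t = extend (shift-closed {T} a cl) l w (cl 0 [] a t)

    Decided⊆ : ∀ {T} → Closed T → ∀ k l w → Decided k (T k) l w → T l w
    Decided⊆ {T} cl zero    l       w       t = extend {T} cl l w t
    Decided⊆ {T} cl (suc k) (suc l) (a ∷ w) t = Decided⊆ {shift a T} (shift-closed {T} a cl) k l w t

    -- Words that entered T by length k form a cylinder inside T, disjoint from the cylinder of
    -- those that did not. What T gains outside the former is therefore at most its growth after
    -- length k.
    Decided-avoid : ∀ {T} → Closed T → ∀ k l → k ℕ.≤ l → prob (T ⊓ Decided k (λ v → ¬ T k v)) l ℚ.+ prob T k ℚ.≤ prob T l
    Decided-avoid {T} cl k l k≤l = begin
      prob (T ⊓ N) l ℚ.+ prob T k                ≤⟨ ℚ.+-monoʳ-≤ (prob (T ⊓ N) l) (prob-Decided-≥ k (T k) l k≤l) ⟩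
      prob (T ⊓ N) l ℚ.+ prob (Decided k (T k)) l ≤⟨ prob-+ {T ⊓ N} {Decided k (T k)} {T} {λ _ _ → ⊥} l (λ w → proj₁) (Decided⊆ {T} cl k l)
                                                       (λ w n d → Decided-contradictory k _ _ (λ v t ¬t → ¬t t) l w d (proj₂ n)) ⟩
      prob T l ℚ.+ prob (λ _ _ → ⊥) l            ≡⟨ cong (prob T l ℚ.+_) (trans (E-cong (power 𝓛 l) _ _ (λ w → ind-no {P = ⊥} (λ ()))) (E-const (power 𝓛 l) 0ℚ)) ⟩
      prob T l ℚ.+ 0ℚ                            ≡⟨ ℚ.+-identityʳ (prob T l) ⟩
      prob T l                                   ∎
      where
      open ℚ.≤-Reasoning
      N : Event
      N = Decided k (λ v → ¬ T k v)

    Covers : Event → Pred Ω 0ℓ → Set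
    Covers T S = ∀ ω → S ω → ∃ λ k → T k (prefix k ω)

    record Outer (S : Pred Ω 0ℓ) (q : ℚ) : Set₁ where
      constructor outer
      field
        event  : Event
        closed : Closed event
        covers : Covers event S
        small  : Small event q

    -- Lebesgue's criterion: a measurable set and its complement have open covers
    -- with arbitrarily small overlap.
    record Measurable (S : Pred Ω 0ℓ) (ε : ℚ) : Set₁ where
      field
        inside outside : Event
        inside-closed  : Closed inside
        outside-closed : Closed outside
        inside-covers  : Covers inside S
        outside-covers : Covers outside (∁ S)
        small          : Small (inside ⊓ outside) ε

    IsMeasurable : Pred Ω 0ℓ → Set₁
    IsMeasurable S = ∀ {ε} → 0ℚ ℚ.< ε → Measurable S ε

    outer-≤ : ∀ {S p q} → p ℚ.≤ q → Outer S p → Outer S q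
    outer-≤ {S} {p} {q} p≤q (outer T cl c s) = outer T cl c (λ k → ℚ.≤-trans {prob T k} {p} {q} (s k) p≤q)

    outer-⊆ : ∀ {S S′ q} → S ⊆ S′ → Outer S′ q → Outer S q
    outer-⊆ S⊆S′ (outer T cl c s) = outer T cl (λ ω ω∈S → c ω (S⊆S′ ω∈S)) s

    outer≥0 : ∀ {S q} → Outer S q → 0ℚ ℚ.≤ q
    outer≥0 {S} {q} (outer T cl c s) = ℚ.≤-trans {0ℚ} {prob T 0} {q} (0≤prob T 0) (s 0)

    outer-1 : ∀ S → Outer S 1ℚ
    outer-1 S = outer (λ _ _ → ⊤) (λ k w a t → t) (λ ω _ → 0 , tt) (prob≤1 (λ _ _ → ⊤))

    outer-∅ : ∀ {S q} → (∀ ω → ¬ S ω) → 0ℚ ℚ.≤ q → Outer S q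
    outer-∅ {S} {q} empty 0≤q = outer (λ _ _ → ⊥) (λ k w a t → t) (λ ω ω∈S → ⊥-elim (empty ω ω∈S))
      (λ k → E-≤ (power 𝓛 k) _ q (λ w → ℚ.≤-trans (ℚ.≤-reflexive (ind-no {P = ⊥} (λ ()))) 0≤q))

    -- Countable subadditivity: at each length only finitely many of the covers contribute, so
    -- finite sums suffice.
    outer-⋃ : ∀ {S : ℕ → Pred Ω 0ℓ} {q : ℕ → ℚ} {Q} → (∀ n → Outer (S n) (q n)) → (∀ M → ∑ℚ M q ℚ.≤ Q) → Outer (⋃ ℕ S) Q
    outer-⋃ {S} {q} {Q} o total = outer (⨆ T) (λ k w a (n , t) → n , Outer.closed (o n) k w a t)
      (λ ω (n , ω∈Sn) → proj₁ (Outer.covers (o n) ω ω∈Sn) , n , proj₂ (Outer.covers (o n) ω ω∈Sn)) bound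
      where
      T : ℕ → Event
      T n = Outer.event (o n)

      bound : Small (⨆ T) Q
      bound k = begin
        prob (⨆ T) k                    ≤⟨ prob-⊆ {⨆ T} {⨆< M T} k (proj₂ (⨆-finite T k)) ⟩
        prob (⨆< M T) k                 ≤⟨ prob-⨆< M T k ⟩
        ∑ℚ M (λ n → prob (T n) k)       ≤⟨ ∑ℚ-mono M (λ n → prob (T n) k) q (λ n → Outer.small (o n) k) ⟩
        ∑ℚ M q                          ≤⟨ total M ⟩
        Q                               ∎
        where
        open ℚ.≤-Reasoning
        M : ℕ
        M = proj₁ (⨆-finite T k)

  -- The exponent is n + 1, so that the terms from n = 0 on sum to ε.
  _/2^_ : ℚ → ℕ → ℚ
  ε /2^ n = ½^ suc n ℚ.* ε

  0</2^ : ∀ {ε} n → 0ℚ ℚ.< ε → 0ℚ ℚ.< ε /2^ n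
  0</2^ n 0<ε = 0<* (0<½^ (suc n)) 0<ε

  ∑-/2^ : ∀ M {ε} → 0ℚ ℚ.≤ ε → ∑ℚ M (ε /2^_) ℚ.≤ ε
  ∑-/2^ M {ε} 0≤ε = slack-≤ (½^ M ℚ.* ε) (0≤* (ℚ.<⇒≤ (0<½^ M)) 0≤ε) (exact M ε)
    where
    scale-gen : ∀ M (f : ℕ → ℚ) → ∑ℚ M (λ n → ½ ℚ.* f n) ≡ ½ ℚ.* ∑ℚ M f
    scale-gen zero    f = refl
    scale-gen (suc M) f = trans (cong (½ ℚ.* f 0 ℚ.+_) (scale-gen M (f ∘ suc))) (sym (ℚ.*-distribˡ-+ ½ (f 0) (∑ℚ M (f ∘ suc))))

    ∑-cong : ∀ M {f g : ℕ → ℚ} → (∀ n → f n ≡ g n) → ∑ℚ M f ≡ ∑ℚ M g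
    ∑-cong zero    eq = refl
    ∑-cong (suc M) eq = cong₂ ℚ._+_ (eq 0) (∑-cong M (eq ∘ suc))

    scale : ∀ M ε → ∑ℚ M (λ n → ε /2^ suc n) ≡ ½ ℚ.* ∑ℚ M (ε /2^_)
    scale M ε = trans (∑-cong M (λ n → ℚ.*-assoc ½ (½^ suc n) ε)) (scale-gen M (ε /2^_))

    exact : ∀ M ε → ∑ℚ M (ε /2^_) ℚ.+ ½^ M ℚ.* ε ≡ ε
    exact zero    ε = trans (ℚ.+-identityˡ _) (ℚ.*-identityˡ ε)
    exact (suc M) ε = begin
      ε /2^ 0 ℚ.+ ∑ℚ M (λ n → ε /2^ suc n) ℚ.+ ½^ suc M ℚ.* ε
        ≡⟨ cong (λ s → ε /2^ 0 ℚ.+ s ℚ.+ ½^ suc M ℚ.* ε) (scale M ε) ⟩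
      ε /2^ 0 ℚ.+ ½ ℚ.* ∑ℚ M (ε /2^_) ℚ.+ ½^ suc M ℚ.* ε
        ≡⟨ solve 3 (λ e s h → con ½ :* con 1ℚ :* e :+ con ½ :* s :+ con ½ :* h :* e := con ½ :* e :+ con ½ :* (s :+ h :* e)) refl ε (∑ℚ M (ε /2^_)) (½^ M) ⟩
      ½ ℚ.* ε ℚ.+ ½ ℚ.* (∑ℚ M (ε /2^_) ℚ.+ ½^ M ℚ.* ε)
        ≡⟨ cong (λ s → ½ ℚ.* ε ℚ.+ ½ ℚ.* s) (exact M ε) ⟩
      ½ ℚ.* ε ℚ.+ ½ ℚ.* ε
        ≡⟨ solve 1 (λ e → con ½ :* e :+ con ½ :* e := e) refl ε ⟩
      ε ∎
      where open ≡-Reasoning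

  module TreeMeasure {L : Set} (𝓛 : Alphabet L) where
    open Tree 𝓛

    lift : ∀ {T} → Closed T → ∀ ω {k l} → k ℕ.≤′ l → T k (prefix k ω) → T l (prefix l ω)
    lift cl ω (ℕ.≤′-reflexive refl) t = t
    lift {T} cl ω {l = suc l} (ℕ.≤′-step k≤l) t =
      subst (T (suc l)) (sym (prefix-∷ʳ l ω)) (cl l (prefix l ω) (ω l) (lift {T} cl ω k≤l t))

    measurable-∁ : ∀ {S} → IsMeasurable S → IsMeasurable (∁ S)
    measurable-∁ {S} meas 0<ε = record
      { inside = outside ; outside = inside
      ; inside-closed = outside-closed ; outside-closed = inside-closed
      ; inside-covers = outside-covers
      ; outside-covers = λ ω ¬¬ω∈S → inside-covers ω (¬¬-elim ¬¬ω∈S)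
      ; small = λ k → ℚ.≤-trans (prob-⊆ {outside ⊓ inside} {inside ⊓ outside} k (λ w (o , i) → i , o)) (small k)
      }
      where open Measurable (meas 0<ε)

    measurable-resp : ∀ {S S′} → S ≐ S′ → IsMeasurable S → IsMeasurable S′
    measurable-resp (S⊆ , ⊆S) meas 0<ε = record
      { inside = inside ; outside = outside
      ; inside-closed = inside-closed ; outside-closed = outside-closed
      ; inside-covers = λ ω ω∈ → inside-covers ω (⊆S ω∈)
      ; outside-covers = λ ω ω∉ → outside-covers ω (λ ω∈S → ω∉ (S⊆ ω∈S))
      ; small = small
      }
      where open Measurable (meas 0<ε)

    -- An open set covers itself. Its complement is covered by the words that have not entered T by
    -- length K, where K is so late that T gains at most ε afterwards.
    measurable-open : ∀ T → Closed T → ∀ {S} → Covers T S → (∀ k ω → T k (prefix k ω) → S ω) → IsMeasurable S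
    measurable-open T cl covers sound {ε} 0<ε = record
      { inside = T ; outside = Decided K (λ v → ¬ T K v)
      ; inside-closed = cl ; outside-closed = Decided-closed K (λ v → ¬ T K v)
      ; inside-covers = covers
      ; outside-covers = λ ω ω∉S → K , Decided-intro K (λ v → ¬ T K v) ω (λ t → ω∉S (sound K ω t))
      ; small = small-from {T ⊓ Decided K (λ v → ¬ T K v)} {ε} K (⊓-closed {T} cl (Decided-closed K (λ v → ¬ T K v))) bound
      }
      where
      K : ℕ
      K = proj₁ (almost-limit T 0<ε)

      bound : ∀ l → K ℕ.≤ l → prob (T ⊓ Decided K (λ v → ¬ T K v)) l ℚ.≤ ε
      bound l K≤l = slack-≤ ((prob T l ℚ.- (p ℚ.+ prob T K)) ℚ.+ (prob T K ℚ.+ ε ℚ.- prob T l))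
        (0≤+ (p≤q⇒0≤q-p (Decided-avoid {T} cl K l K≤l)) (p≤q⇒0≤q-p (proj₂ (almost-limit T 0<ε) l)))
        (solve 4 (λ p a b e → p :+ ((b :- (p :+ a)) :+ (a :+ e :- b)) := e) refl p (prob T K) (prob T l) ε)
        where
        p : ℚ
        p = prob (T ⊓ Decided K (λ v → ¬ T K v)) l

    ⨆-closed : ∀ T → (∀ n → Closed (T n)) → Closed (⨆ T)
    ⨆-closed T cl k w a (n , t) = n , cl n k w a t

    -- The intersection of all outside covers need not be open, so only the first M are intersected.
    -- M is such that the first M inside covers carry `⨆ I` up to ε/2; the overlaps of these M pairs
    -- add up to at most ε/2.
    measurable-⋃ : ∀ {S : ℕ → Pred Ω 0ℓ} → (∀ n → IsMeasurable (S n)) → IsMeasurable (⋃ ℕ S)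
    measurable-⋃ {S} meas {ε} 0<ε = record
      { inside = ⨆ I ; outside = ⨅< M O
      ; inside-closed = ⨆-closed I I-closed
      ; outside-closed = ⨅-closed
      ; inside-covers = λ ω (n , ω∈Sn) → proj₁ (inside-covers (m n) ω ω∈Sn) , n , proj₂ (inside-covers (m n) ω ω∈Sn)
      ; outside-covers = λ ω ω∉ → avoid ω ω∉ M
      ; small = small-from {⨆ I ⊓ ⨅< M O} {ε} k₀ (⊓-closed {⨆ I} (⨆-closed I I-closed) ⨅-closed) bound
      }
      where
      open Measurable
      m : ∀ n → Measurable (S n) ((ε ℚ.* ½) /2^ n)
      m n = meas n (0</2^ n (half 0<ε))

      I O : ℕ → Event
      I n = inside (m n)
      O n = outside (m n)

      I-closed : ∀ n → Closed (I n)
      I-closed n = inside-closed (m n)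

      k₀ M : ℕ
      k₀ = proj₁ (almost-limit (⨆ I) (half 0<ε))
      M = proj₁ (⨆-finite I k₀)

      ⨅-closed : Closed (⨅< M O)
      ⨅-closed k w a o n n<M = outside-closed (m n) k w a (o n n<M)

      ⨆<-closed : Closed (⨆< M I)
      ⨆<-closed k w a (n , n<M , t) = n , n<M , I-closed n k w a t

      avoid : ∀ ω → ¬ ⋃ ℕ S ω → ∀ M → ∃ λ k → ⨅< M O k (prefix k ω)
      avoid ω ω∉ zero    = 0 , λ n ()
      avoid ω ω∉ (suc M) = k ℕ.⊔ proj₁ (avoid ω ω∉ M) , λ n n<M → [
          (λ n<M′ → lift {O n} (outside-closed (m n)) ω (ℕ.≤⇒≤′ (ℕ.m≤n⊔m k _)) (proj₂ (avoid ω ω∉ M) n n<M′)) ,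
          (λ { refl → lift {O n} (outside-closed (m n)) ω (ℕ.≤⇒≤′ (ℕ.m≤m⊔n k _)) (proj₂ (outside-covers (m M) ω (λ ω∈SM → ω∉ (M , ω∈SM)))) })
          ]′ (ℕ.m<1+n⇒m<n∨m≡n n<M)
        where
        k : ℕ
        k = proj₁ (outside-covers (m M) ω (λ ω∈SM → ω∉ (M , ω∈SM)))

      J : ℕ → Event
      J n = I n ⊓ O n

      bound : ∀ l → k₀ ℕ.≤ l → prob (⨆ I ⊓ ⨅< M O) l ℚ.≤ ε
      bound l k₀≤l = slack-≤
          ((a ℚ.+ j ℚ.- (x ℚ.+ u)) ℚ.+ ((ε ℚ.* ½ ℚ.- j) ℚ.+ ((a₀ ℚ.+ ε ℚ.* ½ ℚ.- a) ℚ.+ (u ℚ.- a₀))))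
          (0≤+ (p≤q⇒0≤q-p count) (0≤+ (p≤q⇒0≤q-p j≤) (0≤+ (p≤q⇒0≤q-p (proj₂ (almost-limit (⨆ I) (half 0<ε)) l)) (p≤q⇒0≤q-p a₀≤u))))
          (solve 6 (λ x u a a₀ j e → x :+ ((a :+ j :- (x :+ u)) :+ ((e :* con ½ :- j) :+ ((a₀ :+ e :* con ½ :- a) :+ (u :- a₀)))) := e)
            refl x u a a₀ j ε)
        where
        x u a a₀ j : ℚ
        x  = prob (⨆ I ⊓ ⨅< M O) l
        u  = prob (⨆< M I) l
        a  = prob (⨆ I) l
        a₀ = prob (⨆ I) k₀
        j  = prob (⨆< M J) l

        count : x ℚ.+ u ℚ.≤ a ℚ.+ j
        count = prob-+ {⨆ I ⊓ ⨅< M O} {⨆< M I} {⨆ I} {⨆< M J} l (λ w → proj₁) (λ w (n , _ , i) → n , i)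
          (λ w (_ , o) (n , n<M , i) → n , n<M , i , o n n<M)

        j≤ : j ℚ.≤ ε ℚ.* ½
        j≤ = begin
          prob (⨆< M J) l                 ≤⟨ prob-⨆< M J l ⟩
          ∑ℚ M (λ n → prob (J n) l)       ≤⟨ ∑ℚ-mono M (λ n → prob (J n) l) ((ε ℚ.* ½) /2^_) (λ n → small (m n) l) ⟩
          ∑ℚ M ((ε ℚ.* ½) /2^_)           ≤⟨ ∑-/2^ M (ℚ.<⇒≤ (half 0<ε)) ⟩
          ε ℚ.* ½                         ∎
          where open ℚ.≤-Reasoning

        a₀≤u : a₀ ℚ.≤ u
        a₀≤u = ℚ.≤-trans {a₀} {prob (⨆< M I) k₀} {u} (prob-⊆ {⨆ I} {⨆< M I} k₀ (proj₂ (⨆-finite I k₀)))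
          (prob-mono {⨆< M I} ⨆<-closed (ℕ.≤⇒≤′ k₀≤l))

    -- Carathéodory's condition: a cover of S is cut by the inside and outside covers of S₁, which
    -- overlap by at most ε/2. The measure of each piece is read off at a late length with a margin
    -- of ε/4.
    outer-split : ∀ {S S₁ S₂ : Pred Ω 0ℓ} {q ε} → IsMeasurable S₁ → S₁ ⊆ S → S₂ ⊆ S → (∀ ω → S₁ ω → ¬ S₂ ω) →
      Outer S q → 0ℚ ℚ.< ε → ∃ λ q₁ → ∃ λ q₂ → Outer S₁ q₁ × Outer S₂ q₂ × q₁ ℚ.+ q₂ ℚ.≤ q ℚ.+ ε
    outer-split {S} {S₁} {S₂} {q} {ε} meas S₁⊆S S₂⊆S disjoint (outer T cl covers small) 0<ε =
        prob A K ℚ.+ δ , prob B K ℚ.+ δ ,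
        outer A A-closed (λ ω ω∈ → both ω (covers ω (S₁⊆S ω∈)) (M.inside-covers ω ω∈))
          (λ l → ℚ.≤-trans {prob A l} {prob A KA ℚ.+ δ} {prob A K ℚ.+ δ} (proj₂ limA l)
            (ℚ.+-monoˡ-≤ δ (prob-mono {A} A-closed (ℕ.≤⇒≤′ (ℕ.m≤m⊔n KA KB))))) ,
        outer B B-closed (λ ω ω∈ → both′ ω (covers ω (S₂⊆S ω∈)) (M.outside-covers ω (λ ω∈S₁ → disjoint ω ω∈S₁ ω∈)))
          (λ l → ℚ.≤-trans {prob B l} {prob B KB ℚ.+ δ} {prob B K ℚ.+ δ} (proj₂ limB l)
            (ℚ.+-monoˡ-≤ δ (prob-mono {B} B-closed (ℕ.≤⇒≤′ (ℕ.m≤n⊔m KA KB))))) ,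
        slack-≤ ((prob T K ℚ.+ d ℚ.- (prob A K ℚ.+ prob B K)) ℚ.+ ((q ℚ.- prob T K) ℚ.+ (ε ℚ.* ½ ℚ.- d)))
          (0≤+ (p≤q⇒0≤q-p count) (0≤+ (p≤q⇒0≤q-p (small K)) (p≤q⇒0≤q-p (M.small K))))
          (solve 6 (λ a b t d q e → (a :+ e :* con ½ :* con ½) :+ (b :+ e :* con ½ :* con ½) :+ ((t :+ d :- (a :+ b)) :+ ((q :- t) :+ (e :* con ½ :- d))) := q :+ e)
            refl (prob A K) (prob B K) (prob T K) d q ε)
      where
      module M = Measurable (meas (half 0<ε))
      δ : ℚ
      δ = ε ℚ.* ½ ℚ.* ½

      A B : Event
      A = T ⊓ M.inside
      B = T ⊓ M.outside

      A-closed : Closed A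
      A-closed = ⊓-closed {T} cl M.inside-closed

      B-closed : Closed B
      B-closed = ⊓-closed {T} cl M.outside-closed

      limA : ∃ λ K → ∀ l → prob A l ℚ.≤ prob A K ℚ.+ δ
      limA = almost-limit A (half (half 0<ε))

      limB : ∃ λ K → ∀ l → prob B l ℚ.≤ prob B K ℚ.+ δ
      limB = almost-limit B (half (half 0<ε))

      KA KB K : ℕ
      KA = proj₁ limA
      KB = proj₁ limB
      K = KA ℕ.⊔ KB

      d : ℚ
      d = prob (M.inside ⊓ M.outside) K

      meet : ∀ {T′} → Closed T′ → ∀ ω → (∃ λ k → T k (prefix k ω)) → (∃ λ k → T′ k (prefix k ω)) → ∃ λ k → (T ⊓ T′) k (prefix k ω)
      meet {T′} cl′ ω (k , t) (l , t′) = k ℕ.⊔ l , lift {T} cl ω (ℕ.≤⇒≤′ (ℕ.m≤m⊔n k l)) t , lift {T′} cl′ ω (ℕ.≤⇒≤′ (ℕ.m≤n⊔m k l)) t′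

      both : ∀ ω → (∃ λ k → T k (prefix k ω)) → (∃ λ k → M.inside k (prefix k ω)) → ∃ λ k → A k (prefix k ω)
      both = meet {M.inside} M.inside-closed

      both′ : ∀ ω → (∃ λ k → T k (prefix k ω)) → (∃ λ k → M.outside k (prefix k ω)) → ∃ λ k → B k (prefix k ω)
      both′ = meet {M.outside} M.outside-closed

      count : prob A K ℚ.+ prob B K ℚ.≤ prob T K ℚ.+ d
      count = prob-+ {A} {B} {T} {M.inside ⊓ M.outside} K (λ w → proj₁) (λ w → proj₁) (λ w (_ , i) (_ , o) → i , o)

    -- Weak Kőnig: an event reached along every infinite word is already
    -- reached by all words of some fixed length.
    Bar : Event → Set
    Bar T = ∃ λ k → ∀ w → T k w

    uniform-bar : ∀ {T} → Closed T → (G : L → Set) → (∀ a → G a → Bar (shift a T)) → ∃ λ k → ∀ a → G a → ∀ w → T (suc k) (a ∷ w)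
    uniform-bar {T} cl G bar = M , λ a g w → reach a g (ℕ.≤⇒≤′ (subst (ℕ._≤ M) (length-yes a g) (proj₂ b a))) w
      where
      length : L → ℕ
      length a with dec (G a)
      ... | yes g = proj₁ (bar a g)
      ... | no  _ = 0

      chosen : ∀ a → G a → Bar (shift a T)
      chosen a g with dec (G a)
      ... | yes g′ = bar a g′
      ... | no ¬g  = ⊥-elim (¬g g)

      length-yes : ∀ a g → length a ≡ proj₁ (chosen a g)
      length-yes a g with dec (G a)
      ... | yes _ = refl
      ... | no ¬g = ⊥-elim (¬g g)

      b : ∃ λ M → ∀ a → length a ℕ.≤ M
      b = bounded 𝓛 length

      M : ℕ
      M = proj₁ b

      reach : ∀ a g {k} → proj₁ (chosen a g) ℕ.≤′ k → ∀ w → T (suc k) (a ∷ w)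
      reach a g (ℕ.≤′-reflexive refl) w = proj₂ (chosen a g) w
      reach a g {suc k} (ℕ.≤′-step p) w with Vec.initLast w
      ... | (v , x , refl) = cl (suc k) (a ∷ v) x (reach a g p v)

    State : Set₁
    State = Σ Event λ T → Closed T × ¬ Bar T

    -- If every first letter led to a barred event, finiteness of the alphabet would give a common
    -- depth and bar the whole. Repeating the escape produces an infinite word that avoids the
    -- event.
    escape : (s : State) → ∃ λ a → ¬ Bar (shift a (proj₁ s))
    escape (T , cl , ¬bar) = ¬∀⇒∃¬ λ all → ¬bar (suc (proj₁ (uni all)) , λ { (a ∷ w) → proj₂ (uni all) a tt w })
      where
      uni : (∀ a → Bar (shift a T)) → ∃ λ k → ∀ a → ⊤ → ∀ w → T (suc k) (a ∷ w)
      uni all = uniform-bar {T} cl (λ _ → ⊤) (λ a _ → all a)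

    next : State → State
    next s = shift (proj₁ (escape s)) (proj₁ s) , shift-closed {proj₁ s} (proj₁ (escape s)) (proj₁ (proj₂ s)) , proj₂ (escape s)

    path : State → Ω
    path s zero    = proj₁ (escape s)
    path s (suc n) = path (next s) n

    path-avoids : ∀ k (s : State) → ¬ proj₁ s k (prefix k (path s))
    path-avoids zero    s t = proj₂ (proj₂ s) (0 , λ { [] → t })
    path-avoids (suc k) s t = path-avoids k (next s) t

    bar : ∀ {T} → Closed T → (∀ ω → ∃ λ k → T k (prefix k ω)) → Bar T
    bar {T} cl covers = ¬¬-elim λ ¬bar → path-avoids (proj₁ (covers (path (T , cl , ¬bar)))) (T , cl , ¬bar) (proj₂ (covers (path (T , cl , ¬bar))))

    -- The source of every lower bound for the measure. By compactness, any cover of the words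
    -- beginning in G is already reached at one common length k + 1, where its probability is at
    -- least that of G.
    outer-first-letter : ∀ (G : L → Set) {S q} → (∀ ω → G (ω 0) → S ω) → Outer S q → E 𝓛 (λ a → ind (G a)) ℚ.≤ q
    outer-first-letter G {S} {q} G⊆S (outer T cl covers small) = ℚ.≤-trans
      (E-mono 𝓛 _ _ λ a → below a)
      (small (suc k))
      where
      cons : L → Ω → Ω
      cons a ω zero    = a
      cons a ω (suc n) = ω n

      tail-covers : ∀ a ω → (∃ λ k → T k (prefix k (cons a ω))) → ∃ λ k → shift a T k (prefix k ω)
      tail-covers a ω (zero  , t) = 0 , cl 0 [] a t
      tail-covers a ω (suc k , t) = k , t

      uni : ∃ λ k → ∀ a → G a → ∀ w → T (suc k) (a ∷ w)
      uni = uniform-bar {T} cl G λ a g → bar {shift a T} (shift-closed {T} a cl) λ ω → tail-covers a ω (covers (cons a ω) (G⊆S (cons a ω) g))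

      k : ℕ
      k = proj₁ uni

      below : ∀ a → ind (G a) ℚ.≤ 𝔼 k (λ w → ind (T (suc k) (a ∷ w)))
      below a with dec (G a)
      ... | yes g = E-≥ (power 𝓛 k) _ _ (λ w → ℚ.≤-reflexive (sym (ind-yes (proj₂ uni a g w))))
      ... | no  _ = E-≥ (power 𝓛 k) _ _ (λ w → 0≤ind (T (suc k) (a ∷ w)))

  ≤-by-ε : ∀ {x y} → (∀ e → 0ℚ ℚ.< e → x ≤ᴿ y +ᴿ fromℚ e) → x ≤ᴿ y
  ≤-by-ε {x} {y} h = mk≤ λ ε 0<ε → ev-map
    (λ n p → subst (approx x n ℚ.≤_) (trans (ℚ.+-assoc (approx y n) _ _) (cong (approx y n ℚ.+_) (half+half ε))) p)
    (_≤ᴿ_.below (h (ε ℚ.* ½) (half 0<ε)) (ε ℚ.* ½) (half 0<ε))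

  ≤-by-rationals : ∀ {x y} → (∀ q → y <ᴿ fromℚ q → x ≤ᴿ fromℚ q) → x ≤ᴿ y
  ≤-by-rationals {x} {y} h = ≤-by-ε λ e 0<e →
    let q , y<q , q≤y+e = rational-above y 0<e in ≤-trans {x} {fromℚ q} {y +ᴿ fromℚ e} (h q y<q) q≤y+e

  -- The outer measure on words, its σ-additivity, and image measures

  module PushForward {L : Set} (𝓛 : Alphabet L) where
    open Tree 𝓛
    open TreeMeasure 𝓛

    module Value (S : Pred Ω 0ℓ) = Infimum (Outer S) outer-≤ outer≥0 (outer-1 S)

    value : Pred Ω 0ℓ → ℝ
    value = Value.inf

    value-≤ : ∀ {S q} → Outer S q → value S ≤ᴿ fromℚ q
    value-≤ {S} = Value.inf-lower S

    value-< : ∀ {S q} → value S <ᴿ fromℚ q → Outer S q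
    value-< {S} = Value.inf-greatest S

    value-≥ : ∀ {S x} → (∀ q → Outer S q → x ≤ᴿ fromℚ q) → x ≤ᴿ value S
    value-≥ {S} {x} h = ≤-by-rationals {x} {value S} λ q v<q → h q (value-< v<q)

    value-mono : ∀ {S S′} → S ⊆ S′ → value S ≤ᴿ value S′
    value-mono {S} {S′} S⊆S′ = value-≥ {S′} {value S} λ q o → value-≤ (outer-⊆ S⊆S′ o)

    0≤value : ∀ S → 0ᴿ ≤ᴿ value S
    0≤value S = value-≥ {S} {0ᴿ} λ q o → fromℚ-mono-≤ (outer≥0 o)

    value-∅ : ∀ {S} → (∀ ω → ¬ S ω) → value S ≈ 0ᴿ
    value-∅ {S} empty = ≤-antisym (value-≤ {S} {0ℚ} (outer-∅ empty ℚ.≤-refl)) (0≤value S)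

    value-U : ∀ {S} → (∀ ω → S ω) → value S ≈ 1ᴿ
    value-U {S} all = ≤-antisym (value-≤ {S} {1ℚ} (outer-1 S)) (value-≥ {S} {1ᴿ} λ q o → fromℚ-mono-≤
      (subst (ℚ._≤ q) (trans (E-cong 𝓛 (λ _ → ind ⊤) (λ _ → 1ℚ) (λ _ → ind-yes tt)) (E-1 𝓛))
        (outer-first-letter (λ _ → ⊤) (λ ω _ → all ω) o)))

    partial : (ℕ → ℝ) → ℕ → ℝ
    partial a M = sum {M} (λ i → a (toℕ i))

    partial-mono : ∀ a → (∀ n → 0ᴿ ≤ᴿ a n) → ∀ {M M′} → M ℕ.≤ M′ → partial a M ≤ᴿ partial a M′
    partial-mono a 0≤a {zero} {zero}   ℕ.z≤n = ≤-refl {0ᴿ}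
    partial-mono a 0≤a {zero} {suc M′} ℕ.z≤n = 0≤+ᴿ (0≤a 0) (partial-mono (a ∘ suc) (0≤a ∘ suc) {zero} {M′} ℕ.z≤n)
    partial-mono a 0≤a (ℕ.s≤s M≤M′) = +ᴿ-mono-≤ (≤-refl {a 0}) (partial-mono (a ∘ suc) (0≤a ∘ suc) M≤M′)

    partial-above : ∀ a q e → (∀ n → fromℚ (q n) ≤ᴿ a n +ᴿ fromℚ (e n)) → ∀ M → fromℚ (∑ℚ M q) ≤ᴿ partial a M +ᴿ fromℚ (∑ℚ M e)
    partial-above a q e h zero    = pt≤ {0ᴿ} {0ᴿ +ᴿ 0ᴿ} λ _ → ℚ.≤-refl
    partial-above a q e h (suc M) = ≤-trans (≈⇒≤ (≈-sym (fromℚ-+ (q 0) (∑ℚ M (q ∘ suc)))))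
      (≤-trans (+ᴿ-mono-≤ (h 0) (partial-above (a ∘ suc) (q ∘ suc) (e ∘ suc) (h ∘ suc) M))
        (≈⇒≤ (pt≈ λ n → solve 4 (λ a e s t → (a :+ e) :+ (s :+ t) := (a :+ s) :+ (e :+ t)) refl
          (approx (a 0) n) (e 0) (approx (partial (a ∘ suc) M) n) (∑ℚ M (e ∘ suc)))))

    module _ (S : ℕ → Pred Ω 0ℓ) (meas : ∀ n → IsMeasurable (S n)) (disjoint : ∀ i j → i ≢ j → ∀ ω → S i ω → ¬ S j ω) where

      -- Splits off one set at a time, spending half of the remaining ε; the family is a variable
      -- because the recursion passes to its tail.
      finite-≤ : ∀ M (S : ℕ → Pred Ω 0ℓ) (meas : ∀ n → IsMeasurable (S n)) (disjoint : ∀ i j → i ≢ j → ∀ ω → S i ω → ¬ S j ω)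
        q → Outer (⋃ ℕ S) q → ∀ ε → 0ℚ ℚ.< ε → partial (λ n → value (S n)) M ≤ᴿ fromℚ (q ℚ.+ ε)
      finite-≤ zero    S meas disjoint q o ε 0<ε = fromℚ-mono-≤ (0≤+ (outer≥0 o) (ℚ.<⇒≤ 0<ε))
      finite-≤ (suc M) S meas disjoint q o ε 0<ε =
        let q₁ , q₂ , o₁ , o₂ , q₁+q₂≤ = outer-split {⋃ ℕ S} {S 0} {⋃ ℕ (S ∘ suc)} (meas 0) (λ ∈S → 0 , ∈S) (λ (n , ∈S) → suc n , ∈S)
              (λ ω ∈S₀ (n , ∈S) → disjoint 0 (suc n) (λ ()) ω ∈S₀ ∈S) o (half 0<ε)
        in ≤-trans (+ᴿ-mono-≤ (value-≤ o₁) (finite-≤ M (S ∘ suc) (meas ∘ suc) (λ i j i≢j → disjoint (suc i) (suc j) (i≢j ∘ ℕ.suc-injective)) q₂ o₂ (ε ℚ.* ½) (half 0<ε)))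
             (≤-trans (≈⇒≤ (fromℚ-+ q₁ (q₂ ℚ.+ ε ℚ.* ½))) (fromℚ-mono-≤ (slack-≤ (q ℚ.+ ε ℚ.* ½ ℚ.- (q₁ ℚ.+ q₂)) (p≤q⇒0≤q-p q₁+q₂≤)
               (solve 4 (λ a b q e → a :+ (b :+ e :* con ½) :+ (q :+ e :* con ½ :- (a :+ b)) := q :+ e) refl q₁ q₂ q ε))))

      private
        a : ℕ → ℝ
        a n = value (S n)

        l : ℝ
        l = value (⋃ ℕ S)

      partial-≤ : ∀ M → partial a M ≤ᴿ l
      partial-≤ M = value-≥ {⋃ ℕ S} {partial a M} λ q o → ≤-by-ε λ e 0<e →
        ≤-trans (finite-≤ M S meas disjoint q o e 0<e) (≈⇒≤ (≈-sym (fromℚ-+ q e)))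

      -- If all partial sums stayed below l - e, near-optimal covers with total excess e/2 would
      -- cover the union at cost at most l - e/2. A rational Q between that and l then contradicts
      -- the definition of l.
      eventually-≥ : ∀ e → 0ℚ ℚ.< e → ∃ λ M → l <ᴿ partial a M +ᴿ fromℚ e
      eventually-≥ e 0<e = ¬¬-elim λ none → contradict (λ M → ≮⇒≥ λ lt → none (M , lt))
        where
        r : ∃ λ Q → l -ᴿ fromℚ (e ℚ.* ½) <ᴿ fromℚ Q × fromℚ Q ≤ᴿ l -ᴿ fromℚ (e ℚ.* ½) +ᴿ fromℚ (e ℚ.* ½ ℚ.* ½)
        r = rational-above (l -ᴿ fromℚ (e ℚ.* ½)) (half (half 0<e))

        Q : ℚ
        Q = proj₁ r

        Q<l : fromℚ Q <ᴿ l
        Q<l = ≤-<-trans (proj₂ (proj₂ r)) (gap⇒< (half (half 0<e)) (≈⇒≤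
          (pt≈ {l -ᴿ fromℚ (e ℚ.* ½) +ᴿ fromℚ (e ℚ.* ½ ℚ.* ½) +ᴿ fromℚ (e ℚ.* ½ ℚ.* ½)} {l}
            λ n → solve 2 (λ l e → l :- e :* con ½ :+ e :* con ½ :* con ½ :+ e :* con ½ :* con ½ := l) refl (approx l n) e)))

        above : ∀ n → ∃ λ q → a n <ᴿ fromℚ q × fromℚ q ≤ᴿ a n +ᴿ fromℚ ((e ℚ.* ½) /2^ n)
        above n = rational-above (a n) (0</2^ n (half 0<e))

        q : ℕ → ℚ
        q n = proj₁ (above n)

        contradict : ¬ (∀ M → partial a M +ᴿ fromℚ e ≤ᴿ l)
        contradict small = <⇒≱ Q<l (value-≤ (outer-⋃ {S} {q} {Q} (λ n → value-< (proj₁ (proj₂ (above n)))) λ M → fromℚ-cancel-≤ (bound M)))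
          where
          bound : ∀ M → fromℚ (∑ℚ M q) ≤ᴿ fromℚ Q
          bound M = begin
            fromℚ (∑ℚ M q)                                        ≲⟨ partial-above a q ((e ℚ.* ½) /2^_) (λ n → proj₂ (proj₂ (above n))) M ⟩
            partial a M +ᴿ fromℚ (∑ℚ M ((e ℚ.* ½) /2^_))          ≲⟨ +ᴿ-mono-≤ (≤-refl {partial a M}) (fromℚ-mono-≤ (∑-/2^ M (ℚ.<⇒≤ (half 0<e)))) ⟩
            partial a M +ᴿ fromℚ (e ℚ.* ½)                        ≈⟨ pt≈ {partial a M +ᴿ fromℚ (e ℚ.* ½)} {partial a M +ᴿ fromℚ e -ᴿ fromℚ (e ℚ.* ½)}
                                                                       (λ n → solve 2 (λ p e → p :+ e :* con ½ := p :+ e :- e :* con ½) refl (approx (partial a M) n) e) ⟩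
            partial a M +ᴿ fromℚ e -ᴿ fromℚ (e ℚ.* ½)             ≲⟨ -ᴿ-mono (small M) ⟩
            l -ᴿ fromℚ (e ℚ.* ½)                                  ≲⟨ <⇒≤ (proj₁ (proj₂ r)) ⟩
            fromℚ Q                                               ∎
            where
            open ≤-Reasoning
            -ᴿ-mono : ∀ {x y z} → x ≤ᴿ y → x -ᴿ z ≤ᴿ y -ᴿ z
            -ᴿ-mono {x} {y} {z} x≤y = slack (y -ᴿ x) (x≤y⇒0≤y-x x≤y)
              (pt≈ λ n → solve 3 (λ x y z → x :- z :+ (y :- x) := y :- z) refl (approx x n) (approx y n) (approx z n))

      value-σ-additive : HasSum a l
      value-σ-additive ε 0<ε = proj₁ late , λ M M≥ → lower M M≥ , upper M
        where
        e : ∃ λ e → 0ℚ ℚ.< e × fromℚ e ≤ᴿ ε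
        e = rational-below 0<ε

        late : ∃ λ M → l <ᴿ partial a M +ᴿ fromℚ (proj₁ e)
        late = eventually-≥ (proj₁ e) (proj₁ (proj₂ e))

        l<l+ε : l <ᴿ l +ᴿ ε
        l<l+ε = gap⇒< (proj₁ (proj₂ e)) (+ᴿ-mono-≤ (≤-refl {l}) (proj₂ (proj₂ e)))

        upper : ∀ M → partial a M <ᴿ l +ᴿ ε
        upper M = ≤-<-trans (partial-≤ M) l<l+ε

        lower : ∀ M → proj₁ late ℕ.≤ M → l -ᴿ ε <ᴿ partial a M
        lower M M≥ = let g , 0<g , l+g≤ = <⇒gap (proj₂ late) in gap⇒< {l -ᴿ ε} {partial a M} 0<g (begin
            l -ᴿ ε +ᴿ fromℚ g                        ≈⟨ pt≈ {l -ᴿ ε +ᴿ fromℚ g} {l +ᴿ fromℚ g -ᴿ ε} (λ n → solve 3 (λ l e g → l :- e :+ g := l :+ g :- e) refl (approx l n) (approx ε n) g) ⟩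
            l +ᴿ fromℚ g -ᴿ ε                        ≲⟨ sub-mono l+g≤ (proj₂ (proj₂ e)) ⟩
            partial a (proj₁ late) +ᴿ fromℚ (proj₁ e) -ᴿ fromℚ (proj₁ e) ≈⟨ pt≈ {partial a (proj₁ late) +ᴿ fromℚ (proj₁ e) -ᴿ fromℚ (proj₁ e)} {partial a (proj₁ late)}
                                                          (λ n → solve 2 (λ p e → p :+ e :- e := p) refl (approx (partial a (proj₁ late)) n) (proj₁ e)) ⟩
            partial a (proj₁ late)                   ≲⟨ partial-mono a (λ n → 0≤value (S n)) M≥ ⟩
            partial a M                              ∎)
          where
          open ≤-Reasoning
          sub-mono : ∀ {x y u v} → x ≤ᴿ y → v ≤ᴿ u → x -ᴿ u ≤ᴿ y -ᴿ v
          sub-mono {x} {y} {u} {v} x≤y v≤u = slack ((y -ᴿ x) +ᴿ (u -ᴿ v)) (0≤+ᴿ (x≤y⇒0≤y-x x≤y) (x≤y⇒0≤y-x v≤u))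
            (pt≈ λ n → solve 4 (λ x y u v → x :- u :+ ((y :- x) :+ (u :- v)) := y :- v) refl (approx x n) (approx y n) (approx u n) (approx v n))

    Continuous : ∀ {d} → (Ω → Space d) → Set
    Continuous Φ = ∀ ω e → 0ℚ ℚ.< e → ∃ λ k → ∀ ω′ → prefix k ω′ ≡ prefix k ω → ∀ j → ∣ Φ ω′ j +ᴿ -ᴿ Φ ω j ∣ᴿ ≤ᴿ fromℚ e

    module _ {d} (Φ : Ω → Space d) (continuous : Continuous Φ) where
      preimage : Pred (Space d) 0ℓ → Pred Ω 0ℓ
      preimage A ω = Φ ω ∈ A

      borel⇒measurable : ∀ {A} → IsBorel A → IsMeasurable (preimage A)
      borel⇒measurable (open′ {A} open-A) = measurable-open T closed covers (λ k ω t → t ω refl)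
        where
        -- All continuations of w must land in A, which makes T sound; continuity makes it reach
        -- every word of the preimage.
        T : Event
        T k w = ∀ ω → prefix k ω ≡ w → Φ ω ∈ A

        closed : Closed T
        closed k w a t ω eq = t ω (Vec.∷ʳ-injectiveˡ (prefix k ω) w (trans (sym (prefix-∷ʳ k ω)) eq))

        covers : Covers T (preimage A)
        covers ω ω∈ = proj₁ c , λ ω′ eq → near n (Φ ω′) (proj₂ c ω′ eq)
          where
          n : Neighbourhood A (Φ ω)
          n = neighbourhood open-A ω∈

          c : ∃ λ k → ∀ ω′ → prefix k ω′ ≡ prefix k ω → ∀ j → ∣ Φ ω′ j +ᴿ -ᴿ Φ ω j ∣ᴿ ≤ᴿ fromℚ (radius n)
          c = continuous ω (radius n) (radius>0 n)
      borel⇒measurable (complement b)         = measurable-∁ (borel⇒measurable b)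
      borel⇒measurable (union b)              = measurable-⋃ (λ n → borel⇒measurable (b n))
      borel⇒measurable (resp (A⊆B , B⊆A) b)   = measurable-resp ((λ ∈ → A⊆B ∈) , (λ ∈ → B⊆A ∈)) (borel⇒measurable b)

      pushForward : ProbabilityMeasure d
      pushForward = record
        { measure = λ A → value (preimage (set A))
        ; resp-≐ = λ A B (A⊆B , B⊆A) → ≤-antisym (value-mono (λ ∈ → A⊆B ∈)) (value-mono (λ ∈ → B⊆A ∈))
        ; nonnegative = λ A → 0≤value (preimage (set A))
        ; empty = λ A (A⊆∅ , _) → value-∅ (λ ω ω∈ → A⊆∅ ω∈)
        ; σ-additive = λ A disjoint → value-σ-additive (λ n → preimage (set (A n))) (λ n → borel⇒measurable (isBorel (A n)))
            (λ i j i≢j ω → disjoint i j i≢j (Φ ω))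
        ; total = λ A (_ , U⊆A) → value-U (λ ω → U⊆A tt)
        }

  -- The uniform measure on a union of boxes

  ∏ℚ : ∀ {d} → (Fin d → ℚ) → ℚ
  ∏ℚ {zero}  f = 1ℚ
  ∏ℚ {suc d} f = f Fin.zero ℚ.* ∏ℚ (f ∘ Fin.suc)

  ∏ℚ-cong : ∀ {d} (f g : Fin d → ℚ) → (∀ j → f j ≡ g j) → ∏ℚ f ≡ ∏ℚ g
  ∏ℚ-cong {zero}  f g eq = refl
  ∏ℚ-cong {suc d} f g eq = cong₂ ℚ._*_ (eq Fin.zero) (∏ℚ-cong (f ∘ Fin.suc) (g ∘ Fin.suc) (eq ∘ Fin.suc))

  0≤∏ℚ : ∀ {d} (f : Fin d → ℚ) → (∀ j → 0ℚ ℚ.≤ f j) → 0ℚ ℚ.≤ ∏ℚ f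
  0≤∏ℚ {zero}  f 0≤f = 0≤1
  0≤∏ℚ {suc d} f 0≤f = 0≤* (0≤f Fin.zero) (0≤∏ℚ (f ∘ Fin.suc) (0≤f ∘ Fin.suc))

  ∏ℚ-mono : ∀ {d} (f g : Fin d → ℚ) → (∀ j → 0ℚ ℚ.≤ f j) → (∀ j → f j ℚ.≤ g j) → ∏ℚ f ℚ.≤ ∏ℚ g
  ∏ℚ-mono {zero}  f g 0≤f f≤g = ℚ.≤-refl
  ∏ℚ-mono {suc d} f g 0≤f f≤g = *-mono-≤-0≤ (ℚ.≤-trans (0≤f Fin.zero) (f≤g Fin.zero)) (0≤∏ℚ (f ∘ Fin.suc) (0≤f ∘ Fin.suc))
    (f≤g Fin.zero) (∏ℚ-mono (f ∘ Fin.suc) (g ∘ Fin.suc) (0≤f ∘ Fin.suc) (f≤g ∘ Fin.suc))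

  coin : Alphabet Bool
  coin = record
    { E = λ f → ½ ℚ.* (f true ℚ.+ f false)
    ; E-mono = λ f g h → *-monoˡ-≤-0≤ (ℚ.<⇒≤ 0<½) (ℚ.+-mono-≤ (h true) (h false))
    ; E-+ = λ f g → solve 4 (λ a b c d → con ½ :* (a :+ b :+ (c :+ d)) := con ½ :* (a :+ c) :+ con ½ :* (b :+ d)) refl (f true) (g true) (f false) (g false)
    ; E-* = λ c f → solve 3 (λ c a b → con ½ :* (c :* a :+ c :* b) := c :* (con ½ :* (a :+ b))) refl c (f true) (f false)
    ; E-1 = refl
    ; bounded = λ f → f true ℕ.⊔ f false , λ { true → ℕ.m≤m⊔n _ _ ; false → ℕ.m≤n⊔m (f true) _ }
    }

  ∑Fin : ∀ {n} → (Fin n → ℚ) → ℚ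
  ∑Fin {zero}  f = 0ℚ
  ∑Fin {suc n} f = f Fin.zero ℚ.+ ∑Fin (f ∘ Fin.suc)

  ∑Fin-mono : ∀ {n} (f g : Fin n → ℚ) → (∀ i → f i ℚ.≤ g i) → ∑Fin f ℚ.≤ ∑Fin g
  ∑Fin-mono {zero}  f g h = ℚ.≤-refl
  ∑Fin-mono {suc n} f g h = ℚ.+-mono-≤ (h Fin.zero) (∑Fin-mono (f ∘ Fin.suc) (g ∘ Fin.suc) (h ∘ Fin.suc))

  ∑Fin-+ : ∀ {n} (f g : Fin n → ℚ) → ∑Fin (λ i → f i ℚ.+ g i) ≡ ∑Fin f ℚ.+ ∑Fin g
  ∑Fin-+ {zero}  f g = refl
  ∑Fin-+ {suc n} f g = trans (cong (f Fin.zero ℚ.+ g Fin.zero ℚ.+_) (∑Fin-+ (f ∘ Fin.suc) (g ∘ Fin.suc)))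
    (solve 4 (λ a b c d → a :+ b :+ (c :+ d) := (a :+ c) :+ (b :+ d)) refl (f Fin.zero) (g Fin.zero) (∑Fin (f ∘ Fin.suc)) (∑Fin (g ∘ Fin.suc)))

  ∑Fin-* : ∀ {n} c (f : Fin n → ℚ) → ∑Fin (λ i → c ℚ.* f i) ≡ c ℚ.* ∑Fin f
  ∑Fin-* {zero}  c f = sym (ℚ.*-zeroʳ c)
  ∑Fin-* {suc n} c f = trans (cong (c ℚ.* f Fin.zero ℚ.+_) (∑Fin-* c (f ∘ Fin.suc))) (sym (ℚ.*-distribˡ-+ c (f Fin.zero) (∑Fin (f ∘ Fin.suc))))

  ∑Fin-1 : ∀ n → ∑Fin {n} (λ _ → 1ℚ) ≡ fromℕ n
  ∑Fin-1 zero    = refl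
  ∑Fin-1 (suc n) = cong (1ℚ ℚ.+_) (∑Fin-1 n)

  ∑Fin-≥ : ∀ {n} (f : Fin n → ℚ) → (∀ i → 0ℚ ℚ.≤ f i) → ∀ i → f i ℚ.≤ ∑Fin f
  ∑Fin-≥ {suc n} f 0≤f Fin.zero = slack-≤ (∑Fin (f ∘ Fin.suc)) (0≤∑ (f ∘ Fin.suc) (0≤f ∘ Fin.suc)) refl
    where
    0≤∑ : ∀ {n} (f : Fin n → ℚ) → (∀ i → 0ℚ ℚ.≤ f i) → 0ℚ ℚ.≤ ∑Fin f
    0≤∑ {zero}  f 0≤f = ℚ.≤-refl
    0≤∑ {suc n} f 0≤f = 0≤+ (0≤f Fin.zero) (0≤∑ (f ∘ Fin.suc) (0≤f ∘ Fin.suc))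
  ∑Fin-≥ {suc n} f 0≤f (Fin.suc i) = slack-≤ (f Fin.zero ℚ.+ (∑Fin (f ∘ Fin.suc) ℚ.- f (Fin.suc i)))
    (0≤+ (0≤f Fin.zero) (p≤q⇒0≤q-p (∑Fin-≥ (f ∘ Fin.suc) (0≤f ∘ Fin.suc) i)))
    (solve 3 (λ x z s → x :+ (z :+ (s :- x)) := z :+ s) refl (f (Fin.suc i)) (f Fin.zero) (∑Fin (f ∘ Fin.suc)))

  maxFin : ∀ {n} (f : Fin n → ℕ) → ∃ λ M → ∀ i → f i ℕ.≤ M
  maxFin {zero}  f = 0 , λ ()
  maxFin {suc n} f = f Fin.zero ℕ.⊔ proj₁ (maxFin (f ∘ Fin.suc)) , λ
    { Fin.zero    → ℕ.m≤m⊔n _ _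
    ; (Fin.suc i) → ℕ.≤-trans (proj₂ (maxFin (f ∘ Fin.suc)) i) (ℕ.m≤n⊔m (f Fin.zero) _) }

  abstract
    1/1+ : ℕ → ℚ
    1/1+ n = proj₁ (divide (0<fromℕ n) 0<1)

    0<1/1+ : ∀ n → 0ℚ ℚ.< 1/1+ n
    0<1/1+ n = proj₁ (proj₂ (divide (0<fromℕ n) 0<1))

    n*1/n : ∀ n → fromℕ (suc n) ℚ.* 1/1+ n ≡ 1ℚ
    n*1/n n = proj₂ (proj₂ (divide (0<fromℕ n) 0<1))

  uniform : ∀ n → Alphabet (Fin (suc n))
  uniform n = record
    { E = λ f → 1/1+ n ℚ.* ∑Fin f
    ; E-mono = λ f g h → *-monoˡ-≤-0≤ (ℚ.<⇒≤ (0<1/1+ n)) (∑Fin-mono f g h)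
    ; E-+ = λ f g → trans (cong (1/1+ n ℚ.*_) (∑Fin-+ f g)) (ℚ.*-distribˡ-+ (1/1+ n) (∑Fin f) (∑Fin g))
    ; E-* = λ c f → trans (cong (1/1+ n ℚ.*_) (∑Fin-* c f)) (solve 3 (λ a c s → a :* (c :* s) := c :* (a :* s)) refl (1/1+ n) c (∑Fin f))
    ; E-1 = trans (cong (1/1+ n ℚ.*_) (∑Fin-1 (suc n))) (trans (ℚ.*-comm (1/1+ n) (fromℕ (suc n))) (n*1/n n))
    ; bounded = maxFin
    }

  _⊗_ : ∀ {A B} → Alphabet A → Alphabet B → Alphabet (A × B)
  𝓐 ⊗ 𝓑 = record
    { E = λ f → E 𝓐 (λ a → E 𝓑 (λ b → f (a , b)))
    ; E-mono = λ f g h → E-mono 𝓐 _ _ (λ a → E-mono 𝓑 _ _ (λ b → h (a , b)))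
    ; E-+ = λ f g → trans (E-cong 𝓐 _ _ (λ a → E-+ 𝓑 (λ b → f (a , b)) (λ b → g (a , b)))) (E-+ 𝓐 _ _)
    ; E-* = λ c f → trans (E-cong 𝓐 _ _ (λ a → E-* 𝓑 c (λ b → f (a , b)))) (E-* 𝓐 c _)
    ; E-1 = trans (E-cong 𝓐 _ _ (λ a → E-1 𝓑)) (E-1 𝓐)
    ; bounded = λ f → proj₁ (bounded 𝓐 (λ a → proj₁ (bounded 𝓑 (λ b → f (a , b))))) , λ
        { (a , b) → ℕ.≤-trans (proj₂ (bounded 𝓑 (λ b → f (a , b))) b) (proj₂ (bounded 𝓐 (λ a → proj₁ (bounded 𝓑 (λ b → f (a , b))))) a) }
    }

  E-second : ∀ {A B} (𝓐 : Alphabet A) (𝓑 : Alphabet B) k (h : Vec B k → ℚ) →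
             E (power (𝓐 ⊗ 𝓑) k) (λ w → h (Vec.map proj₂ w)) ≡ E (power 𝓑 k) h
  E-second 𝓐 𝓑 zero    h = refl
  E-second 𝓐 𝓑 (suc k) h = trans
    (E-cong 𝓐 _ _ (λ a → E-cong 𝓑 _ _ (λ b → E-second 𝓐 𝓑 k (λ w → h (b ∷ w)))))
    (E-const 𝓐 (E (power 𝓑 (suc k)) h))

  independent : ∀ {A} (𝓐 : Alphabet A) d (g : Fin d → A → ℚ) →
                E (power 𝓐 d) (λ s → ∏ℚ (λ j → g j (Vec.lookup s j))) ≡ ∏ℚ (λ j → E 𝓐 (g j))
  independent 𝓐 zero    g = refl
  independent 𝓐 (suc d) g = begin
    E 𝓐 (λ a → E (power 𝓐 d) (λ s → g Fin.zero a ℚ.* ∏ℚ (λ j → g (Fin.suc j) (Vec.lookup s j))))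
      ≡⟨ E-cong 𝓐 _ _ (λ a → trans (E-* (power 𝓐 d) (g Fin.zero a) _) (trans (cong (g Fin.zero a ℚ.*_) (independent 𝓐 d (g ∘ Fin.suc))) (ℚ.*-comm (g Fin.zero a) _))) ⟩
    E 𝓐 (λ a → ∏ℚ (λ j → E 𝓐 (g (Fin.suc j))) ℚ.* g Fin.zero a)
      ≡⟨ E-* 𝓐 (∏ℚ (λ j → E 𝓐 (g (Fin.suc j)))) (g Fin.zero) ⟩
    ∏ℚ (λ j → E 𝓐 (g (Fin.suc j))) ℚ.* E 𝓐 (g Fin.zero)
      ≡⟨ ℚ.*-comm _ (E 𝓐 (g Fin.zero)) ⟩
    ∏ℚ (λ j → E 𝓐 (g j)) ∎
    where open ≡-Reasoning

  row : ∀ {A : Set} {d k} → Fin d → Vec (Vec A d) k → Vec A k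
  row j = Vec.map (λ s → Vec.lookup s j)

  -- Each letter carries one digit for every coordinate. Transposed, the digit sequences of
  -- different coordinates are independent, by `independent` at each letter.
  independent-rows : ∀ {A} (𝓐 : Alphabet A) d k (g : Fin d → Vec A k → ℚ) →
    E (power (power 𝓐 d) k) (λ v → ∏ℚ (λ j → g j (row j v))) ≡ ∏ℚ (λ j → E (power 𝓐 k) (g j))
  independent-rows 𝓐 d zero    g = refl
  independent-rows 𝓐 d (suc k) g = trans
    (E-cong (power 𝓐 d) _ _ (λ s → independent-rows 𝓐 d k (λ j v → g j (Vec.lookup s j ∷ v))))
    (independent 𝓐 d (λ j a → E (power 𝓐 k) (λ v → g j (a ∷ v))))

  <-or-≥ : ∀ p q → p ℚ.< q ⊎ q ℚ.≤ p
  <-or-≥ p q with p ℚ.<? q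
  ... | yes p<q = inj₁ p<q
  ... | no  p≮q = inj₂ (ℚ.≮⇒≥ p≮q)

  -- Distribution of binary fractions

  bit : Bool → ℚ
  bit true  = 1ℚ
  bit false = 0ℚ

  binary : ∀ {k} → Vec Bool k → ℚ
  binary []      = 0ℚ
  binary (b ∷ v) = ½ ℚ.* (bit b ℚ.+ binary v)

  0≤bit : ∀ b → 0ℚ ℚ.≤ bit b
  0≤bit true  = 0≤1
  0≤bit false = ℚ.≤-refl

  bit≤1 : ∀ b → bit b ℚ.≤ 1ℚ
  bit≤1 true  = ℚ.≤-refl
  bit≤1 false = 0≤1

  0≤binary : ∀ {k} (v : Vec Bool k) → 0ℚ ℚ.≤ binary v
  0≤binary []      = ℚ.≤-refl
  0≤binary (b ∷ v) = 0≤* (ℚ.<⇒≤ 0<½) (0≤+ (0≤bit b) (0≤binary v))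

  binary≤1 : ∀ {k} (v : Vec Bool k) → binary v ℚ.≤ 1ℚ
  binary≤1 []      = 0≤1
  binary≤1 (b ∷ v) = slack-≤ (½ ℚ.* ((1ℚ ℚ.- bit b) ℚ.+ (1ℚ ℚ.- binary v)))
    (0≤* (ℚ.<⇒≤ 0<½) (0≤+ (p≤q⇒0≤q-p (bit≤1 b)) (p≤q⇒0≤q-p (binary≤1 v))))
    (solve 2 (λ b v → con ½ :* (b :+ v) :+ con ½ :* ((con 1ℚ :- b) :+ (con 1ℚ :- v)) := con 1ℚ) refl (bit b) (binary v))

  -- The first digit replaces t by 2t - 1 or 2t. If 2t < 1 the first case is empty; if 2t ≥ 1 the
  -- trivial bound 1 is enough in the second. So only one recursive estimate enters, and its error
  -- is halved.
  below : ∀ k t → 0ℚ ℚ.≤ t → E (power coin k) (λ v → ind (binary v ℚ.≤ t)) ℚ.≤ t ℚ.+ ½^ k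
  below zero    t 0≤t = ℚ.≤-trans (ind≤1 (0ℚ ℚ.≤ t)) (slack-≤ t 0≤t (ℚ.+-comm 1ℚ t))
  below (suc k) t 0≤t = ℚ.≤-trans (*-monoˡ-≤-0≤ (ℚ.<⇒≤ 0<½) (ℚ.+-mono-≤ (mono 1ℚ) (mono 0ℚ))) (halves (<-or-≥ (t ℚ.+ t) 1ℚ))
    where
    F : ℚ → ℚ
    F s = E (power coin k) (λ v → ind (binary v ℚ.≤ s))

    mono : ∀ b → E (power coin k) (λ v → ind (½ ℚ.* (b ℚ.+ binary v) ℚ.≤ t)) ℚ.≤ F (t ℚ.+ t ℚ.- b)
    mono b = E-mono (power coin k) _ _ (λ v → ind-mono λ h → slack-≤ ((t ℚ.- ½ ℚ.* (b ℚ.+ binary v)) ℚ.+ (t ℚ.- ½ ℚ.* (b ℚ.+ binary v)))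
      (0≤+ (p≤q⇒0≤q-p h) (p≤q⇒0≤q-p h))
      (solve 3 (λ t b v → v :+ ((t :- con ½ :* (b :+ v)) :+ (t :- con ½ :* (b :+ v))) := t :+ t :- b) refl t b (binary v)))

    halves : t ℚ.+ t ℚ.< 1ℚ ⊎ 1ℚ ℚ.≤ t ℚ.+ t → ½ ℚ.* (F (t ℚ.+ t ℚ.- 1ℚ) ℚ.+ F (t ℚ.+ t ℚ.- 0ℚ)) ℚ.≤ t ℚ.+ ½^ suc k
    halves (inj₂ 1≤2t) = ℚ.≤-trans
      (*-monoˡ-≤-0≤ (ℚ.<⇒≤ 0<½) (ℚ.+-mono-≤ (below k (t ℚ.+ t ℚ.- 1ℚ) (p≤q⇒0≤q-p 1≤2t)) (E-≤ (power coin k) _ 1ℚ (λ v → ind≤1 (binary v ℚ.≤ t ℚ.+ t ℚ.- 0ℚ)))))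
      (ℚ.≤-reflexive (solve 2 (λ t h → con ½ :* (t :+ t :- con 1ℚ :+ h :+ con 1ℚ) := t :+ con ½ :* h) refl t (½^ k)))
    halves (inj₁ 2t<1) = ℚ.≤-trans
      (*-monoˡ-≤-0≤ (ℚ.<⇒≤ 0<½) (ℚ.+-mono-≤
        (E-≤ (power coin k) _ 0ℚ (λ v → ℚ.≤-reflexive (ind-no λ h → ℚ.<-irrefl refl (ℚ.<-≤-trans 2t<1 (1≤2t v h)))))
        (below k (t ℚ.+ t ℚ.- 0ℚ) (ℚ.≤-trans (0≤+ 0≤t 0≤t) (ℚ.≤-reflexive (solve 1 (λ t → t :+ t := t :+ t :- con 0ℚ) refl t))))))
      (ℚ.≤-reflexive (solve 2 (λ t h → con ½ :* (con 0ℚ :+ (t :+ t :- con 0ℚ :+ h)) := t :+ con ½ :* h) refl t (½^ k)))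
      where
      1≤2t : ∀ (v : Vec Bool k) → binary v ℚ.≤ t ℚ.+ t ℚ.- 1ℚ → 1ℚ ℚ.≤ t ℚ.+ t
      1≤2t v h = slack-≤ (t ℚ.+ t ℚ.- 1ℚ) (ℚ.≤-trans (0≤binary v) h) (solve 1 (λ t → con 1ℚ :+ (t :+ t :- con 1ℚ) := t :+ t) refl t)

  strictly-below : ∀ k t → t ℚ.≤ 1ℚ → t ℚ.≤ E (power coin k) (λ v → ind (binary v ℚ.< t))
  strictly-below zero t t≤1 with ℚ.<-cmp 0ℚ t
  ... | tri< 0<t _ _ = subst (t ℚ.≤_) (sym (ind-yes 0<t)) t≤1
  ... | tri≈ _ 0≡t _ = subst (ℚ._≤ ind (0ℚ ℚ.< t)) 0≡t (0≤ind (0ℚ ℚ.< t))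
  ... | tri> _ _ t<0 = ℚ.≤-trans (ℚ.<⇒≤ t<0) (0≤ind (0ℚ ℚ.< t))
  strictly-below (suc k) t t≤1 = ℚ.≤-trans (halves (<-or-≥ 1ℚ (t ℚ.+ t))) (*-monoˡ-≤-0≤ (ℚ.<⇒≤ 0<½) (ℚ.+-mono-≤ (mono 1ℚ) (mono 0ℚ)))
    where
    G : ℚ → ℚ
    G s = E (power coin k) (λ v → ind (binary v ℚ.< s))

    mono : ∀ b → G (t ℚ.+ t ℚ.- b) ℚ.≤ E (power coin k) (λ v → ind (½ ℚ.* (b ℚ.+ binary v) ℚ.< t))
    mono b = E-mono (power coin k) _ _ (λ v → ind-mono λ h → slack-< (½ ℚ.* (t ℚ.+ t ℚ.- b ℚ.- binary v))
      (half′ (p<q⇒0<q-p h))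
      (solve 3 (λ t b v → con ½ :* (b :+ v) :+ con ½ :* (t :+ t :- b :- v) := t) refl t b (binary v)))
      where
      half′ : ∀ {p} → 0ℚ ℚ.< p → 0ℚ ℚ.< ½ ℚ.* p
      half′ = 0<* 0<½

    halves : 1ℚ ℚ.< t ℚ.+ t ⊎ t ℚ.+ t ℚ.≤ 1ℚ → t ℚ.≤ ½ ℚ.* (G (t ℚ.+ t ℚ.- 1ℚ) ℚ.+ G (t ℚ.+ t ℚ.- 0ℚ))
    halves (inj₂ 2t≤1) = ℚ.≤-trans
      (ℚ.≤-reflexive (solve 1 (λ t → t := con ½ :* (con 0ℚ :+ (t :+ t :- con 0ℚ))) refl t))
      (*-monoˡ-≤-0≤ (ℚ.<⇒≤ 0<½) (ℚ.+-mono-≤ (E-≥ (power coin k) _ 0ℚ (λ v → 0≤ind (binary v ℚ.< t ℚ.+ t ℚ.- 1ℚ)))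
        (strictly-below k (t ℚ.+ t ℚ.- 0ℚ) (ℚ.≤-trans (ℚ.≤-reflexive (solve 1 (λ t → t :+ t :- con 0ℚ := t :+ t) refl t)) 2t≤1))))
    halves (inj₁ 1<2t) = ℚ.≤-trans
      (ℚ.≤-reflexive (solve 1 (λ t → t := con ½ :* (t :+ t :- con 1ℚ :+ con 1ℚ)) refl t))
      (*-monoˡ-≤-0≤ (ℚ.<⇒≤ 0<½) (ℚ.+-mono-≤
        (strictly-below k (t ℚ.+ t ℚ.- 1ℚ) (slack-≤ ((1ℚ ℚ.- t) ℚ.+ (1ℚ ℚ.- t)) (0≤+ (p≤q⇒0≤q-p t≤1) (p≤q⇒0≤q-p t≤1))
          (solve 1 (λ t → t :+ t :- con 1ℚ :+ ((con 1ℚ :- t) :+ (con 1ℚ :- t)) := con 1ℚ) refl t)))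
        (E-≥ (power coin k) _ 1ℚ (λ v → ℚ.≤-reflexive (sym (ind-yes (ℚ.≤-<-trans (binary≤1 v)
          (ℚ.<-≤-trans 1<2t (ℚ.≤-reflexive (solve 1 (λ t → t :+ t := t :+ t :- con 0ℚ) refl t))))))))))

  -- A difference of two distribution estimates, at u - c and at l - c - h with h = ½^k. One h is
  -- the error of `below`, the other the tolerance for the missing digits. The estimates apply when
  -- 0 ≤ u - c and l - c - h ≤ 1; otherwise the event is empty.
  interval : ∀ k l u c → l ℚ.≤ u → E (power coin k) (λ v → ind (l ℚ.≤ c ℚ.+ binary v ℚ.+ ½^ k × c ℚ.+ binary v ℚ.≤ u)) ℚ.≤ u ℚ.- l ℚ.+ ½^ k ℚ.+ ½^ k
  interval k l u c l≤u = cases (<-or-≥ (u ℚ.- c) 0ℚ) (<-or-≥ 1ℚ l′)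
    where
    h l′ : ℚ
    h = ½^ k
    l′ = l ℚ.- c ℚ.- h

    P : Vec Bool k → Set
    P v = l ℚ.≤ c ℚ.+ binary v ℚ.+ h × c ℚ.+ binary v ℚ.≤ u

    0≤bound : 0ℚ ℚ.≤ u ℚ.- l ℚ.+ h ℚ.+ h
    0≤bound = 0≤+ (0≤+ (p≤q⇒0≤q-p l≤u) (ℚ.<⇒≤ (0<½^ k))) (ℚ.<⇒≤ (0<½^ k))

    low : ∀ v → P v → l′ ℚ.≤ binary v
    low v (h₁ , _) = slack-≤ (c ℚ.+ binary v ℚ.+ h ℚ.- l) (p≤q⇒0≤q-p h₁)
      (solve 4 (λ l c h v → l :- c :- h :+ (c :+ v :+ h :- l) := v) refl l c h (binary v))

    high : ∀ v → P v → binary v ℚ.≤ u ℚ.- c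
    high v (_ , h₂) = slack-≤ (u ℚ.- (c ℚ.+ binary v)) (p≤q⇒0≤q-p h₂)
      (solve 3 (λ u c v → v :+ (u :- (c :+ v)) := u :- c) refl u c (binary v))

    impossible : (∀ v → ¬ P v) → E (power coin k) (λ v → ind (P v)) ℚ.≤ u ℚ.- l ℚ.+ h ℚ.+ h
    impossible ¬P = E-≤ (power coin k) _ _ (λ v → ℚ.≤-trans (ℚ.≤-reflexive (ind-no (¬P v))) 0≤bound)

    l′≤u-c : l′ ℚ.≤ u ℚ.- c
    l′≤u-c = slack-≤ ((u ℚ.- l) ℚ.+ h) (0≤+ (p≤q⇒0≤q-p l≤u) (ℚ.<⇒≤ (0<½^ k)))
      (solve 4 (λ l c h u → l :- c :- h :+ ((u :- l) :+ h) := u :- c) refl l c h u)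

    main : 0ℚ ℚ.≤ u ℚ.- c → l′ ℚ.≤ 1ℚ → E (power coin k) (λ v → ind (P v)) ℚ.≤ u ℚ.- l ℚ.+ h ℚ.+ h
    main 0≤u-c l′≤1 = slack-≤ ((F ℚ.+ 0ℚ ℚ.- (p ℚ.+ G)) ℚ.+ ((u ℚ.- c ℚ.+ h ℚ.- F) ℚ.+ (G ℚ.- l′)))
      (0≤+ (p≤q⇒0≤q-p count) (0≤+ (p≤q⇒0≤q-p (below k (u ℚ.- c) 0≤u-c)) (p≤q⇒0≤q-p (strictly-below k l′ l′≤1))))
      (solve 7 (λ p F G u l c h → p :+ ((F :+ con 0ℚ :- (p :+ G)) :+ ((u :- c :+ h :- F) :+ (G :- (l :- c :- h)))) := u :- l :+ h :+ h) refl p F G u l c h)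
      where
      p F G : ℚ
      p = E (power coin k) (λ v → ind (P v))
      F = E (power coin k) (λ v → ind (binary v ℚ.≤ u ℚ.- c))
      G = E (power coin k) (λ v → ind (binary v ℚ.< l′))

      count : p ℚ.+ G ℚ.≤ F ℚ.+ 0ℚ
      count = ℚ.≤-trans (E-mono-+ (power coin k) (λ v → ind (P v)) (λ v → ind (binary v ℚ.< l′)) (λ v → ind (binary v ℚ.≤ u ℚ.- c)) (λ _ → ind ⊥)
          (λ v → ind-+ (high v) (λ lt → ℚ.≤-trans (ℚ.<⇒≤ lt) l′≤u-c) (λ P lt → ℚ.<-irrefl refl (ℚ.<-≤-trans lt (low v P)))))
        (ℚ.≤-reflexive (cong (F ℚ.+_) (trans (E-const (power coin k) (ind ⊥)) (ind-no {P = ⊥} (λ ())))))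

    cases : u ℚ.- c ℚ.< 0ℚ ⊎ 0ℚ ℚ.≤ u ℚ.- c → 1ℚ ℚ.< l′ ⊎ l′ ℚ.≤ 1ℚ →
            E (power coin k) (λ v → ind (P v)) ℚ.≤ u ℚ.- l ℚ.+ h ℚ.+ h
    cases (inj₁ u-c<0) _           = impossible λ v p → ℚ.<-irrefl refl (ℚ.≤-<-trans (ℚ.≤-trans (0≤binary v) (high v p)) u-c<0)
    cases _            (inj₁ 1<l′) = impossible λ v p → ℚ.<-irrefl refl (ℚ.<-≤-trans 1<l′ (ℚ.≤-trans (low v p) (binary≤1 v)))
    cases (inj₂ 0≤u-c) (inj₂ l′≤1) = main 0≤u-c l′≤1

  module Coin = Tree coin

  binary-prefix-mono : ∀ {m n} β → m ℕ.≤ n → binary (Coin.prefix m β) ℚ.≤ binary (Coin.prefix n β)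
  binary-prefix-mono {n = n} β ℕ.z≤n = 0≤binary (Coin.prefix n β)
  binary-prefix-mono β (ℕ.s≤s m≤n)   = *-monoˡ-≤-0≤ (ℚ.<⇒≤ 0<½) (ℚ.+-monoʳ-≤ (bit (β 0)) (binary-prefix-mono (β ∘ suc) m≤n))

  binary-prefix-close : ∀ k {m n} β β′ → Coin.prefix k β ≡ Coin.prefix k β′ → k ℕ.≤ m → k ℕ.≤ n →
                        binary (Coin.prefix m β) ℚ.≤ binary (Coin.prefix n β′) ℚ.+ ½^ k
  binary-prefix-close zero {m} {n} β β′ _ _ _ = ℚ.≤-trans (binary≤1 (Coin.prefix m β))
    (slack-≤ (binary (Coin.prefix n β′)) (0≤binary (Coin.prefix n β′)) (ℚ.+-comm 1ℚ (binary (Coin.prefix n β′))))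
  binary-prefix-close (suc k) {suc m} {suc n} β β′ eq (ℕ.s≤s k≤m) (ℕ.s≤s k≤n) = begin
    ½ ℚ.* (bit (β 0) ℚ.+ x)            ≡⟨ cong (λ b → ½ ℚ.* (bit b ℚ.+ x)) (Vec.∷-injectiveˡ eq) ⟩
    ½ ℚ.* (bit (β′ 0) ℚ.+ x)           ≤⟨ *-monoˡ-≤-0≤ (ℚ.<⇒≤ 0<½) (ℚ.+-monoʳ-≤ (bit (β′ 0)) (binary-prefix-close k (β ∘ suc) (β′ ∘ suc) (Vec.∷-injectiveʳ eq) k≤m k≤n)) ⟩
    ½ ℚ.* (bit (β′ 0) ℚ.+ (y ℚ.+ ½^ k)) ≡⟨ solve 3 (λ b y h → con ½ :* (b :+ (y :+ h)) := con ½ :* (b :+ y) :+ con ½ :* h) refl (bit (β′ 0)) y (½^ k) ⟩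
    ½ ℚ.* (bit (β′ 0) ℚ.+ y) ℚ.+ ½^ suc k ∎
    where
    open ℚ.≤-Reasoning
    x y : ℚ
    x = binary (Coin.prefix m (β ∘ suc))
    y = binary (Coin.prefix n (β′ ∘ suc))

  abstract
    binary-cauchy : ∀ β → IsCauchy (λ n → binary (Coin.prefix n β))
    binary-cauchy β ε 0<ε = proj₁ s , λ m n m≥ n≥ → ∣p∣<q (one m n m≥ n≥)
        (subst (ℚ._< ε) (solve 2 (λ a b → b :- a := :- (a :- b)) refl (binary (Coin.prefix m β)) (binary (Coin.prefix n β))) (one n m n≥ m≥))
      where
      s : ∃ λ k → ½^ k ℚ.< ε
      s = ½^-small 0<ε

      one : ∀ m n → proj₁ s ℕ.≤ m → proj₁ s ℕ.≤ n → binary (Coin.prefix m β) ℚ.- binary (Coin.prefix n β) ℚ.< ε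
      one m n m≥ n≥ = slack-< ((y ℚ.+ ½^ proj₁ s ℚ.- x) ℚ.+ (ε ℚ.- ½^ proj₁ s))
        (ℚ.+-mono-≤-< (p≤q⇒0≤q-p (binary-prefix-close (proj₁ s) β β refl m≥ n≥)) (p<q⇒0<q-p (proj₂ s)))
        (solve 4 (λ x y h e → x :- y :+ ((y :+ h :- x) :+ (e :- h)) := e) refl x y (½^ proj₁ s) ε)
        where
        x y : ℚ
        x = binary (Coin.prefix m β)
        y = binary (Coin.prefix n β)

  bits : (ℕ → Bool) → ℝ
  bits β = mkℝ (λ n → binary (Coin.prefix n β)) (binary-cauchy β)

  prefix≤bits : ∀ k β → fromℚ (binary (Coin.prefix k β)) ≤ᴿ bits β
  prefix≤bits k β = ev≤ (k , λ n n≥ → binary-prefix-mono β n≥)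

  bits≤prefix : ∀ k β → bits β ≤ᴿ fromℚ (binary (Coin.prefix k β) ℚ.+ ½^ k)
  bits≤prefix k β = ev≤ (k , λ n n≥ → binary-prefix-close k β β refl n≥ ℕ.≤-refl)

  0≤bits : ∀ β → 0ᴿ ≤ᴿ bits β
  0≤bits β = pt≤ λ n → 0≤binary (Coin.prefix n β)

  bits≤1 : ∀ β → bits β ≤ᴿ 1ᴿ
  bits≤1 β = pt≤ λ n → binary≤1 (Coin.prefix n β)

  bits-close : ∀ k β β′ → Coin.prefix k β ≡ Coin.prefix k β′ → bits β ≤ᴿ bits β′ +ᴿ fromℚ (½^ k)
  bits-close k β β′ eq = ev≤ (k , λ n n≥ → binary-prefix-close k β β′ eq n≥ n≥)

  map-prefix : ∀ {L : Set} (𝓛 : Alphabet L) (f : L → Bool) k (ω : ℕ → L) → Vec.map f (Tree.prefix 𝓛 k ω) ≡ Coin.prefix k (f ∘ ω)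
  map-prefix 𝓛 f zero    ω = refl
  map-prefix 𝓛 f (suc k) ω = cong (f (ω 0) ∷_) (map-prefix 𝓛 f k (ω ∘ suc))

  -- Rational enclosures of boxes

  abs-product-bound : ∀ {d} B (x : Fin d → ℚ) → 0ℚ ℚ.< B → (∀ j → ℚ.∣ x j ∣ ℚ.≤ B) → ∃ λ C → C ≡ ∏ℚ {d} (λ _ → B) × ℚ.∣ ∏ℚ x ∣ ℚ.≤ C
  abs-product-bound {zero}  B x 0<B x≤B = 1ℚ , refl , ℚ.≤-refl
  abs-product-bound {suc d} B x 0<B x≤B = _ , refl , ℚ.≤-trans (ℚ.≤-reflexive (ℚ.∣p*q∣≡∣p∣*∣q∣ (x Fin.zero) (∏ℚ (x ∘ Fin.suc))))
    (*-mono-≤-0≤ (ℚ.<⇒≤ 0<B) (ℚ.0≤∣p∣ (∏ℚ (x ∘ Fin.suc))) (x≤B Fin.zero)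
      (let _ , eq , le = abs-product-bound B (x ∘ Fin.suc) 0<B (x≤B ∘ Fin.suc) in subst (ℚ.∣ ∏ℚ (x ∘ Fin.suc) ∣ ℚ.≤_) eq le))

  abstract
    ∏ℚ-continuous : ∀ d B → 0ℚ ℚ.< B → ∀ {g} → 0ℚ ℚ.< g → ∃ λ δ → 0ℚ ℚ.< δ × (∀ (x y : Fin d → ℚ) → (∀ j → ℚ.∣ x j ∣ ℚ.≤ B) → (∀ j → ℚ.∣ y j ∣ ℚ.≤ B) →
                    (∀ j → y j ℚ.≤ x j ℚ.+ δ) → (∀ j → x j ℚ.≤ y j ℚ.+ δ) → ℚ.∣ ∏ℚ y ℚ.- ∏ℚ x ∣ ℚ.≤ g)
    ∏ℚ-continuous zero    B 0<B {g} 0<g = 1ℚ , 0<1 , λ _ _ _ _ _ _ → ℚ.<⇒≤ 0<g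
    ∏ℚ-continuous (suc d) B 0<B {g} 0<g = δ , 0<δ , close
      where
      C : ℚ
      C = ∏ℚ {d} (λ _ → B) ℚ.+ 1ℚ

      0<C : 0ℚ ℚ.< C
      0<C = ℚ.+-mono-≤-< (0≤∏ℚ {d} (λ _ → B) (λ _ → ℚ.<⇒≤ 0<B)) 0<1

      g₁ : ∃ λ g₁ → 0ℚ ℚ.< g₁ × B ℚ.* g₁ ≡ g ℚ.* ½
      g₁ = divide 0<B (half 0<g)

      δ₁ : ∃ λ δ → 0ℚ ℚ.< δ × (∀ (x y : Fin d → ℚ) → (∀ j → ℚ.∣ x j ∣ ℚ.≤ B) → (∀ j → ℚ.∣ y j ∣ ℚ.≤ B) →
             (∀ j → y j ℚ.≤ x j ℚ.+ δ) → (∀ j → x j ℚ.≤ y j ℚ.+ δ) → ℚ.∣ ∏ℚ y ℚ.- ∏ℚ x ∣ ℚ.≤ proj₁ g₁)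
      δ₁ = ∏ℚ-continuous d B 0<B (proj₁ (proj₂ g₁))

      δ₂ : ∃ λ δ → 0ℚ ℚ.< δ × C ℚ.* δ ≡ g ℚ.* ½
      δ₂ = divide 0<C (half 0<g)

      δ : ℚ
      δ = proj₁ δ₁ ℚ.⊓ proj₁ δ₂

      0<δ : 0ℚ ℚ.< δ
      0<δ = [ (λ eq → subst (0ℚ ℚ.<_) (sym eq) (proj₁ (proj₂ δ₁))) , (λ eq → subst (0ℚ ℚ.<_) (sym eq) (proj₁ (proj₂ δ₂))) ]′ (ℚ.⊓-sel (proj₁ δ₁) (proj₁ δ₂))

      close : ∀ (x y : Fin (suc d) → ℚ) → (∀ j → ℚ.∣ x j ∣ ℚ.≤ B) → (∀ j → ℚ.∣ y j ∣ ℚ.≤ B) →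
              (∀ j → y j ℚ.≤ x j ℚ.+ δ) → (∀ j → x j ℚ.≤ y j ℚ.+ δ) → ℚ.∣ ∏ℚ y ℚ.- ∏ℚ x ∣ ℚ.≤ g
      close x y x≤B y≤B y≤x x≤y = begin
        ℚ.∣ y₀ ℚ.* Y ℚ.- x₀ ℚ.* X ∣
          ≡⟨ cong ℚ.∣_∣ (solve 4 (λ x₀ y₀ X Y → y₀ :* Y :- x₀ :* X := y₀ :* (Y :- X) :+ X :* (y₀ :- x₀)) refl x₀ y₀ X Y) ⟩
        ℚ.∣ y₀ ℚ.* (Y ℚ.- X) ℚ.+ X ℚ.* (y₀ ℚ.- x₀) ∣
          ≤⟨ ℚ.∣p+q∣≤∣p∣+∣q∣ (y₀ ℚ.* (Y ℚ.- X)) (X ℚ.* (y₀ ℚ.- x₀)) ⟩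
        ℚ.∣ y₀ ℚ.* (Y ℚ.- X) ∣ ℚ.+ ℚ.∣ X ℚ.* (y₀ ℚ.- x₀) ∣
          ≡⟨ cong₂ ℚ._+_ (ℚ.∣p*q∣≡∣p∣*∣q∣ y₀ (Y ℚ.- X)) (ℚ.∣p*q∣≡∣p∣*∣q∣ X (y₀ ℚ.- x₀)) ⟩
        ℚ.∣ y₀ ∣ ℚ.* ℚ.∣ Y ℚ.- X ∣ ℚ.+ ℚ.∣ X ∣ ℚ.* ℚ.∣ y₀ ℚ.- x₀ ∣
          ≤⟨ ℚ.+-mono-≤
               (*-mono-≤-0≤ (ℚ.<⇒≤ 0<B) (ℚ.0≤∣p∣ (Y ℚ.- X)) (y≤B Fin.zero)
                 (proj₂ (proj₂ δ₁) (x ∘ Fin.suc) (y ∘ Fin.suc) (x≤B ∘ Fin.suc) (y≤B ∘ Fin.suc) (λ j → weaken (y (Fin.suc j)) (x (Fin.suc j)) (y≤x (Fin.suc j))) (λ j → weaken (x (Fin.suc j)) (y (Fin.suc j)) (x≤y (Fin.suc j)))))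
               (*-mono-≤-0≤ (ℚ.<⇒≤ 0<C) (ℚ.0≤∣p∣ (y₀ ℚ.- x₀)) X≤C y₀-x₀≤) ⟩
        B ℚ.* proj₁ g₁ ℚ.+ C ℚ.* proj₁ δ₂
          ≡⟨ cong₂ ℚ._+_ (proj₂ (proj₂ g₁)) (proj₂ (proj₂ δ₂)) ⟩
        g ℚ.* ½ ℚ.+ g ℚ.* ½
          ≡⟨ half+half g ⟩
        g ∎
        where
        open ℚ.≤-Reasoning
        x₀ y₀ X Y : ℚ
        x₀ = x Fin.zero
        y₀ = y Fin.zero
        X = ∏ℚ (x ∘ Fin.suc)
        Y = ∏ℚ (y ∘ Fin.suc)

        weaken : ∀ a b → a ℚ.≤ b ℚ.+ δ → a ℚ.≤ b ℚ.+ proj₁ δ₁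
        weaken a b h = ℚ.≤-trans {a} {b ℚ.+ δ} {b ℚ.+ proj₁ δ₁} h (ℚ.+-monoʳ-≤ b (ℚ.p⊓q≤p (proj₁ δ₁) (proj₁ δ₂)))

        X≤C : ℚ.∣ X ∣ ℚ.≤ C
        X≤C = let c , eq , le = abs-product-bound B (x ∘ Fin.suc) 0<B (x≤B ∘ Fin.suc) in
          ℚ.≤-trans {ℚ.∣ X ∣} {∏ℚ {d} (λ _ → B)} {C} (subst (ℚ.∣ X ∣ ℚ.≤_) eq le) (slack-≤ 1ℚ 0≤1 refl)

        diff≤ : ∀ {a b} → a ℚ.≤ b ℚ.+ δ → a ℚ.- b ℚ.≤ proj₁ δ₂
        diff≤ {a} {b} h = slack-≤ ((b ℚ.+ δ ℚ.- a) ℚ.+ (proj₁ δ₂ ℚ.- δ)) (0≤+ (p≤q⇒0≤q-p h) (p≤q⇒0≤q-p (ℚ.p⊓q≤q (proj₁ δ₁) (proj₁ δ₂))))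
          (solve 4 (λ a b d e → a :- b :+ ((b :+ d :- a) :+ (e :- d)) := e) refl a b δ (proj₁ δ₂))

        y₀-x₀≤ : ℚ.∣ y₀ ℚ.- x₀ ∣ ℚ.≤ proj₁ δ₂
        y₀-x₀≤ = ∣p∣≤q (diff≤ (y≤x Fin.zero))
          (subst (ℚ._≤ proj₁ δ₂) (solve 2 (λ a b → a :- b := :- (b :- a)) refl x₀ y₀) (diff≤ (x≤y Fin.zero)))

  approx-product : ∀ {d} (f : Vector ℝ d) n → approx (product f) n ≡ ∏ℚ (λ j → approx (f j) n)
  approx-product {zero}  f n = refl
  approx-product {suc d} f n = cong (approx (f Fin.zero) n ℚ.*_) (approx-product (f ∘ Fin.suc) n)

  ev-all : ∀ {d} (P : Fin d → ℕ → Set) → (∀ j → Eventually (P j)) → Eventually λ n → ∀ j → P j n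
  ev-all {zero}  P ev = 0 , λ n _ ()
  ev-all {suc d} P ev = ev-map₂ {P Fin.zero} {λ n → ∀ j → P (Fin.suc j) n} (λ n p q → λ { Fin.zero → p ; (Fin.suc j) → q j })
    (ev Fin.zero) (ev-all (P ∘ Fin.suc) (ev ∘ Fin.suc))

  eventually-near : ∀ x {ε} → 0ℚ ℚ.< ε → Eventually λ n → fromℚ (approx x n ℚ.- ε) ≤ᴿ x × x ≤ᴿ fromℚ (approx x n ℚ.+ ε)
  eventually-near x {ε} 0<ε = proj₁ c , λ n n≥ →
      ev≤ (proj₁ c , λ m m≥ → slack-≤ (approx x m ℚ.+ ε ℚ.- approx x n) (p≤q⇒0≤q-p (ℚ.<⇒≤ (∣p-q∣<r⇒p<q+r {approx x n} {approx x m} (proj₂ c n m n≥ m≥))))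
        (solve 3 (λ a b e → a :- e :+ (b :+ e :- a) := b) refl (approx x n) (approx x m) ε)) ,
      ev≤ (proj₁ c , λ m m≥ → ℚ.<⇒≤ (∣p-q∣<r⇒p<q+r {approx x m} {approx x n} (proj₂ c m n m≥ n≥)))
    where
    c : ∃ λ N → ∀ m n → N ℕ.≤ m → N ℕ.≤ n → ℚ.∣ approx x m ℚ.- approx x n ∣ ℚ.< ε
    c = isCauchy x ε 0<ε

  -- κ leaves room for the resolution of the binary digits.
  record Enclosure {d} (B : Box d) (q : ℚ) : Set where
    open Box B
    field
      l u      : Fin d → ℚ
      κ        : ℚ
      κ>0      : 0ℚ ℚ.< κ
      l≤lower  : ∀ j → fromℚ (l j) ≤ᴿ lower j
      upper≤u  : ∀ j → upper j ≤ᴿ fromℚ (u j)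
      l≤u      : ∀ j → l j ℚ.≤ u j
      thick≤q  : ∏ℚ (λ j → u j ℚ.- l j ℚ.+ κ ℚ.+ κ) ℚ.≤ q

  -- The strict inequality leaves a gap g. Products of bounded sides are uniformly continuous, so
  -- sides widened by a small δ still multiply to at most q.
  enclose : ∀ {d} (B : Box d) {q} → Box.volume B <ᴿ fromℚ q → Enclosure B q
  enclose {d} B {q} (mk< g 0<g vol) = build (ev-map₂ (λ n v p → v , p) vol (ev-all Good good))
    where
    open Box B
    side : Fin d → ℝ
    side j = upper j -ᴿ lower j

    W : ∀ j → ∃ (Bounded (approx (side j)))
    W j = approx-bounded (side j)

    W* : ℚ
    W* = ∑Fin (λ j → proj₁ (W j))

    B₀ : ℚ
    B₀ = W* ℚ.+ 1ℚ

    0<B₀ : 0ℚ ℚ.< B₀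
    0<B₀ = ℚ.+-mono-≤-< (∑≥0 (λ j → proj₁ (W j)) (λ j → ℚ.<⇒≤ (proj₁ (proj₂ (W j))))) 0<1
      where
      ∑≥0 : ∀ {d} (f : Fin d → ℚ) → (∀ j → 0ℚ ℚ.≤ f j) → 0ℚ ℚ.≤ ∑Fin f
      ∑≥0 {zero}  f h = ℚ.≤-refl
      ∑≥0 {suc d} f h = 0≤+ (h Fin.zero) (∑≥0 (f ∘ Fin.suc) (h ∘ Fin.suc))

    cont : ∃ λ δ → 0ℚ ℚ.< δ × (∀ (x y : Fin d → ℚ) → (∀ j → ℚ.∣ x j ∣ ℚ.≤ B₀) → (∀ j → ℚ.∣ y j ∣ ℚ.≤ B₀) →
             (∀ j → y j ℚ.≤ x j ℚ.+ δ) → (∀ j → x j ℚ.≤ y j ℚ.+ δ) → ℚ.∣ ∏ℚ y ℚ.- ∏ℚ x ∣ ℚ.≤ g)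
    cont = ∏ℚ-continuous d B₀ 0<B₀ 0<g

    δ η : ℚ
    -- The cap 1 keeps widened sides within B₀. Each side grows by 4η = δ: 2η for the rational end
    -- points and 2η for the two copies of κ.
    δ = proj₁ cont ℚ.⊓ 1ℚ
    η = δ ℚ.* ½ ℚ.* ½

    0<δ : 0ℚ ℚ.< δ
    0<δ = [ (λ eq → subst (0ℚ ℚ.<_) (sym eq) (proj₁ (proj₂ cont))) , (λ eq → subst (0ℚ ℚ.<_) (sym eq) 0<1) ]′ (ℚ.⊓-sel (proj₁ cont) 1ℚ)

    0<η : 0ℚ ℚ.< η
    0<η = half (half 0<δ)

    Good : Fin d → ℕ → Set
    Good j n = ((fromℚ (approx (lower j) n ℚ.- η) ≤ᴿ lower j × lower j ≤ᴿ fromℚ (approx (lower j) n ℚ.+ η)) ×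
                (fromℚ (approx (upper j) n ℚ.- η) ≤ᴿ upper j × upper j ≤ᴿ fromℚ (approx (upper j) n ℚ.+ η))) ×
               (ℚ.∣ approx (side j) n ∣ ℚ.≤ proj₁ (W j) × approx (lower j) n ℚ.≤ approx (upper j) n ℚ.+ η)

    good : ∀ j → Eventually (Good j)
    good j = ev-map₂ (λ n p q → p , q)
      (ev-map₂ (λ n p q → p , q) (eventually-near (lower j) 0<η) (eventually-near (upper j) 0<η))
      (ev-map₂ (λ n p q → p , q) (proj₂ (proj₂ (W j))) (_≤ᴿ_.below (lower≤upper j) η 0<η))

    build : (Eventually λ n → approx volume n ℚ.+ g ℚ.≤ q × (∀ j → Good j n)) → Enclosure B q
    build (N , ev) = record
      { l = λ j → lo j ℚ.- η ; u = λ j → up j ℚ.+ η ; κ = η ; κ>0 = 0<η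
      ; l≤lower = λ j → proj₁ (proj₁ (proj₁ (proj₂ (ev N ℕ.≤-refl) j)))
      ; upper≤u = λ j → proj₂ (proj₂ (proj₁ (proj₂ (ev N ℕ.≤-refl) j)))
      ; l≤u = λ j → slack-≤ ((up j ℚ.+ η ℚ.- lo j) ℚ.+ η) (0≤+ (p≤q⇒0≤q-p (lo≤up j)) (ℚ.<⇒≤ 0<η))
          (solve 3 (λ a b e → a :- e :+ ((b :+ e :- a) :+ e) := b :+ e) refl (lo j) (up j) η)
      ; thick≤q = thick
      }
      where
      lo up x y : Fin d → ℚ
      lo j = approx (lower j) N
      up j = approx (upper j) N
      x j = up j ℚ.- lo j
      y j = up j ℚ.+ η ℚ.- (lo j ℚ.- η) ℚ.+ η ℚ.+ η

      lo≤up : ∀ j → lo j ℚ.≤ up j ℚ.+ η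
      lo≤up j = proj₂ (proj₂ (proj₂ (ev N ℕ.≤-refl) j))

      y≡x+δ : ∀ j → y j ≡ x j ℚ.+ δ
      y≡x+δ j = solve 3 (λ a b d → b :+ d :* con ½ :* con ½ :- (a :- d :* con ½ :* con ½) :+ d :* con ½ :* con ½ :+ d :* con ½ :* con ½ := b :- a :+ d)
        refl (lo j) (up j) δ

      x≤W : ∀ j → ℚ.∣ x j ∣ ℚ.≤ W*
      x≤W j = ℚ.≤-trans (proj₁ (proj₂ (proj₂ (ev N ℕ.≤-refl) j))) (∑Fin-≥ (λ j → proj₁ (W j)) (λ j → ℚ.<⇒≤ (proj₁ (proj₂ (W j)))) j)

      x≤B₀ : ∀ j → ℚ.∣ x j ∣ ℚ.≤ B₀
      x≤B₀ j = ℚ.≤-trans (x≤W j) (slack-≤ 1ℚ 0≤1 refl)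

      y≤B₀ : ∀ j → ℚ.∣ y j ∣ ℚ.≤ B₀
      y≤B₀ j = subst (λ r → ℚ.∣ r ∣ ℚ.≤ B₀) (sym (y≡x+δ j)) (ℚ.≤-trans (ℚ.∣p+q∣≤∣p∣+∣q∣ (x j) δ)
        (ℚ.+-mono-≤ (x≤W j) (ℚ.≤-trans (ℚ.≤-reflexive (ℚ.0≤p⇒∣p∣≡p (ℚ.<⇒≤ 0<δ))) (ℚ.p⊓q≤q (proj₁ cont) 1ℚ))))

      y≤x+ : ∀ j → y j ℚ.≤ x j ℚ.+ proj₁ cont
      y≤x+ j = ℚ.≤-trans (ℚ.≤-reflexive (y≡x+δ j)) (ℚ.+-monoʳ-≤ (x j) (ℚ.p⊓q≤p (proj₁ cont) 1ℚ))

      x≤y+ : ∀ j → x j ℚ.≤ y j ℚ.+ proj₁ cont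
      x≤y+ j = slack-≤ (δ ℚ.+ proj₁ cont) (0≤+ (ℚ.<⇒≤ 0<δ) (ℚ.<⇒≤ (proj₁ (proj₂ cont))))
        (trans (sym (ℚ.+-assoc (x j) δ (proj₁ cont))) (cong (ℚ._+ proj₁ cont) (sym (y≡x+δ j))))

      thick : ∏ℚ y ℚ.≤ q
      thick = slack-≤ ((g ℚ.- (∏ℚ y ℚ.- ∏ℚ x)) ℚ.+ (q ℚ.- (∏ℚ x ℚ.+ g)))
        (0≤+ (p≤q⇒0≤q-p (ℚ.≤-trans (p≤∣p∣ (∏ℚ y ℚ.- ∏ℚ x)) (proj₂ (proj₂ cont) x y x≤B₀ y≤B₀ y≤x+ x≤y+)))
             (p≤q⇒0≤q-p (subst (λ v → v ℚ.+ g ℚ.≤ q) (approx-product side N) (proj₁ (ev N ℕ.≤-refl)))))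
        (solve 4 (λ Y X g q → Y :+ ((g :- (Y :- X)) :+ (q :- (X :+ g))) := q) refl (∏ℚ y) (∏ℚ x) g q)

  -- The measure, its mass on the unit boxes, and its null sets

  module BoxMeasure {d N′ n : ℕ} (c : Fin (suc N′) → Fin d → Fin n) where
    Letter : Set
    Letter = Fin (suc N′) × Vec Bool d

    𝓛 : Alphabet Letter
    𝓛 = uniform N′ ⊗ power coin d

    open Tree 𝓛
    open TreeMeasure 𝓛
    open PushForward 𝓛

    corner : Fin (suc N′) → Fin d → ℚ
    corner a j = fromℕ (toℕ (c a j))

    digit : Fin d → Letter → Bool
    digit j (_ , s) = Vec.lookup s j

    -- The first letter selects a box; the second components spell the binary
    -- digits of the position in that box.
    Φ : Ω → Space d
    Φ ω j = fromℚ (corner (proj₁ (ω 0)) j) +ᴿ bits (digit j ∘ ω)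

    Φ-in-box : ∀ ω → Φ ω ∈ UnitBox (c (proj₁ (ω 0)))
    Φ-in-box ω j =
        ≤-trans (≈⇒≤ (nat≈fromℕ k)) (slack (bits β) (0≤bits β) (≈-refl {fromℚ (fromℕ k) +ᴿ bits β})) ,
        ≤-trans (+ᴿ-mono-≤ (≈⇒≤ (≈-sym (nat≈fromℕ k))) (bits≤1 β))
          (≈⇒≤ (pt≈ {ℝ′.nat k +ᴿ 1ᴿ} {1ᴿ +ᴿ ℝ′.nat k} λ m → ℚ.+-comm (approx (ℝ′.nat k) m) 1ℚ))
      where
      k : ℕ
      k = toℕ (c (proj₁ (ω 0)) j)

      β : ℕ → Bool
      β = digit j ∘ ω

    same-digits : ∀ k ω ω′ → prefix k ω ≡ prefix k ω′ → ∀ j → Coin.prefix k (digit j ∘ ω) ≡ Coin.prefix k (digit j ∘ ω′)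
    same-digits k ω ω′ eq j = trans (sym (map-prefix 𝓛 (digit j) k ω)) (trans (cong (Vec.map (digit j)) eq) (map-prefix 𝓛 (digit j) k ω′))

    Φ-≤ : ∀ k ω ω′ → prefix (suc k) ω ≡ prefix (suc k) ω′ → ∀ j → Φ ω j ≤ᴿ Φ ω′ j +ᴿ fromℚ (½^ suc k)
    Φ-≤ k ω ω′ eq j = ≤-trans (+ᴿ-mono-≤ (fromℚ-mono-≤ (ℚ.≤-reflexive (cong (λ a → corner (proj₁ a) j) (Vec.∷-injectiveˡ eq))))
        (bits-close (suc k) (digit j ∘ ω) (digit j ∘ ω′) (same-digits (suc k) ω ω′ eq j)))
      (≈⇒≤ (pt≈ λ m → sym (ℚ.+-assoc (corner (proj₁ (ω′ 0)) j) (approx (bits (digit j ∘ ω′)) m) (½^ suc k))))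

    Φ-continuous : Continuous Φ
    Φ-continuous ω e 0<e = suc k , λ ω′ eq j → ∣x∣≤y {Φ ω′ j +ᴿ -ᴿ Φ ω j} {fromℚ e}
        (difference (Φ-≤ k ω′ ω eq j))
        (≤-trans (≈⇒≤ (pt≈ { -ᴿ (Φ ω′ j +ᴿ -ᴿ Φ ω j)} {Φ ω j +ᴿ -ᴿ Φ ω′ j}
            λ m → solve 2 (λ a b → con 0ℚ :- (a :+ (con 0ℚ :- b)) := b :+ (con 0ℚ :- a)) refl (approx (Φ ω′ j) m) (approx (Φ ω j) m)))
          (difference (Φ-≤ k ω ω′ (sym eq) j)))
      where
      k : ℕ
      k = proj₁ (½^-small 0<e)

      ½^≤e : ½^ suc k ℚ.≤ e
      ½^≤e = ℚ.≤-trans (½^-antitone (ℕ.n≤1+n k)) (ℚ.<⇒≤ (proj₂ (½^-small 0<e)))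

      difference : ∀ {x y} → x ≤ᴿ y +ᴿ fromℚ (½^ suc k) → x +ᴿ -ᴿ y ≤ᴿ fromℚ e
      difference {x} {y} h = slack ((y +ᴿ fromℚ (½^ suc k) -ᴿ x) +ᴿ fromℚ (e ℚ.- ½^ suc k))
        (0≤+ᴿ (x≤y⇒0≤y-x h) (fromℚ-mono-≤ (p≤q⇒0≤q-p ½^≤e)))
        (pt≈ λ m → solve 4 (λ x y h e → x :+ (con 0ℚ :- y) :+ ((y :+ h :- x) :+ (e :- h)) := e) refl (approx x m) (approx y m) (½^ suc k) e)

    μ : ProbabilityMeasure d
    μ = pushForward Φ Φ-continuous

    -- Words whose first letter selects box a are mapped into it, and compactness gives this
    -- cylinder at least its probability as outer measure.
    box-mass : ∀ a (A : BorelSet d) → UnitBox (c a) ⊆ set A → fromℚ (1/1+ N′) ≤ᴿ measure μ A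
    box-mass a A box⊆A = value-≥ {preimage Φ Φ-continuous (set A)} {fromℚ (1/1+ N′)} λ q o → fromℚ-mono-≤ (ℚ.≤-trans mass
        (outer-first-letter G (λ ω first → box⊆A (subst (λ b → Φ ω ∈ UnitBox (c b)) first (Φ-in-box ω))) o))
      where
      G : Letter → Set
      G x = proj₁ x ≡ a

      mass : 1/1+ N′ ℚ.≤ E 𝓛 (λ x → ind (G x))
      mass = ℚ.≤-trans (ℚ.≤-reflexive (sym (ℚ.*-identityʳ (1/1+ N′)))) (*-monoˡ-≤-0≤ (ℚ.<⇒≤ (0<1/1+ N′))
        (ℚ.≤-trans (E-≥ (power coin d) (λ s → ind (G (a , s))) 1ℚ (λ s → ℚ.≤-reflexive (sym (ind-yes {P = a ≡ a} refl))))
          (∑Fin-≥ (λ b → E (power coin d) (λ s → ind (G (b , s)))) (λ b → E-≥ (power coin d) (λ s → ind (G (b , s))) 0ℚ (λ s → 0≤ind (b ≡ a))) a)))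

    module _ (B : Box d) (q : ℚ) (enclosure : Enclosure B q) where
      open Box B
      open Enclosure enclosure

      private
        s : ∃ λ k → ½^ k ℚ.< κ
        s = ½^-small κ>0

        k : ℕ
        k = proj₁ s

        h : ℚ
        -- One digit more than κ requires, so that the prefix is nonempty and its first letter
        -- reveals the box.
        h = ½^ suc k

        h≤κ : h ℚ.≤ κ
        h≤κ = ℚ.≤-trans (½^-antitone (ℕ.n≤1+n k)) (ℚ.<⇒≤ (proj₂ s))

        Near : Fin (suc N′) → Fin d → Vec Bool (suc k) → Set
        Near a j v = l j ℚ.≤ corner a j ℚ.+ binary v ℚ.+ h × corner a j ℚ.+ binary v ℚ.≤ u j

        R : Vec Letter (suc k) → Set
        R w = ∀ j → Near (proj₁ (Vec.head w)) j (Vec.map (digit j) w)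

        covers : ∀ ω → Φ ω ∈ Box.points B → R (prefix (suc k) ω)
        covers ω ω∈B j = subst (Near a j) (sym (map-prefix 𝓛 (digit j) (suc k) ω))
          ( fromℚ-cancel-≤ (≤-trans (l≤lower j) (≤-trans (proj₁ (ω∈B j))
              (≤-trans (+ᴿ-mono-≤ (≤-refl {fromℚ (corner a j)}) (bits≤prefix (suc k) β)) (pt≤ λ _ → ℚ.≤-reflexive (sym (ℚ.+-assoc (corner a j) v h))))))
          , fromℚ-cancel-≤ (≤-trans (≈⇒≤ (≈-sym (fromℚ-+ (corner a j) v)))
              (≤-trans (+ᴿ-mono-≤ (≤-refl {fromℚ (corner a j)}) (prefix≤bits (suc k) β)) (≤-trans (proj₂ (ω∈B j)) (upper≤u j)))) )
          where
          a : Fin (suc N′)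
          a = proj₁ (ω 0)

          β : ℕ → Bool
          β = digit j ∘ ω

          v : ℚ
          v = binary (Coin.prefix (suc k) β)

        factor : Fin (suc N′) → Fin d → Vec Bool (suc k) → ℚ
        factor a j v = ind (Near a j v)

        ind-∀ : ∀ {d} (P : Fin d → Set) → ind (∀ j → P j) ℚ.≤ ∏ℚ (λ j → ind (P j))
        ind-∀ {zero}  P = ind≤1 (∀ j → P j)
        ind-∀ {suc d} P = both (dec (P Fin.zero))
          where
          both : Dec (P Fin.zero) → ind (∀ j → P j) ℚ.≤ ind (P Fin.zero) ℚ.* ∏ℚ (λ j → ind (P (Fin.suc j)))
          both (yes p) = subst (λ r → ind (∀ j → P j) ℚ.≤ r ℚ.* ∏ℚ (λ j → ind (P (Fin.suc j)))) (sym (ind-yes p))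
            (ℚ.≤-trans (ind-mono {P = ∀ j → P j} {Q = ∀ j → P (Fin.suc j)} (λ all j → all (Fin.suc j)))
              (ℚ.≤-trans (ind-∀ (λ j → P (Fin.suc j))) (ℚ.≤-reflexive (sym (ℚ.*-identityˡ _)))))
          both (no ¬p) = ℚ.≤-trans (ℚ.≤-reflexive (ind-no {P = ∀ j → P j} (λ all → ¬p (all Fin.zero))))
            (0≤* (0≤ind (P Fin.zero)) (0≤∏ℚ (λ j → ind (P (Fin.suc j))) (λ j → 0≤ind (P (Fin.suc j)))))

        -- Given the box, the expectation factors over the coordinates. Each factor is at most the
        -- side plus two resolutions h, and h ≤ κ is what `thick≤q` allows for.
        box-probability : ∀ a → E (power (power coin d) (suc k)) (λ v → ∏ℚ (λ j → factor a j (row j v))) ℚ.≤ q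
        box-probability a = ℚ.≤-trans (ℚ.≤-reflexive (independent-rows coin d (suc k) (factor a)))
          (ℚ.≤-trans (∏ℚ-mono (λ j → E (power coin (suc k)) (factor a j)) (λ j → u j ℚ.- l j ℚ.+ κ ℚ.+ κ)
              (λ j → E-≥ (power coin (suc k)) (factor a j) 0ℚ (λ v → 0≤ind (Near a j v)))
              (λ j → ℚ.≤-trans (interval (suc k) (l j) (u j) (corner a j) (l≤u j)) (ℚ.+-mono-≤ (ℚ.+-monoʳ-≤ (u j ℚ.- l j) h≤κ) h≤κ)))
            thick≤q)

        selected : Fin (suc N′) → Vec (Vec Bool d) (suc k) → ℚ
        selected a v = ∏ℚ (λ j → factor a j (row j v))

        rows : ∀ j {m} (w : Vec Letter m) → Vec.map (digit j) w ≡ row j (Vec.map proj₂ w)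
        rows j []      = refl
        rows j (x ∷ w) = cong (digit j x ∷_) (rows j w)

        R≤ : ∀ a b w → ind (R ((a , b) ∷ w)) ℚ.≤ selected a (b ∷ Vec.map proj₂ w)
        R≤ a b w = ℚ.≤-trans (ind-∀ (λ j → Near a j (Vec.map (digit j) ((a , b) ∷ w))))
          (ℚ.≤-reflexive (∏ℚ-cong _ _ (λ j → cong (factor a j) (rows j ((a , b) ∷ w)))))

        -- The bound holds for each box separately, hence for their average. The first letter is
        -- treated apart because it alone fixes the box.
        R-probability : 𝔼 (suc k) (λ w → ind (R w)) ℚ.≤ q
        R-probability = E-≤ (uniform N′) _ q λ a → ℚ.≤-trans
          (E-mono (power coin d) _ _ λ b → ℚ.≤-trans (E-mono (power 𝓛 k) _ _ (R≤ a b))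
            (ℚ.≤-reflexive (E-second (uniform N′) (power coin d) k (λ v → selected a (b ∷ v)))))
          (box-probability a)

      box-outer : Outer (preimage Φ Φ-continuous (Box.points B)) q
      box-outer = outer (Decided (suc k) R) (Decided-closed (suc k) R)
        (λ ω ω∈ → suc k , Decided-intro (suc k) R ω (covers ω ω∈))
        (λ m → ℚ.≤-trans (prob-Decided-≤ (suc k) R m) R-probability)

    volume≥0 : ∀ (B : Box d) → 0ᴿ ≤ᴿ Box.volume B
    volume≥0 B = product≥0 (λ j → Box.upper B j -ᴿ Box.lower B j) (λ j → x≤y⇒0≤y-x (Box.lower≤upper B j))
      where
      product≥0 : ∀ {d} (f : Vector ℝ d) → (∀ j → 0ᴿ ≤ᴿ f j) → 0ᴿ ≤ᴿ product f
      product≥0 {zero}  f h = <⇒≤ 0ᴿ<1ᴿ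
      product≥0 {suc d} f h = 0≤*ᴿ (h Fin.zero) (product≥0 (f ∘ Fin.suc) (h ∘ Fin.suc))

    partial≤sum : ∀ a → (∀ n → 0ᴿ ≤ᴿ a n) → ∀ {s} → HasSum a s → ∀ M → partial a M ≤ᴿ s
    partial≤sum a 0≤a {s} has M = ≤-by-ε λ e 0<e → let K , within = has (fromℚ e) (fromℚ-mono-< 0<e) in
      ≤-trans (partial-mono a 0≤a (ℕ.m≤m⊔n M K)) (<⇒≤ (proj₂ (within (M ℕ.⊔ K) (ℕ.m≤n⊔m M K))))

    -- Each covering box is enclosed with excess at most e/2^(n + 1), so the covers on words cost at
    -- most the covering volume plus e.
    covering-outer : ∀ {A : Pred (Space d) 0ℓ} {s} → CoveringVolume A s → ∀ q → s <ᴿ fromℚ q → ∀ e → 0ℚ ℚ.< e →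
                     Outer (preimage Φ Φ-continuous A) (q ℚ.+ e)
    covering-outer {A} {s} (B , A⊆ , has) q s<q e 0<e = outer-⊆ {preimage Φ Φ-continuous A} {⋃ ℕ (λ n → preimage Φ Φ-continuous (Box.points (B n)))} (λ ω∈ → A⊆ ω∈)
        (outer-⋃ {λ n → preimage Φ Φ-continuous (Box.points (B n))} {p} (λ n → box-outer (B n) (p n) (enclose (B n) (proj₁ (proj₂ (above n))))) λ M → fromℚ-cancel-≤ (total M))
      where
      a : ℕ → ℝ
      a n = Box.volume (B n)

      above : ∀ n → ∃ λ p → a n <ᴿ fromℚ p × fromℚ p ≤ᴿ a n +ᴿ fromℚ (e /2^ n)
      above n = rational-above (a n) (0</2^ n 0<e)

      p : ℕ → ℚ
      p n = proj₁ (above n)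

      total : ∀ M → fromℚ (∑ℚ M p) ≤ᴿ fromℚ (q ℚ.+ e)
      total M = ≤-trans (partial-above a p (e /2^_) (λ n → proj₂ (proj₂ (above n))) M)
        (≤-trans (+ᴿ-mono-≤ (≤-trans (partial≤sum a (λ n → volume≥0 (B n)) has M) (<⇒≤ s<q)) (fromℚ-mono-≤ (∑-/2^ M (ℚ.<⇒≤ 0<e))))
          (≈⇒≤ (fromℚ-+ q e)))

    absolutelyContinuous : AbsolutelyContinuous μ
    absolutelyContinuous A (_ , greatest) = ≤-antisym
        (≤-by-ε {measure μ A} {0ᴿ} λ e 0<e → ≤-trans (value-≤ (null e 0<e)) (pt≤ {fromℚ (e ℚ.* ½ ℚ.+ e ℚ.* ½)} {0ᴿ +ᴿ fromℚ e} λ _ → ℚ.≤-reflexive (trans (half+half e) (sym (ℚ.+-identityˡ e)))))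
        (0≤value (preimage Φ Φ-continuous (set A)))
      where
      null : ∀ e → 0ℚ ℚ.< e → Outer (preimage Φ Φ-continuous (set A)) (e ℚ.* ½ ℚ.+ e ℚ.* ½)
      null e 0<e = covering-outer (proj₁ (proj₂ small)) (e ℚ.* ½) (proj₂ (proj₂ small)) (e ℚ.* ½) (half 0<e)
        where
        small : ∃ λ s → CoveringVolume (set A) s × s <ᴿ fromℚ (e ℚ.* ½)
        -- Were every covering volume at least e/2, that number would be a lower bound above the
        -- infimum 0.
        small = ¬¬-elim λ none → <⇒≱ (fromℚ-mono-< (half 0<e)) (greatest (fromℚ (e ℚ.* ½)) λ s cov → ≮⇒≥ λ s<e → none (s , cov , s<e))

  *-1/suc : ∀ n → fromℕ (suc n) ℚ.* (+ 1 / suc n) ≡ 1ℚ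
  *-1/suc n = trans (cong (ℚ._* (+ 1 / suc n)) (fromℕ-/1 (suc n))) (ℚ.toℚᵘ-injective (begin
      ℚ.toℚᵘ ((+ suc n / 1) ℚ.* (+ 1 / suc n))
        ≈⟨ ℚ.toℚᵘ-homo-* (+ suc n / 1) (+ 1 / suc n) ⟩
      ℚ.toℚᵘ (+ suc n / 1) ℚᵘ.* ℚ.toℚᵘ (+ 1 / suc n)
        ≈⟨ ℚᵘ.*-cong (ℚ.toℚᵘ-fromℚᵘ (ℚᵘ.mkℚᵘ (+ suc n) 0)) (ℚ.toℚᵘ-fromℚᵘ (ℚᵘ.mkℚᵘ (+ 1) n)) ⟩
      ℚᵘ.mkℚᵘ (+ suc n) 0 ℚᵘ.* ℚᵘ.mkℚᵘ (+ 1) n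
        ≈⟨ ℚᵘ.*≡* (trans (ℤ.*-identityʳ _) (trans (ℤ.*-comm (+ suc n) (+ 1)) (cong (λ k → + 1 ℤ.* + k) (sym (ℕ.+-identityʳ (suc n)))))) ⟩
      ℚ.toℚᵘ 1ℚ ∎))
    where open ℚᵘ.≃-Reasoning

  -- With N = n + 1, N x = 1 and (N + 1) y = 1, the inequality x ≤ y would give y = N x - N y ≤ 0.
  reciprocals-decrease : ∀ n → ¬ 1/1+ n ℚ.≤ + 1 / suc (suc n)
  reciprocals-decrease n x≤y = ℚ.<-irrefl refl (ℚ.<-≤-trans (0<1/1+ n) (ℚ.≤-trans x≤y y≤0))
    where
    N y : ℚ
    N = fromℕ (suc n)
    y = + 1 / suc (suc n)

    y≤0 : y ℚ.≤ 0ℚ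
    y≤0 = slack-≤ (N ℚ.* y ℚ.- N ℚ.* 1/1+ n) (p≤q⇒0≤q-p (*-monoˡ-≤-0≤ (ℚ.<⇒≤ (0<fromℕ n)) x≤y))
      (begin
        y ℚ.+ (N ℚ.* y ℚ.- N ℚ.* 1/1+ n)     ≡⟨ solve 3 (λ y N x → y :+ (N :* y :- N :* x) := (con 1ℚ :+ N) :* y :- N :* x) refl y N (1/1+ n) ⟩
        (1ℚ ℚ.+ N) ℚ.* y ℚ.- N ℚ.* 1/1+ n    ≡⟨ cong₂ ℚ._-_ (*-1/suc (suc n)) (n*1/n n) ⟩
        1ℚ ℚ.- 1ℚ                            ≡⟨⟩
        0ℚ                                   ∎)
      where open ≡-Reasoning

  -- The number of boxes and the contradiction

  module Counterexample (k m₂ : ℕ) (2d≤m : 2 ℕ.* suc (suc k) ℕ.≤ suc (suc m₂)) where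
    d m N′ : ℕ
    d = suc (suc k)
    m = suc (suc m₂)
    -- Written so that `2 * m` reduces to `suc (suc N′)`: there are N′ + 1 = 2m - 1 boxes, and a
    -- part would weigh 1/(N′ + 2).
    N′ = m₂ ℕ.+ suc (suc m₂ ℕ.+ 0)

    -- Here m ≥ 2d enters: 2(d - 1) + m + 1 ≤ 2m - 1 amounts to 2d + m ≤ 2m.
    enough : suc (suc k ℕ.+ suc k ℕ.+ m) ℕ.≤ suc N′
    enough = ℕ.≤-pred (begin
      suc (suc (suc k ℕ.+ suc k ℕ.+ m))   ≡⟨ ℕ-Solver.solve 2 (λ k m → ℕ-Solver.con 2 ⊕ (ℕ-Solver.con 1 ⊕ k ⊕ (ℕ-Solver.con 1 ⊕ k) ⊕ m) ⊜ ℕ-Solver.con 2 ⊗′ (ℕ-Solver.con 2 ⊕ k) ⊕ m) refl k m ⟩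
      2 ℕ.* d ℕ.+ m                       ≤⟨ ℕ.+-monoˡ-≤ m 2d≤m ⟩
      m ℕ.+ m                             ≡⟨ cong (m ℕ.+_) (ℕ.+-identityʳ m) ⟨
      suc (suc N′)                        ∎)
      where
      open ℕ.≤-Reasoning
      open ℕ-Solver using () renaming (_:+_ to _⊕_; _:*_ to _⊗′_; _:=_ to _⊜_)

    0≢1 : Fin.zero {suc m₂} ≢ Fin.suc Fin.zero
    0≢1 ()

    n′ : ℕ
    n′ = proj₁ (unstabbed-boxes k m (suc N′) 0≢1 enough)

    boxes : Σ (Fin (suc N′) → Fin d → Fin (suc n′)) λ c → ∀ (F : Fan d m) → ∃ λ a → Misses (Fan.hyperplane F) (c a)
    boxes = proj₂ (unstabbed-boxes k m (suc N′) 0≢1 enough)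

    module M = BoxMeasure (proj₁ boxes)

    -- Each of the 2m - 1 boxes is too heavy to fit in a part.
    no-equipartition : ∀ (F : Fan d m) → ¬ Equipartitions F M.μ
    no-equipartition F E = reciprocals-decrease N′ (fromℚ-cancel-≤ (≤-trans
        (M.box-mass (proj₁ missed) (Equipartitions.part E (proj₁ part)) (λ {x} → proj₂ part {x}))
        (≈⇒≤ (Equipartitions.equal E (proj₁ part)))))
      where
      missed : ∃ λ a → Misses (Fan.hyperplane F) (proj₁ boxes a)
      missed = proj₂ boxes F

      part : ∃ λ i → UnitBox (proj₁ boxes (proj₁ missed)) ⊆ set (Equipartitions.part E i)
      part = part-contains-box F M.μ E (proj₁ boxes (proj₁ missed)) (proj₂ missed)

open import Data.Nat.Base using (ℕ; _≤_; _*_)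
open import Data.Product.Base using (Σ; _×_)
open import Relation.Nullary.Negation using (¬_)

theorem8 : Classical →
    ∀ (d : ℕ) → 2 ≤ d →
    ∀ (m : ℕ) → 2 * d ≤ m →
    Σ (ProbabilityMeasure d) λ μ →
    AbsolutelyContinuous μ × (∀ (F : Fan d m) → ¬ Equipartitions F μ)
theorem8 lem (suc (suc k)) 2≤d (suc (suc m)) 2d≤m = M.μ , M.absolutelyContinuous , no-equipartition
  where open Classically.Counterexample lem k m 2d≤m
theorem8 lem (suc (suc k)) 2≤d (suc zero) (ℕ.s≤s ())
theorem8 lem (suc zero) (ℕ.s≤s ())
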